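{- Let $I(\varGamma(\mathbb{Z}_{pqr}),x)$ be the independence polynomial of $\varGamma(\mathbb{Z}_{pqr})$, where $p<q<r$ are primes. Then $x=-1$ is a zero of $I(\varGamma(\mathbb{Z}_{pqr}),x)$ with multiplicity $(p-1)(q+r-2)$, and every other complex zero $x$ of $I(\varGamma(\mathbb{Z}_{pqr}),x)$ satisfies $$\frac12<|1+x|<2.$$
   Context: For a positive integer $n$, the zero divisor graph $\varGamma(\mathbb{Z}_n)$ is the simple undirected graph whose vertices are the non-zero zero divisors of the ring $\mathbb{Z}_n$ of integers modulo $n$ (non-zero $a$ such that $ab=0$ for some non-zero $b$), two distinct vertices $a,b$ being adjacent if and only if $ab=0$ in $\mathbb{Z}_n$. An independent set of a finite graph $G$ is a set of vertices no two of which are adjacent (the empty set included); $\alpha(G)$ is the maximum size of an independent set, and $s_k(G)$ is the number of independent sets of size $k$. The independence polynomial of $G$ is $I(G,x)=\sum_{k=0}^{\alpha(G)} s_k(G)x^k$. -}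

module Defs where

open import Level using (0ℓ)
open import Algebra.Bundles using (RawRing)
open import Data.Fin.Base using (Fin; toℕ)
open import Data.Fin.Properties using (all?; any?; nonZeroIndex)
  renaming (_≟_ to _≟F_)
open import Data.Fin.Subset using (Subset; _∈_; ∣_∣; inside; outside)
open import Data.Fin.Subset.Properties using (_∈?_)
open import Data.Integer.Base as ℤ using (+_; -[1+_])
import Data.Integer.Properties as ℤP
open import Data.List.Base
  using (List; []; _∷_; _++_; map; filter; foldr; length; upTo)
open import Data.Nat.Base as ℕ using (ℕ; zero; suc)
import Data.Nat.Properties as ℕP
open import Data.Nat.DivMod using (_mod_)
open import Data.Product.Base using (∃; _×_; _,_; proj₁; proj₂)
open import Data.Rational.Base as ℚ using (ℚ; mkℚ; 0ℚ; 1ℚ; ½; _/_)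
import Data.Rational.Properties as ℚP
open import Data.Rational.Solver using (module +-*-Solver)
import Data.Rational.Unnormalised.Base as ℚᵘ
import Data.Rational.Unnormalised.Properties as ℚᵘP
open import Data.Sum.Base using (inj₁; inj₂)
open import Data.Vec.Base using ([]; _∷_)
open import Relation.Binary.Core using (Rel)
open import Relation.Binary.Definitions using (Symmetric; Irreflexive)
  renaming (Decidable to Decidable₂)
open import Relation.Binary.PropositionalEquality
  using (_≡_; _≢_; refl; sym; trans; cong; cong₂; subst; subst₂)
open import Relation.Nullary using (¬_; yes; no; contradiction)
open import Relation.Nullary.Decidable using (¬?; _×-dec_; _→-dec_)
open import Relation.Unary using (Pred; Decidable)

------------------------------------------------------------------------
-- Finite simple graphs and independent sets

-- The vertices form a decidable part of Fin n.  The relation Adj carries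
-- information only between vertices: it is never consulted elsewhere.
record SimpleGraph (n : ℕ) : Set₁ where
  field
    IsVertex : Pred (Fin n) 0ℓ
    Adj      : Rel (Fin n) 0ℓ
    vertex?  : Decidable IsVertex
    adj?     : Decidable₂ Adj
    symmetric   : Symmetric Adj
    irreflexive : Irreflexive _≡_ Adj

-- Each subset of Fin n occurs exactly once.
subsets : (n : ℕ) → List (Subset n)
subsets zero    = [] ∷ []
subsets (suc n) = map (outside ∷_) (subsets n) ++ map (inside ∷_) (subsets n)

module _ {n : ℕ} (G : SimpleGraph n) where
  open SimpleGraph G

  IsIndependent : Pred (Subset n) 0ℓ
  IsIndependent S = (∀ a → a ∈ S → IsVertex a)
                  × (∀ a b → a ∈ S → b ∈ S → ¬ Adj a b)

  isIndependent? : Decidable IsIndependent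
  isIndependent? S =
    all? (λ a → (a ∈? S) →-dec vertex? a) ×-dec
    all? (λ a → all? λ b → (a ∈? S) →-dec ((b ∈? S) →-dec ¬? (adj? a b)))

  independentSets : List (Subset n)
  independentSets = filter isIndependent? (subsets n)

  independenceNumber : ℕ
  independenceNumber = foldr ℕ._⊔_ 0 (map ∣_∣ independentSets)

  -- s_k(G)
  countIndependent : ℕ → ℕ
  countIndependent k = length (filter (λ S → ∣ S ∣ ℕP.≟ k) independentSets)

  -- The coefficients s_0 , … , s_α of I(G,x), constant term first.
  independenceCoefficients : List ℕ
  independenceCoefficients = map countIndependent (upTo (suc independenceNumber))

------------------------------------------------------------------------
-- The zero divisor graph of ℤ/n, whose residues are represented by Fin n

infixl 7 _·_

_·_ : ∀ {n} → Fin n → Fin n → Fin n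
_·_ {n} a b = (toℕ a ℕ.* toℕ b) mod n
  where instance _ = nonZeroIndex a

IsZero : ∀ {n} → Pred (Fin n) 0ℓ
IsZero a = toℕ a ≡ 0

isZero? : ∀ {n} → Decidable (IsZero {n})
isZero? a = toℕ a ℕP.≟ 0

IsNonzeroZeroDivisor : ∀ {n} → Pred (Fin n) 0ℓ
IsNonzeroZeroDivisor a = ¬ IsZero a × ∃ λ b → ¬ IsZero b × IsZero (a · b)

·-comm-IsZero : ∀ {n} (a b : Fin n) → IsZero (a · b) → IsZero (b · a)
·-comm-IsZero {suc n} a b =
  subst (λ k → IsZero (k mod suc n)) (ℕP.*-comm (toℕ a) (toℕ b))

zeroDivisorGraph : (n : ℕ) → SimpleGraph n
zeroDivisorGraph n = record
  { IsVertex    = IsNonzeroZeroDivisor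
  ; Adj         = λ a b → a ≢ b × IsZero (a · b)
  ; vertex?     = λ a → ¬? (isZero? a) ×-dec
                        any? (λ b → ¬? (isZero? b) ×-dec isZero? (a · b))
  ; adj?        = λ a b → ¬? (a ≟F b) ×-dec isZero? (a · b)
  ; symmetric   = λ {a} {b} (a≢b , z) → (λ e → a≢b (sym e)) , ·-comm-IsZero a b z
  ; irreflexive = λ a≡b (a≢b , _) → a≢b a≡b
  }

------------------------------------------------------------------------
-- Polynomials, as lists of coefficients with the constant term first;
-- trailing zeros are allowed, so equality is coefficientwise

module Polynomial {c ℓ} (R : RawRing c ℓ) where
  open RawRing R

  infix  4 _≋_
  infixl 6 _⊕_
  infixl 7 _⊗_
  infixr 8 _↑_

  Poly : Set c
  Poly = List Carrier

  coeff : Poly → ℕ → Carrier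
  coeff []      _       = 0#
  coeff (a ∷ f) zero    = a
  coeff (a ∷ f) (suc k) = coeff f k

  _≋_ : Poly → Poly → Set ℓ
  f ≋ g = ∀ k → coeff f k ≈ coeff g k

  _⊕_ : Poly → Poly → Poly
  []      ⊕ g       = g
  f       ⊕ []      = f
  (a ∷ f) ⊕ (b ∷ g) = (a + b) ∷ (f ⊕ g)

  _⊗_ : Poly → Poly → Poly
  []      ⊗ g = []
  (a ∷ f) ⊗ g = map (a *_) g ⊕ (0# ∷ (f ⊗ g))

  _↑_ : Poly → ℕ → Poly
  f ↑ zero  = 1# ∷ []
  f ↑ suc m = f ⊗ (f ↑ m)

  eval : Poly → Carrier → Carrier
  eval []      x = 0#
  eval (a ∷ f) x = a + x * eval f x

  IsZeroOf : Carrier → Poly → Set ℓ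
  IsZeroOf x f = eval f x ≈ 0#

  X-_ : Carrier → Poly
  X- a = (- a) ∷ 1# ∷ []

  IsZeroOfMultiplicity : Carrier → ℕ → Poly → Set _
  IsZeroOfMultiplicity a m f =
    ∃ λ g → f ≋ ((X- a) ↑ m) ⊗ g × ¬ IsZeroOf a g

------------------------------------------------------------------------
-- Elementary facts on ℚ

module RationalLemmas where
  0<½ : 0ℚ ℚ.< ½
  0<½ = ℚP.positive⁻¹ ½

  0<1 : 0ℚ ℚ.< 1ℚ
  0<1 = ℚP.positive⁻¹ 1ℚ

  *-pos : ∀ {a b} → 0ℚ ℚ.< a → 0ℚ ℚ.< b → 0ℚ ℚ.< a ℚ.* b
  *-pos {a} {b} 0<a 0<b =
    ℚP.positive⁻¹ _ {{ℚP.pos*pos⇒pos a {{ℚ.positive 0<a}} b {{ℚ.positive 0<b}}}}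

  *-mono-≤ : ∀ {a b c d} → 0ℚ ℚ.≤ b → 0ℚ ℚ.≤ c →
             a ℚ.≤ b → c ℚ.≤ d → a ℚ.* c ℚ.≤ b ℚ.* d
  *-mono-≤ {a} {b} {c} {d} 0≤b 0≤c a≤b c≤d = ℚP.≤-trans
    (ℚP.*-monoʳ-≤-nonNeg c {{ℚ.nonNegative 0≤c}} a≤b)
    (ℚP.*-monoˡ-≤-nonNeg b {{ℚ.nonNegative 0≤b}} c≤d)

  *-nonNeg : ∀ {a b} → 0ℚ ℚ.≤ a → 0ℚ ℚ.≤ b → 0ℚ ℚ.≤ a ℚ.* b
  *-nonNeg 0≤a 0≤b = *-mono-≤ 0≤a ℚP.≤-refl 0≤a 0≤b

  +-nonNeg : ∀ {a b} → 0ℚ ℚ.≤ a → 0ℚ ℚ.≤ b → 0ℚ ℚ.≤ a ℚ.+ b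
  +-nonNeg = ℚP.+-mono-≤

  halves : ∀ ε → ½ ℚ.* ε ℚ.+ ½ ℚ.* ε ≡ ε
  halves = solve 1 (λ e → con ½ :* e :+ con ½ :* e := e) refl
    where open +-*-Solver

  a≤∣a∣ : ∀ a → a ℚ.≤ ℚ.∣ a ∣
  a≤∣a∣ a with ℚP.≤-total 0ℚ a
  ... | inj₁ 0≤a = ℚP.≤-reflexive (sym (ℚP.0≤p⇒∣p∣≡p 0≤a))
  ... | inj₂ a≤0 = ℚP.≤-trans a≤0 (ℚP.0≤∣p∣ a)

  ∣-∣-comm : ∀ a b → ℚ.∣ a ℚ.- b ∣ ≡ ℚ.∣ b ℚ.- a ∣
  ∣-∣-comm a b = trans (cong ℚ.∣_∣ (eq a b)) (ℚP.∣-p∣≡∣p∣ (b ℚ.- a))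
    where
    open +-*-Solver
    eq : ∀ a b → a ℚ.- b ≡ ℚ.- (b ℚ.- a)
    eq = solve 2 (λ a b → a :- b := :- (b :- a)) refl

  ≤-+-∣-∣ : ∀ a b → a ℚ.≤ b ℚ.+ ℚ.∣ a ℚ.- b ∣
  ≤-+-∣-∣ a b = ℚP.≤-trans (ℚP.≤-reflexive (eq a b))
    (ℚP.+-monoʳ-≤ b (a≤∣a∣ (a ℚ.- b)))
    where
    open +-*-Solver
    eq : ∀ a b → a ≡ b ℚ.+ (a ℚ.- b)
    eq = solve 2 (λ a b → a := b :+ (a :- b)) refl

  ∣-∣-< : ∀ {a b ε} → a ℚ.< b ℚ.+ ε → b ℚ.< a ℚ.+ ε → ℚ.∣ a ℚ.- b ∣ ℚ.< ε
  ∣-∣-< {a} {b} {ε} a<b+ε b<a+ε with ℚP.∣p∣≡p∨∣p∣≡-p (a ℚ.- b)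
  ... | inj₁ e = subst₂ ℚ._<_ (sym e) (eq b ε) (ℚP.+-monoˡ-< (ℚ.- b) a<b+ε)
    where
    open +-*-Solver
    eq : ∀ b ε → b ℚ.+ ε ℚ.- b ≡ ε
    eq = solve 2 (λ b ε → b :+ ε :- b := ε) refl
  ... | inj₂ e = subst₂ ℚ._<_ (trans (eq₁ a b) (sym e)) (eq₂ a ε)
                   (ℚP.+-monoˡ-< (ℚ.- a) b<a+ε)
    where
    open +-*-Solver
    eq₁ : ∀ a b → b ℚ.- a ≡ ℚ.- (a ℚ.- b)
    eq₁ = solve 2 (λ a b → b :- a := :- (a :- b)) refl
    eq₂ : ∀ a ε → a ℚ.+ ε ℚ.- a ≡ ε
    eq₂ = solve 2 (λ a ε → a :+ ε :- a := ε) refl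

  -- δ n = 1/(n+1)
  δ : ℕ → ℚ
  δ n = + 1 / suc n

open RationalLemmas

fromℕ : ℕ → ℚ
fromℕ k = + k / 1

module ArchimedeanLemmas where
  toδ : ∀ n → ℚ.toℚᵘ (δ n) ℚᵘ.≃ ℚᵘ.mkℚᵘ (+ 1) n
  toδ n = ℚP.toℚᵘ-fromℚᵘ (ℚᵘ.mkℚᵘ (+ 1) n)

  toFromℕ : ∀ k → ℚ.toℚᵘ (fromℕ k) ℚᵘ.≃ ℚᵘ.mkℚᵘ (+ k) 0
  toFromℕ k = ℚP.toℚᵘ-fromℚᵘ (ℚᵘ.mkℚᵘ (+ k) 0)

  0≤δ : ∀ n → 0ℚ ℚ.≤ δ n
  0≤δ n = ℚP.nonNegative⁻¹ (δ n) {{ℚP.normalize-nonNeg 1 (suc n)}}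

  0≤fromℕ : ∀ k → 0ℚ ℚ.≤ fromℕ k
  0≤fromℕ k = ℚP.nonNegative⁻¹ (fromℕ k) {{ℚP.normalize-nonNeg k 1}}

  δ-small : ∀ ε → 0ℚ ℚ.< ε → ∃ λ N → ∀ n → N ℕ.≤ n → δ n ℚ.≤ ε
  δ-small (mkℚ (+ zero) d _) (ℚ.*<* (ℤ.+<+ ()))
  δ-small (mkℚ -[1+ _ ] d _) (ℚ.*<* ())
  δ-small (mkℚ (+ suc a) d _) _ = d , λ n d≤n → ℚP.toℚᵘ-cancel-≤
    (ℚᵘP.≤-respˡ-≃ (ℚᵘP.≃-sym {ℚ.toℚᵘ (δ n)} {ℚᵘ.mkℚᵘ (+ 1) n} (toδ n))
      (ℚᵘ.*≤* (ℤ.+≤+ (ℕP.*-mono-≤ {1} {suc a} (ℕ.s≤s ℕ.z≤n) (ℕ.s≤s d≤n)))))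

  fromℕ*δ : ∀ M n → fromℕ (M ℕ.* suc n) ℚ.* δ n ≡ fromℕ M
  fromℕ*δ M n = ℚP.toℚᵘ-injective (begin
    ℚ.toℚᵘ (fromℕ (M ℕ.* suc n) ℚ.* δ n)
      ≈⟨ ℚP.toℚᵘ-homo-* (fromℕ (M ℕ.* suc n)) (δ n) ⟩
    ℚ.toℚᵘ (fromℕ (M ℕ.* suc n)) ℚᵘ.* ℚ.toℚᵘ (δ n)
      ≈⟨ ℚᵘP.*-cong (toFromℕ (M ℕ.* suc n)) (toδ n) ⟩
    ℚᵘ.mkℚᵘ (+ (M ℕ.* suc n)) 0 ℚᵘ.* ℚᵘ.mkℚᵘ (+ 1) n
      ≈⟨ ℚᵘ.*≡* (trans (cong (ℤ._* + 1) (ℤP.*-identityʳ (+ (M ℕ.* suc n))))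
           (trans (ℤP.*-identityʳ (+ (M ℕ.* suc n)))
             (trans (ℤP.pos-* M (suc n))
                (cong (λ k → + M ℤ.* (+ k)) (sym (ℕP.*-identityˡ (suc n))))))) ⟩
    ℚᵘ.mkℚᵘ (+ M) 0
      ≈⟨ ℚᵘP.≃-sym (toFromℕ M) ⟩
    ℚ.toℚᵘ (fromℕ M) ∎)
    where open ℚᵘP.≃-Reasoning

  archimedean : ∀ q → 0ℚ ℚ.≤ q → ∃ λ M → 1ℚ ℚ.≤ fromℕ M × q ℚ.< fromℕ M
  archimedean (mkℚ -[1+ _ ] d _) (ℚ.*≤* ())
  archimedean q@(mkℚ (+ a) d _) _ = suc a ,
    ℚP.toℚᵘ-cancel-≤ (ℚᵘP.≤-respʳ-≃ (ℚᵘP.≃-sym (toFromℕ (suc a)))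
      (ℚᵘ.*≤* (ℤ.+≤+ (ℕ.s≤s ℕ.z≤n)))) ,
    ℚP.toℚᵘ-cancel-< (ℚᵘP.<-respʳ-≃ (ℚᵘP.≃-sym (toFromℕ (suc a)))
      (ℚᵘ.*<* (subst (ℤ._< + suc a ℤ.* + suc d) (sym (ℤP.*-identityʳ (+ a)))
        (ℤ.+<+ (ℕP.m≤m*n (suc a) (suc d))))))

open ArchimedeanLemmas

------------------------------------------------------------------------
-- Real numbers, as Cauchy sequences of rationals

Cauchy : (ℕ → ℚ) → Set
Cauchy u = ∀ ε → 0ℚ ℚ.< ε →
  ∃ λ N → ∀ m n → N ℕ.≤ m → N ℕ.≤ n → ℚ.∣ u m ℚ.- u n ∣ ℚ.< ε

record ℝ : Set where
  constructor mkℝ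
  field
    seq    : ℕ → ℚ
    cauchy : Cauchy seq

open ℝ public

infix 4 _≃ᴿ_ _<ᴿ_

_≃ᴿ_ : Rel ℝ 0ℓ
x ≃ᴿ y = ∀ ε → 0ℚ ℚ.< ε →
  ∃ λ N → ∀ n → N ℕ.≤ n → ℚ.∣ seq x n ℚ.- seq y n ∣ ℚ.< ε

_<ᴿ_ : Rel ℝ 0ℓ
x <ᴿ y = ∃ λ ε → 0ℚ ℚ.< ε ×
  ∃ λ N → ∀ n → N ℕ.≤ n → seq x n ℚ.+ ε ℚ.< seq y n

fromℚ : ℚ → ℝ
fromℚ q = mkℝ (λ _ → q) λ ε 0<ε → 0 , λ _ _ _ _ →
  subst (ℚ._< ε) (cong ℚ.∣_∣ (sym (ℚP.+-inverseʳ q))) 0<ε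

module CauchyLemmas where
  both : ∀ M N {k} → M ℕ.⊔ N ℕ.≤ k → M ℕ.≤ k × N ℕ.≤ k
  both M N le = ℕP.m⊔n≤o⇒m≤o M N le , ℕP.m⊔n≤o⇒n≤o M N le

  +-cauchy : ∀ u v → Cauchy u → Cauchy v → Cauchy (λ n → u n ℚ.+ v n)
  +-cauchy u v cu cv ε 0<ε =
    let M , hu = cu (½ ℚ.* ε) (*-pos 0<½ 0<ε)
        N , hv = cv (½ ℚ.* ε) (*-pos 0<½ 0<ε)
    in M ℕ.⊔ N , λ m n lm ln →
      let open ℚP.≤-Reasoning
          Mm , Nm = both M N lm
          Mn , Nn = both M N ln
      in begin-strict
        ℚ.∣ (u m ℚ.+ v m) ℚ.- (u n ℚ.+ v n) ∣
          ≡⟨ cong ℚ.∣_∣ (eq (u m) (v m) (u n) (v n)) ⟩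
        ℚ.∣ (u m ℚ.- u n) ℚ.+ (v m ℚ.- v n) ∣
          ≤⟨ ℚP.∣p+q∣≤∣p∣+∣q∣ (u m ℚ.- u n) (v m ℚ.- v n) ⟩
        ℚ.∣ u m ℚ.- u n ∣ ℚ.+ ℚ.∣ v m ℚ.- v n ∣
          <⟨ ℚP.+-mono-< (hu m n Mm Mn) (hv m n Nm Nn) ⟩
        ½ ℚ.* ε ℚ.+ ½ ℚ.* ε
          ≡⟨ halves ε ⟩
        ε ∎
    where
    open +-*-Solver
    eq : ∀ a b c d → (a ℚ.+ b) ℚ.- (c ℚ.+ d) ≡ (a ℚ.- c) ℚ.+ (b ℚ.- d)
    eq = solve 4 (λ a b c d → (a :+ b) :- (c :+ d) := (a :- c) :+ (b :- d)) refl

  neg-cauchy : ∀ u → Cauchy u → Cauchy (λ n → ℚ.- u n)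
  neg-cauchy u cu ε 0<ε =
    let N , h = cu ε 0<ε
    in N , λ m n lm ln → subst (ℚ._< ε) (cong ℚ.∣_∣ (eq (u n) (u m))) (h n m ln lm)
    where
    open +-*-Solver
    eq : ∀ a b → a ℚ.- b ≡ (ℚ.- b) ℚ.- (ℚ.- a)
    eq = solve 2 (λ a b → a :- b := (:- b) :- (:- a)) refl

  eventuallyBounded : ∀ u → Cauchy u →
    ∃ λ B → 0ℚ ℚ.< B × ∃ λ N → ∀ n → N ℕ.≤ n → ℚ.∣ u n ∣ ℚ.≤ B
  eventuallyBounded u cu =
    let N , h = cu 1ℚ 0<1
    in ℚ.∣ u N ∣ ℚ.+ 1ℚ , ℚP.+-mono-≤-< (ℚP.0≤∣p∣ (u N)) 0<1 , N , λ n ln →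
      let open ℚP.≤-Reasoning
      in begin
        ℚ.∣ u n ∣                           ≡⟨ cong ℚ.∣_∣ (eq (u n) (u N)) ⟩
        ℚ.∣ u N ℚ.+ (u n ℚ.- u N) ∣         ≤⟨ ℚP.∣p+q∣≤∣p∣+∣q∣ (u N) (u n ℚ.- u N) ⟩
        ℚ.∣ u N ∣ ℚ.+ ℚ.∣ u n ℚ.- u N ∣     ≤⟨ ℚP.+-monoʳ-≤ ℚ.∣ u N ∣
                                                 (ℚP.<⇒≤ (h n N ln ℕP.≤-refl)) ⟩
        ℚ.∣ u N ∣ ℚ.+ 1ℚ                    ∎
    where
    open +-*-Solver
    eq : ∀ a b → a ≡ b ℚ.+ (a ℚ.- b)
    eq = solve 2 (λ a b → a := b :+ (a :- b)) refl

  small-product : ∀ v → Cauchy v → ∀ B → 0ℚ ℚ.< B → ∀ ε → 0ℚ ℚ.< ε →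
    ∃ λ N → ∀ m n → N ℕ.≤ m → N ℕ.≤ n → ∀ {b} → b ℚ.≤ B →
      b ℚ.* ℚ.∣ v m ℚ.- v n ∣ ℚ.< ε
  small-product v cv B 0<B ε 0<ε =
    let N , h = cv (1/B ℚ.* ε) (*-pos 0<1/B 0<ε)
    in N , λ m n lm ln {b} b≤B →
      let open ℚP.≤-Reasoning
      in begin-strict
        b ℚ.* ℚ.∣ v m ℚ.- v n ∣   ≤⟨ ℚP.*-monoʳ-≤-nonNeg ℚ.∣ v m ℚ.- v n ∣
                                      {{ℚ.nonNegative (ℚP.0≤∣p∣ (v m ℚ.- v n))}} b≤B ⟩
        B ℚ.* ℚ.∣ v m ℚ.- v n ∣   <⟨ ℚP.*-monoʳ-<-pos B (h m n lm ln) ⟩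
        B ℚ.* (1/B ℚ.* ε)         ≡⟨ ℚP.*-assoc B 1/B ε ⟨
        B ℚ.* 1/B ℚ.* ε           ≡⟨ cong (ℚ._* ε) (ℚP.*-inverseʳ B) ⟩
        1ℚ ℚ.* ε                  ≡⟨ ℚP.*-identityˡ ε ⟩
        ε                         ∎
    where
    instance
      B-pos : ℚ.Positive B
      B-pos = ℚ.positive 0<B
      B-nonZero : ℚ.NonZero B
      B-nonZero = ℚP.pos⇒nonZero B
    1/B : ℚ
    1/B = ℚ.1/ B
    0<1/B : 0ℚ ℚ.< 1/B
    0<1/B = ℚP.positive⁻¹ 1/B {{ℚP.1/pos⇒pos B}}

  *-cauchy : ∀ u v → Cauchy u → Cauchy v → Cauchy (λ n → u n ℚ.* v n)
  *-cauchy u v cu cv ε 0<ε =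
    let A , 0<A , K , hA = eventuallyBounded u cu
        B , 0<B , L , hB = eventuallyBounded v cv
        M , hv = small-product v cv A 0<A (½ ℚ.* ε) (*-pos 0<½ 0<ε)
        N , hu = small-product u cu B 0<B (½ ℚ.* ε) (*-pos 0<½ 0<ε)
    in (K ℕ.⊔ L) ℕ.⊔ (M ℕ.⊔ N) , λ m n lm ln →
      let open ℚP.≤-Reasoning
          KLm , MNm = both (K ℕ.⊔ L) (M ℕ.⊔ N) lm
          KLn , MNn = both (K ℕ.⊔ L) (M ℕ.⊔ N) ln
          Km , _  = both K L KLm
          _  , Ln = both K L KLn
          Mm , Nm = both M N MNm
          Mn , Nn = both M N MNn
      in begin-strict
        ℚ.∣ u m ℚ.* v m ℚ.- u n ℚ.* v n ∣
          ≡⟨ cong ℚ.∣_∣ (eq (u m) (v m) (u n) (v n)) ⟩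
        ℚ.∣ u m ℚ.* (v m ℚ.- v n) ℚ.+ v n ℚ.* (u m ℚ.- u n) ∣
          ≤⟨ ℚP.∣p+q∣≤∣p∣+∣q∣ (u m ℚ.* (v m ℚ.- v n)) (v n ℚ.* (u m ℚ.- u n)) ⟩
        ℚ.∣ u m ℚ.* (v m ℚ.- v n) ∣ ℚ.+ ℚ.∣ v n ℚ.* (u m ℚ.- u n) ∣
          ≡⟨ cong₂ ℚ._+_ (ℚP.∣p*q∣≡∣p∣*∣q∣ (u m) (v m ℚ.- v n))
                         (ℚP.∣p*q∣≡∣p∣*∣q∣ (v n) (u m ℚ.- u n)) ⟩
        ℚ.∣ u m ∣ ℚ.* ℚ.∣ v m ℚ.- v n ∣ ℚ.+ ℚ.∣ v n ∣ ℚ.* ℚ.∣ u m ℚ.- u n ∣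
          <⟨ ℚP.+-mono-< (hv m n Mm Mn (hA m Km)) (hu m n Nm Nn (hB n Ln)) ⟩
        ½ ℚ.* ε ℚ.+ ½ ℚ.* ε
          ≡⟨ halves ε ⟩
        ε ∎
    where
    open +-*-Solver
    eq : ∀ a b c d → a ℚ.* b ℚ.- c ℚ.* d ≡ a ℚ.* (b ℚ.- d) ℚ.+ d ℚ.* (a ℚ.- c)
    eq = solve 4 (λ a b c d → a :* b :- c :* d := a :* (b :- d) :+ d :* (a :- c)) refl

open CauchyLemmas

infixl 6 _+ᴿ_
infixl 7 _*ᴿ_
infix  8 -ᴿ_

_+ᴿ_ : ℝ → ℝ → ℝ
x +ᴿ y = mkℝ (λ n → seq x n ℚ.+ seq y n)
            (+-cauchy (seq x) (seq y) (cauchy x) (cauchy y))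

_*ᴿ_ : ℝ → ℝ → ℝ
x *ᴿ y = mkℝ (λ n → seq x n ℚ.* seq y n)
            (*-cauchy (seq x) (seq y) (cauchy x) (cauchy y))

-ᴿ_ : ℝ → ℝ
-ᴿ x = mkℝ (λ n → ℚ.- seq x n) (neg-cauchy (seq x) (cauchy x))

------------------------------------------------------------------------
-- Square roots

-- s is the square root of q, rounded down to within 1/(n+1); a negative q
-- is treated as 0.
IsRootApprox : ℚ → ℕ → ℚ → Set
IsRootApprox q n s =
  0ℚ ℚ.≤ s × s ℚ.* s ℚ.≤ q ℚ.⊔ 0ℚ ×
  q ℚ.⊔ 0ℚ ℚ.< (s ℚ.+ + 1 / suc n) ℚ.* (s ℚ.+ + 1 / suc n)

module RootLemmas where
  fromℕ-suc : ∀ k → fromℕ (suc k) ≡ fromℕ k ℚ.+ 1ℚ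
  fromℕ-suc k = ℚP.toℚᵘ-injective (begin
    ℚ.toℚᵘ (fromℕ (suc k))                ≈⟨ toFromℕ (suc k) ⟩
    ℚᵘ.mkℚᵘ (+ suc k) 0                   ≈⟨ ℚᵘ.*≡* (cong (ℤ._* + 1) lemma) ⟩
    ℚᵘ.mkℚᵘ (+ k) 0 ℚᵘ.+ ℚᵘ.1ℚᵘ           ≈⟨ ℚᵘP.+-congˡ ℚᵘ.1ℚᵘ (ℚᵘP.≃-sym (toFromℕ k)) ⟩
    ℚ.toℚᵘ (fromℕ k) ℚᵘ.+ ℚ.toℚᵘ 1ℚ       ≈⟨ ℚᵘP.≃-sym (ℚP.toℚᵘ-homo-+ (fromℕ k) 1ℚ) ⟩
    ℚ.toℚᵘ (fromℕ k ℚ.+ 1ℚ)               ∎)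
    where
    open ℚᵘP.≃-Reasoning
    lemma : + suc k ≡ + k ℤ.* + 1 ℤ.+ + 1
    lemma = sym (trans (cong (ℤ._+ + 1) (ℤP.*-identityʳ (+ k)))
                       (cong +_ (ℕP.+-comm k 1)))

  descend : ∀ q n k → 0ℚ ℚ.≤ q →
    q ℚ.< (fromℕ k ℚ.* δ n) ℚ.* (fromℕ k ℚ.* δ n) →
    ∃ λ s → 0ℚ ℚ.≤ s × s ℚ.* s ℚ.≤ q × q ℚ.< (s ℚ.+ δ n) ℚ.* (s ℚ.+ δ n)
  descend q n zero 0≤q q<0 = contradiction
    (ℚP.≤-<-trans 0≤q (ℚP.<-≤-trans q<0 (ℚP.≤-reflexive (eq (δ n)))))
    (ℚP.<-irrefl refl)
    where
    open +-*-Solver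
    eq : ∀ d → (0ℚ ℚ.* d) ℚ.* (0ℚ ℚ.* d) ≡ 0ℚ
    eq = solve 1 (λ d → (con 0ℚ :* d) :* (con 0ℚ :* d) := con 0ℚ) refl
  descend q n (suc k) 0≤q q< with q ℚP.<? (fromℕ k ℚ.* δ n) ℚ.* (fromℕ k ℚ.* δ n)
  ... | yes q<′ = descend q n k 0≤q q<′
  ... | no  q≮  = fromℕ k ℚ.* δ n , *-nonNeg (0≤fromℕ k) (0≤δ n) , ℚP.≮⇒≥ q≮ ,
    subst (λ t → q ℚ.< t ℚ.* t)
      (trans (cong (ℚ._* δ n) (fromℕ-suc k)) (eq (fromℕ k) (δ n))) q<
    where
    open +-*-Solver
    eq : ∀ a d → (a ℚ.+ 1ℚ) ℚ.* d ≡ a ℚ.* d ℚ.+ d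
    eq = solve 2 (λ a d → (a :+ con 1ℚ) :* d := a :* d :+ d) refl

open RootLemmas

rootApprox : ∀ q n → ∃ (IsRootApprox q n)
rootApprox q n =
  let M , 1≤M , q<M = archimedean (q ℚ.⊔ 0ℚ) (ℚP.p≤q⊔p q 0ℚ)
      open ℚP.≤-Reasoning
  in descend (q ℚ.⊔ 0ℚ) n (M ℕ.* suc n) (ℚP.p≤q⊔p q 0ℚ)
    (subst (λ t → q ℚ.⊔ 0ℚ ℚ.< t ℚ.* t) (sym (fromℕ*δ M n)) (begin-strict
      q ℚ.⊔ 0ℚ             <⟨ q<M ⟩
      fromℕ M              ≡⟨ ℚP.*-identityˡ (fromℕ M) ⟨
      1ℚ ℚ.* fromℕ M       ≤⟨ ℚP.*-monoʳ-≤-nonNeg (fromℕ M)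
                                {{ℚ.nonNegative (0≤fromℕ M)}} 1≤M ⟩
      fromℕ M ℚ.* fromℕ M  ∎))

module RootCauchy where
  ⊔0-near : ∀ a b → a ℚ.⊔ 0ℚ ℚ.≤ (b ℚ.⊔ 0ℚ) ℚ.+ ℚ.∣ a ℚ.- b ∣
  ⊔0-near a b = ℚP.⊔-lub
    (ℚP.≤-trans (≤-+-∣-∣ a b) (ℚP.+-monoˡ-≤ ℚ.∣ a ℚ.- b ∣ (ℚP.p≤p⊔q b 0ℚ)))
    (+-nonNeg (ℚP.p≤q⊔p b 0ℚ) (ℚP.0≤∣p∣ (a ℚ.- b)))

  root-near : ∀ ε → 0ℚ ℚ.< ε → ∀ {a b m n s t} →
    ℚ.∣ a ℚ.- b ∣ ℚ.< ½ ℚ.* (ε ℚ.* ε) → δ n ℚ.≤ ½ ℚ.* ε →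
    IsRootApprox a m s → IsRootApprox b n t → s ℚ.< t ℚ.+ ε
  root-near ε 0<ε {a} {b} {m} {n} {s} {t} ab<η δ≤ (0≤s , s²≤a , _) (0≤t , _ , b<)
    with s ℚP.<? t ℚ.+ ε
  ... | yes s<t+ε = s<t+ε
  ... | no  s≮t+ε = contradiction chain (ℚP.<-irrefl refl)
    where
    open ℚP.≤-Reasoning
    0≤ε = ℚP.<⇒≤ 0<ε
    0≤½ε = ℚP.<⇒≤ (*-pos 0<½ 0<ε)
    t+ε≤s = ℚP.≮⇒≥ s≮t+ε
    t+δ≤ = ℚP.+-monoʳ-≤ t δ≤
    η = ½ ℚ.* (ε ℚ.* ε)
    eq : ∀ t ε → (t ℚ.+ ε) ℚ.* (t ℚ.+ ε) ≡
         ((t ℚ.+ ½ ℚ.* ε) ℚ.* (t ℚ.+ ½ ℚ.* ε) ℚ.+ ½ ℚ.* (ε ℚ.* ε))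
         ℚ.+ (t ℚ.* ε ℚ.+ (½ ℚ.* ε) ℚ.* (½ ℚ.* ε))
    eq = +-*-Solver.solve 2 (λ t e → (t :+ e) :* (t :+ e) :=
           ((t :+ con ½ :* e) :* (t :+ con ½ :* e) :+ con ½ :* (e :* e))
           :+ (t :* e :+ (con ½ :* e) :* (con ½ :* e))) refl
      where open +-*-Solver
    chain : (t ℚ.+ ε) ℚ.* (t ℚ.+ ε) ℚ.< (t ℚ.+ ε) ℚ.* (t ℚ.+ ε)
    chain = begin-strict
      (t ℚ.+ ε) ℚ.* (t ℚ.+ ε)
        ≤⟨ *-mono-≤ 0≤s (+-nonNeg 0≤t 0≤ε) t+ε≤s t+ε≤s ⟩
      s ℚ.* s                          ≤⟨ s²≤a ⟩
      a ℚ.⊔ 0ℚ                         ≤⟨ ⊔0-near a b ⟩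
      (b ℚ.⊔ 0ℚ) ℚ.+ ℚ.∣ a ℚ.- b ∣     <⟨ ℚP.+-mono-< b< ab<η ⟩
      (t ℚ.+ δ n) ℚ.* (t ℚ.+ δ n) ℚ.+ η
        ≤⟨ ℚP.+-monoˡ-≤ η (*-mono-≤ (+-nonNeg 0≤t 0≤½ε) (+-nonNeg 0≤t (0≤δ n))
             t+δ≤ t+δ≤) ⟩
      (t ℚ.+ ½ ℚ.* ε) ℚ.* (t ℚ.+ ½ ℚ.* ε) ℚ.+ η
        ≡⟨ ℚP.+-identityʳ _ ⟨
      ((t ℚ.+ ½ ℚ.* ε) ℚ.* (t ℚ.+ ½ ℚ.* ε) ℚ.+ η) ℚ.+ 0ℚ
        ≤⟨ ℚP.+-monoʳ-≤ ((t ℚ.+ ½ ℚ.* ε) ℚ.* (t ℚ.+ ½ ℚ.* ε) ℚ.+ η)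
             (+-nonNeg (*-nonNeg 0≤t 0≤ε) (*-nonNeg 0≤½ε 0≤½ε)) ⟩
      ((t ℚ.+ ½ ℚ.* ε) ℚ.* (t ℚ.+ ½ ℚ.* ε) ℚ.+ η)
        ℚ.+ (t ℚ.* ε ℚ.+ (½ ℚ.* ε) ℚ.* (½ ℚ.* ε))
        ≡⟨ eq t ε ⟨
      (t ℚ.+ ε) ℚ.* (t ℚ.+ ε) ∎

  √-cauchy : ∀ u → Cauchy u → Cauchy (λ n → proj₁ (rootApprox (u n) n))
  √-cauchy u cu ε 0<ε =
    let M , h = cu (½ ℚ.* (ε ℚ.* ε)) (*-pos 0<½ (*-pos 0<ε 0<ε))
        N , d = δ-small (½ ℚ.* ε) (*-pos 0<½ 0<ε)
    in M ℕ.⊔ N , λ m n lm ln →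
      let Mm , Nm = both M N lm
          Mn , Nn = both M N ln
          rm = proj₂ (rootApprox (u m) m)
          rn = proj₂ (rootApprox (u n) n)
      in ∣-∣-< (root-near ε 0<ε {u m} {u n} {m} {n} (h m n Mm Mn) (d n Nn) rm rn)
               (root-near ε 0<ε {u n} {u m} {n} {m} (h n m Mn Mm) (d m Nm) rn rm)

open RootCauchy

√_ : ℝ → ℝ
√ x = mkℝ (λ n → proj₁ (rootApprox (seq x n) n)) (√-cauchy (seq x) (cauchy x))

------------------------------------------------------------------------
-- Complex numbers

record ℂ : Set where
  constructor _+i_
  field
    re im : ℝ

open ℂ public

infix 4 _≃_

_≃_ : Rel ℂ 0ℓ
z ≃ w = re z ≃ᴿ re w × im z ≃ᴿ im w

ℂ-rawRing : RawRing 0ℓ 0ℓ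
ℂ-rawRing = record
  { Carrier = ℂ
  ; _≈_     = _≃_
  ; _+_     = λ z w → (re z +ᴿ re w) +i (im z +ᴿ im w)
  ; _*_     = λ z w → (re z *ᴿ re w +ᴿ -ᴿ (im z *ᴿ im w))
                   +i (re z *ᴿ im w +ᴿ im z *ᴿ re w)
  ; -_      = λ z → (-ᴿ re z) +i (-ᴿ im z)
  ; 0#      = fromℚ 0ℚ +i fromℚ 0ℚ
  ; 1#      = fromℚ 1ℚ +i fromℚ 0ℚ
  }

open RawRing ℂ-rawRing public using ()
  renaming (_+_ to _+ᶜ_; _*_ to _*ᶜ_; -_ to -ᶜ_; 0# to 0ᶜ; 1# to 1ᶜ)

infix 10 ‖_‖

‖_‖ : ℂ → ℝ
‖ z ‖ = √ (re z *ᴿ re z +ᴿ im z *ᴿ im z)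

open Polynomial ℂ-rawRing public

independencePolynomial : ∀ {n} → SimpleGraph n → Poly
independencePolynomial G =
  map (λ k → fromℚ (fromℕ k) +i fromℚ 0ℚ) (independenceCoefficients G)

{-# OPTIONS --safe #-}
-- Vertices of Γ(ℤ_pqr) fall into six classes, according to which of p, q, r
-- divide them, and adjacency depends on the classes only.  The elements of
-- three classes (exactly two of the primes) are joined pairwise across
-- classes; an independent set meets at most one of these classes, and so with
-- y = 1 + x and (a, b, c) = (p-1, q-1, r-1), inclusion-exclusion gives
--
--   I = y^(ab+ac+bc) + Σ (y^(a+ab+ac) - y^(ab+ac)),
--
-- the sum being over the cyclic rotations of (a, b, c).  The least exponent is
-- ab + ac = (p-1)(q+r-2), with coefficient -1.  After division by that power
-- the constant term -1 dominates for |y| ≤ 101/200, and the leading term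
-- dominates for |y| ≥ 200/101, because the gaps between the exponents are large
-- enough.  These estimates hold with a margin, so a single Gaussian rational
-- approximation of y decides constructively whether y lies in an excluded region.
module Submission where

open import Defs
open import Level using (0ℓ)
open import Algebra.Bundles using (CommutativeRing)
import Algebra.Properties.CommutativeSemiring.Exp
import Algebra.Solver.Ring.AlmostCommutativeRing as ACR
import Algebra.Solver.Ring.Simple
open import Algebra.Structures using (IsCommutativeRing)
open import Data.Bool.Base using (Bool; true; false; _∧_; _∨_; not; if_then_else_)
open import Data.Bool.Properties using (∧-assoc)
open import Data.Empty using (⊥; ⊥-elim)
open import Data.Fin.Base using (Fin; zero; suc; toℕ; fromℕ<)
open import Data.Fin.Properties using (toℕ<n; toℕ-fromℕ<; nonZeroIndex)
open import Data.Fin.Subset using (Subset; ∣_∣; _∈_; inside; outside)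
open import Data.Integer.Base as ℤ using (+_)
import Data.Integer.Properties as ℤP
open import Data.List.Base
  using (List; []; _∷_; _++_; map; filter; foldr; length; upTo; applyUpTo)
open import Data.List.Properties using (map-∘; map-applyUpTo; filter-accept; filter-reject)
open import Data.Nat.Base as ℕ using (ℕ; zero; suc; _≤_; _<_; _∸_)
open import Data.Nat.Divisibility
open import Data.Nat.Primality
  using (Prime; ¬prime[0]; euclidsLemma; prime⇒nonZero; prime⇒nonTrivial)
import Data.Nat.Properties as ℕP
import Data.Nat.Solver
open import Data.Product.Base using (_×_; _,_; proj₁; proj₂; ∃)
open import Data.Rational.Base as ℚ using (ℚ; 0ℚ; 1ℚ; ½; _/_)
import Data.Rational.Properties as ℚP
open import Data.Rational.Solver using (module +-*-Solver)
open import Data.Rational.Unnormalised.Base using (*≡*)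
import Data.Rational.Unnormalised.Properties as ℚᵘP
open import Data.Sum.Base using (_⊎_; inj₁; inj₂; [_,_]′)
open import Data.Vec.Base using ([]; _∷_; here; there)
open import Function.Base using (_∘_; id)
open import Function.Bundles using (mk⇔)
open import Function.Definitions using (Injective)
open import Relation.Binary.Definitions using (DecidableEquality; tri<; tri≈; tri>)
open import Relation.Binary.PropositionalEquality
open import Relation.Nullary using (¬_; Dec; does; yes; no; contradiction)
open import Relation.Nullary.Decidable
  using (map′; _×-dec_; _⊎-dec_; from-yes; dec-true; dec-false; does-⇔)
open import Relation.Unary using (Pred; Decidable)
open import Algebra.Properties.CommutativeMonoid.Sum ℕP.+-0-commutativeMonoid
  using (sum; sum-cong-≗; ∑-distrib-+)

open RationalLemmas
open ArchimedeanLemmas using (toFromℕ; δ-small; 0≤δ)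

-- The obstacle is constructive: a complex number here is a pair of Cauchy sequences, so neither |1
-- + x| ≤ 1/2 nor x = -1 is decidable. All algebra and all estimates are therefore carried out over
-- the Gaussian rationals, where equality and order are decidable; the operations on sequences act
-- term by term, so every result transfers index by index. A Cauchy sequence can only be located
-- relative to two distinct thresholds, hence the excluded disc has to reach beyond 1/2 and the
-- outer region has to start below 2. The room is small: against a dominating term of modulus at
-- least 1, the remaining six contribute at most ρ + ρ² + ρ³ + ρ⁴ + ρ⁶ + ρ⁷, about 0.961 at ρ = 1/2
-- and 0.979 at ρ = 101/200. Inside the disc the conclusion x = -1 is reached as a limit: the value
-- is a power of y times a factor bounded away from 0, so y tends to 0. The coefficientwise equality
-- that multiplicity demands is recovered from equal values at infinitely many points.

module ℕ-Solver = Data.Nat.Solver.+-*-Solver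

-- Rationals

≤⇒≯ : ∀ {a b} → a ℚ.≤ b → ¬ b ℚ.< a
≤⇒≯ a≤b b<a = ℚP.<-irrefl refl (ℚP.<-≤-trans b<a a≤b)

0≤a² : ∀ a → 0ℚ ℚ.≤ a ℚ.* a
0≤a² a with ℚP.≤-total 0ℚ a
... | inj₁ 0≤a = *-nonNeg 0≤a 0≤a
... | inj₂ a≤0 = subst (0ℚ ℚ.≤_) (eq a) (*-nonNeg 0≤-a 0≤-a)
  where
  open +-*-Solver
  0≤-a = ℚP.neg-antimono-≤ a≤0
  eq : ∀ a → (ℚ.- a) ℚ.* (ℚ.- a) ≡ a ℚ.* a
  eq = solve 1 (λ a → (:- a) :* (:- a) := a :* a) refl

sq-mono-≤ : ∀ {a b} → 0ℚ ℚ.≤ a → a ℚ.≤ b → a ℚ.* a ℚ.≤ b ℚ.* b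
sq-mono-≤ 0≤a a≤b = *-mono-≤ (ℚP.≤-trans 0≤a a≤b) 0≤a a≤b a≤b

sq-cancel-< : ∀ {a b} → 0ℚ ℚ.≤ b → a ℚ.* a ℚ.< b ℚ.* b → a ℚ.< b
sq-cancel-< 0≤b a²<b² =
  ℚP.≰⇒> λ b≤a → ≤⇒≯ (sq-mono-≤ 0≤b b≤a) a²<b²

sq-cancel-≤ : ∀ {a b} → 0ℚ ℚ.< a → 0ℚ ℚ.≤ b → a ℚ.* a ℚ.≤ b ℚ.* b → a ℚ.≤ b
sq-cancel-≤ {a} {b} 0<a 0≤b a²≤b² = ℚP.≮⇒≥ λ b<a → ≤⇒≯ a²≤b² (b²<a² b<a)
  where
  b²<a² : b ℚ.< a → b ℚ.* b ℚ.< a ℚ.* a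
  b²<a² b<a = ℚP.≤-<-trans
    (ℚP.*-monoˡ-≤-nonNeg b {{ℚ.nonNegative 0≤b}} (ℚP.<⇒≤ b<a))
    (ℚP.*-monoˡ-<-pos a {{ℚ.positive 0<a}} b<a)

∣a∣² : ∀ a → ℚ.∣ a ∣ ℚ.* ℚ.∣ a ∣ ≡ a ℚ.* a
∣a∣² a with ℚP.∣p∣≡p∨∣p∣≡-p a
... | inj₁ e = cong₂ ℚ._*_ e e
... | inj₂ e = trans (cong₂ ℚ._*_ e e) (eq a)
  where
  open +-*-Solver
  eq : ∀ a → (ℚ.- a) ℚ.* (ℚ.- a) ≡ a ℚ.* a
  eq = solve 1 (λ a → (:- a) :* (:- a) := a :* a) refl

fromℕ-injective : ∀ {m n} → fromℕ m ≡ fromℕ n → m ≡ n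
fromℕ-injective {m} {n} e = ℤP.+-injective (begin
    + m               ≡⟨ ℤP.*-identityʳ (+ m) ⟨
    + m ℤ.* + 1       ≡⟨ m≡n ⟩
    + n ℤ.* + 1       ≡⟨ ℤP.*-identityʳ (+ n) ⟩
    + n               ∎)
  where
  open ≡-Reasoning
  m≡n : + m ℤ.* + 1 ≡ + n ℤ.* + 1
  m≡n with ℚᵘP.≃-trans (ℚᵘP.≃-sym (toFromℕ m))
             (ℚᵘP.≃-trans (ℚᵘP.≃-reflexive (cong ℚ.toℚᵘ e)) (toFromℕ n))
  ... | *≡* eq = eq

-- Gaussian rationals

record ℚ[i] : Set where
  constructor ⟨_,_⟩
  field
    real imag : ℚ

open ℚ[i]

infixl 6 _+_
infixl 7 _*_
infix  8 -_

0# 1# : ℚ[i]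
0# = ⟨ 0ℚ , 0ℚ ⟩
1# = ⟨ 1ℚ , 0ℚ ⟩

-- Opaque, since the components of a product of several factors are exponentially large.
opaque
  _+_ _*_ : ℚ[i] → ℚ[i] → ℚ[i]
  z + w = ⟨ real z ℚ.+ real w , imag z ℚ.+ imag w ⟩
  z * w = ⟨ real z ℚ.* real w ℚ.+ ℚ.- (imag z ℚ.* imag w)
          , real z ℚ.* imag w ℚ.+ imag z ℚ.* real w ⟩

  -_ : ℚ[i] → ℚ[i]
  - z = ⟨ ℚ.- real z , ℚ.- imag z ⟩

opaque
  unfolding _+_ _*_ -_

  isCommutativeRing : IsCommutativeRing _≡_ _+_ _*_ -_ 0# 1#
  isCommutativeRing = record
    { isRing = record
      { +-isAbelianGroup = record
        { isGroup = record
          { isMonoid = record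
            { isSemigroup = record
              { isMagma = record { isEquivalence = isEquivalence ; ∙-cong = cong₂ _ }
              ; assoc = λ { ⟨ a , b ⟩ ⟨ c , d ⟩ ⟨ e , f ⟩ →
                  cong₂ ⟨_,_⟩ (ℚP.+-assoc a c e) (ℚP.+-assoc b d f) } }
            ; identity = (λ { ⟨ a , b ⟩ →
                  cong₂ ⟨_,_⟩ (ℚP.+-identityˡ a) (ℚP.+-identityˡ b) })
              , λ { ⟨ a , b ⟩ →
                  cong₂ ⟨_,_⟩ (ℚP.+-identityʳ a) (ℚP.+-identityʳ b) } }
          ; inverse = (λ { ⟨ a , b ⟩ →
                cong₂ ⟨_,_⟩ (ℚP.+-inverseˡ a) (ℚP.+-inverseˡ b) })
            , λ { ⟨ a , b ⟩ →
                cong₂ ⟨_,_⟩ (ℚP.+-inverseʳ a) (ℚP.+-inverseʳ b) }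
          ; ⁻¹-cong = cong -_ }
        ; comm = λ { ⟨ a , b ⟩ ⟨ c , d ⟩ →
            cong₂ ⟨_,_⟩ (ℚP.+-comm a c) (ℚP.+-comm b d) } }
      ; *-cong = cong₂ _
      ; *-assoc = λ { ⟨ a , b ⟩ ⟨ c , d ⟩ ⟨ e , f ⟩ → cong₂ ⟨_,_⟩
          (solve 6 (λ a b c d e f →
             (a :* c :+ :- (b :* d)) :* e :+ :- ((a :* d :+ b :* c) :* f) :=
             a :* (c :* e :+ :- (d :* f)) :+ :- (b :* (c :* f :+ d :* e)))
             refl a b c d e f)
          (solve 6 (λ a b c d e f →
             (a :* c :+ :- (b :* d)) :* f :+ (a :* d :+ b :* c) :* e :=
             a :* (c :* f :+ d :* e) :+ b :* (c :* e :+ :- (d :* f)))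
             refl a b c d e f) }
      ; *-identity = (λ { ⟨ a , b ⟩ → cong₂ ⟨_,_⟩
            (solve 2 (λ a b → con 1ℚ :* a :+ :- (con 0ℚ :* b) := a) refl a b)
            (solve 2 (λ a b → con 1ℚ :* b :+ con 0ℚ :* a := b) refl a b) })
        , λ { ⟨ a , b ⟩ → cong₂ ⟨_,_⟩
            (solve 2 (λ a b → a :* con 1ℚ :+ :- (b :* con 0ℚ) := a) refl a b)
            (solve 2 (λ a b → a :* con 0ℚ :+ b :* con 1ℚ := b) refl a b) }
      ; distrib = (λ { ⟨ a , b ⟩ ⟨ c , d ⟩ ⟨ e , f ⟩ → cong₂ ⟨_,_⟩
            (solve 6 (λ a b c d e f →
               a :* (c :+ e) :+ :- (b :* (d :+ f)) :=
               (a :* c :+ :- (b :* d)) :+ (a :* e :+ :- (b :* f)))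
               refl a b c d e f)
            (solve 6 (λ a b c d e f →
               a :* (d :+ f) :+ b :* (c :+ e) :=
               (a :* d :+ b :* c) :+ (a :* f :+ b :* e))
               refl a b c d e f) })
        , λ { ⟨ a , b ⟩ ⟨ c , d ⟩ ⟨ e , f ⟩ → cong₂ ⟨_,_⟩
            (solve 6 (λ a b c d e f →
               (c :+ e) :* a :+ :- ((d :+ f) :* b) :=
               (c :* a :+ :- (d :* b)) :+ (e :* a :+ :- (f :* b)))
               refl a b c d e f)
            (solve 6 (λ a b c d e f →
               (c :+ e) :* b :+ (d :+ f) :* a :=
               (c :* b :+ d :* a) :+ (e :* b :+ f :* a))
               refl a b c d e f) } }
    ; *-comm = λ { ⟨ a , b ⟩ ⟨ c , d ⟩ → cong₂ ⟨_,_⟩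
        (solve 4 (λ a b c d → a :* c :+ :- (b :* d) := c :* a :+ :- (d :* b))
          refl a b c d)
        (solve 4 (λ a b c d → a :* d :+ b :* c := c :* b :+ d :* a)
          refl a b c d) } }
    where open +-*-Solver

ℚ[i]-commutativeRing : CommutativeRing 0ℓ 0ℓ
ℚ[i]-commutativeRing = record { isCommutativeRing = isCommutativeRing }

infix 4 _≟_

_≟_ : DecidableEquality ℚ[i]
⟨ a , b ⟩ ≟ ⟨ c , d ⟩ =
  map′ (λ (e , f) → cong₂ ⟨_,_⟩ e f) (λ { refl → refl , refl })
    (a ℚP.≟ c ×-dec b ℚP.≟ d)

open CommutativeRing ℚ[i]-commutativeRing
  using (_-_; rawRing; commutativeSemiring; +-identityˡ; +-identityʳ; +-assoc;
         *-identityˡ; *-identityʳ; *-assoc; zeroˡ; zeroʳ; distribˡ; distribʳ; -‿inverseʳ)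
open Algebra.Properties.CommutativeSemiring.Exp commutativeSemiring
  using (_^_; ^-homo-*; ^-distrib-*)

module ℚ[i]-Solver =
  Algebra.Solver.Ring.Simple (ACR.fromCommutativeRing ℚ[i]-commutativeRing) _≟_

normSq : ℚ[i] → ℚ
normSq z = real z ℚ.* real z ℚ.+ imag z ℚ.* imag z

0≤normSq : ∀ z → 0ℚ ℚ.≤ normSq z
0≤normSq z = +-nonNeg (0≤a² (real z)) (0≤a² (imag z))

opaque
  unfolding _+_ _*_ -_

  normSq-* : ∀ z w → normSq (z * w) ≡ normSq z ℚ.* normSq w
  normSq-* z w = eq (real z) (imag z) (real w) (imag w)
    where
    open +-*-Solver
    eq : ∀ a b c d → normSq (⟨ a , b ⟩ * ⟨ c , d ⟩) ≡ normSq ⟨ a , b ⟩ ℚ.* normSq ⟨ c , d ⟩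
    eq = solve 4 (λ a b c d →
      (a :* c :+ :- (b :* d)) :* (a :* c :+ :- (b :* d)) :+
      (a :* d :+ b :* c) :* (a :* d :+ b :* c) :=
      (a :* a :+ b :* b) :* (c :* c :+ d :* d)) refl

  normSq-+ : ∀ z w → normSq (z + w) ≡ normSq z ℚ.+ normSq w ℚ.+
    (real z ℚ.* real w ℚ.+ imag z ℚ.* imag w ℚ.+
     (real z ℚ.* real w ℚ.+ imag z ℚ.* imag w))
  normSq-+ z w = solve 4 (λ a b c d → (a :+ c) :* (a :+ c) :+ (b :+ d) :* (b :+ d) :=
    a :* a :+ b :* b :+ (c :* c :+ d :* d) :+ (a :* c :+ b :* d :+ (a :* c :+ b :* d)))
    refl (real z) (imag z) (real w) (imag w)
    where open +-*-Solver

  normSq-neg : ∀ z → normSq (- z) ≡ normSq z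
  normSq-neg z = eq (real z) (imag z)
    where
    open +-*-Solver
    eq : ∀ a b → normSq (- ⟨ a , b ⟩) ≡ normSq ⟨ a , b ⟩
    eq = solve 2 (λ a b → (:- a) :* (:- a) :+ (:- b) :* (:- b) := a :* a :+ b :* b) refl

real²≤normSq : ∀ z → real z ℚ.* real z ℚ.≤ normSq z
real²≤normSq z = subst (ℚ._≤ normSq z) (ℚP.+-identityʳ _)
  (ℚP.+-monoʳ-≤ (real z ℚ.* real z) (0≤a² (imag z)))

imag²≤normSq : ∀ z → imag z ℚ.* imag z ℚ.≤ normSq z
imag²≤normSq z = subst (ℚ._≤ normSq z) (ℚP.+-identityˡ _)
  (ℚP.+-monoˡ-≤ (imag z ℚ.* imag z) (0≤a² (real z)))

a²≡0⇒a≡0 : ∀ {a} → a ℚ.* a ℚ.≤ 0ℚ → a ≡ 0ℚ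
a²≡0⇒a≡0 {a} a²≤0 with a ℚP.≟ 0ℚ
... | yes a≡0 = a≡0
... | no  a≢0 = contradiction (ℚP.<-≤-trans 0<a² a²≤0) (ℚP.<-irrefl refl)
  where
  0<∣a∣ = ℚP.≰⇒> λ h → a≢0 (ℚP.∣p∣≡0⇒p≡0 a (ℚP.≤-antisym h (ℚP.0≤∣p∣ a)))
  0<a² = subst (0ℚ ℚ.<_) (∣a∣² a) (*-pos 0<∣a∣ 0<∣a∣)

normSq≤0⇒≡0 : ∀ {z} → normSq z ℚ.≤ 0ℚ → z ≡ 0#
normSq≤0⇒≡0 {z} h = cong₂ ⟨_,_⟩
  (a²≡0⇒a≡0 (ℚP.≤-trans (real²≤normSq z) h))
  (a²≡0⇒a≡0 (ℚP.≤-trans (imag²≤normSq z) h))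

≢0⇒0<normSq : ∀ {z} → z ≢ 0# → 0ℚ ℚ.< normSq z
≢0⇒0<normSq z≢0 = ℚP.≰⇒> λ h → z≢0 (normSq≤0⇒≡0 h)

-- The norm is multiplicative and positive away from zero. Root counting for polynomials rests on
-- this.
*-cancel-≢0 : ∀ {z w} → z ≢ 0# → z * w ≡ 0# → w ≡ 0#
*-cancel-≢0 {z} {w} z≢0 zw≡0 with w ≟ 0#
... | yes w≡0 = w≡0
... | no  w≢0 = contradiction
  (subst (0ℚ ℚ.<_) (trans (sym (normSq-* z w)) (cong normSq zw≡0))
    (*-pos (≢0⇒0<normSq z≢0) (≢0⇒0<normSq w≢0)))
  (ℚP.<-irrefl refl)

opaque
  unfolding _+_ _*_ -_

  -- The witness is the conjugate of `y` divided by `normSq y`.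
  inverse : ∀ {y} → 0ℚ ℚ.< normSq y → ∃ λ z → z * y ≡ 1#
  inverse {y} 0<N = ⟨ n ℚ.* real y , ℚ.- (n ℚ.* imag y) ⟩ , cong₂ ⟨_,_⟩
    (trans (eq₁ n (real y) (imag y)) (ℚP.*-inverseˡ (normSq y)))
    (eq₂ n (real y) (imag y))
    where
    instance
      N≢0 : ℚ.NonZero (normSq y)
      N≢0 = ℚP.pos⇒nonZero (normSq y) {{ℚ.positive 0<N}}
    n : ℚ
    n = ℚ.1/ normSq y
    open +-*-Solver
    eq₁ : ∀ n a b → n ℚ.* a ℚ.* a ℚ.+ ℚ.- (ℚ.- (n ℚ.* b) ℚ.* b) ≡ n ℚ.* (a ℚ.* a ℚ.+ b ℚ.* b)
    eq₁ = solve 3 (λ n a b → n :* a :* a :+ :- (:- (n :* b) :* b) := n :* (a :* a :+ b :* b)) refl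
    eq₂ : ∀ n a b → n ℚ.* a ℚ.* b ℚ.+ ℚ.- (n ℚ.* b) ℚ.* a ≡ 0ℚ
    eq₂ = solve 3 (λ n a b → n :* a :* b :+ :- (n :* b) :* a := con 0ℚ) refl

-- z ≼ r says that |z| ≤ r, without square roots.
infix 4 _≼_

record _≼_ (z : ℚ[i]) (r : ℚ) : Set where
  constructor _&_
  field
    0≤bound : 0ℚ ℚ.≤ r
    normSq≤ : normSq z ℚ.≤ r ℚ.* r

open _≼_ using (0≤bound; normSq≤)

0≼ : ∀ {r} → 0ℚ ℚ.≤ r → 0# ≼ r
0≼ {r} 0≤r = 0≤r & 0≤a² r

≼-neg : ∀ {z r} → z ≼ r → - z ≼ r
≼-neg {z} (0≤r & h) = 0≤r & subst (ℚ._≤ _) (sym (normSq-neg z)) h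

≼-mono : ∀ {z r s} → r ℚ.≤ s → z ≼ r → z ≼ s
≼-mono r≤s (0≤r & h) = ℚP.≤-trans 0≤r r≤s & ℚP.≤-trans h (sq-mono-≤ 0≤r r≤s)

≼-* : ∀ {z w r s} → z ≼ r → w ≼ s → z * w ≼ r ℚ.* s
≼-* {z} {w} {r} {s} (0≤r & h) (0≤s & k) = *-nonNeg 0≤r 0≤s & (begin
  normSq (z * w)                    ≡⟨ normSq-* z w ⟩
  normSq z ℚ.* normSq w             ≤⟨ *-mono-≤ (0≤a² r) (0≤normSq w) h k ⟩
  r ℚ.* r ℚ.* (s ℚ.* s)             ≡⟨ eq r s ⟩
  r ℚ.* s ℚ.* (r ℚ.* s)             ∎)
  where
  open ℚP.≤-Reasoning
  eq : ∀ r s → r ℚ.* r ℚ.* (s ℚ.* s) ≡ r ℚ.* s ℚ.* (r ℚ.* s)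
  eq = solve 2 (λ r s → r :* r :* (s :* s) := r :* s :* (r :* s)) refl
    where open +-*-Solver

-- Cauchy–Schwarz bounds the inner product, by Lagrange's identity.
≼-+ : ∀ {z w r s} → z ≼ r → w ≼ s → z + w ≼ r ℚ.+ s
≼-+ {z} {w} {r} {s} (0≤r & h) (0≤s & k) = +-nonNeg 0≤r 0≤s & (begin
  normSq (z + w)                                   ≡⟨ normSq-+ z w ⟩
  normSq z ℚ.+ normSq w ℚ.+ (t ℚ.+ t)
    ≤⟨ ℚP.+-mono-≤ (ℚP.+-mono-≤ h k) (ℚP.+-mono-≤ t≤rs t≤rs) ⟩
  r ℚ.* r ℚ.+ s ℚ.* s ℚ.+ (r ℚ.* s ℚ.+ r ℚ.* s)    ≡⟨ collect r s ⟩
  (r ℚ.+ s) ℚ.* (r ℚ.+ s)                          ∎)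
  where
  open ℚP.≤-Reasoning
  a = real z
  b = imag z
  c = real w
  d = imag w
  t = a ℚ.* c ℚ.+ b ℚ.* d
  v = a ℚ.* d ℚ.- b ℚ.* c
  collect : ∀ r s → r ℚ.* r ℚ.+ s ℚ.* s ℚ.+ (r ℚ.* s ℚ.+ r ℚ.* s) ≡ (r ℚ.+ s) ℚ.* (r ℚ.+ s)
  collect = solve 2 (λ r s → r :* r :+ s :* s :+ (r :* s :+ r :* s) := (r :+ s) :* (r :+ s)) refl
    where open +-*-Solver
  lagrange : ∀ a b c d → (a ℚ.* c ℚ.+ b ℚ.* d) ℚ.* (a ℚ.* c ℚ.+ b ℚ.* d) ℚ.+
    (a ℚ.* d ℚ.- b ℚ.* c) ℚ.* (a ℚ.* d ℚ.- b ℚ.* c) ≡ normSq ⟨ a , b ⟩ ℚ.* normSq ⟨ c , d ⟩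
  lagrange = solve 4 (λ a b c d → (a :* c :+ b :* d) :* (a :* c :+ b :* d) :+
    (a :* d :- b :* c) :* (a :* d :- b :* c) := (a :* a :+ b :* b) :* (c :* c :+ d :* d)) refl
    where open +-*-Solver
  t²≤ : t ℚ.* t ℚ.≤ (r ℚ.* s) ℚ.* (r ℚ.* s)
  t²≤ = begin
    t ℚ.* t                      ≡⟨ ℚP.+-identityʳ (t ℚ.* t) ⟨
    t ℚ.* t ℚ.+ 0ℚ               ≤⟨ ℚP.+-monoʳ-≤ (t ℚ.* t) (0≤a² v) ⟩
    t ℚ.* t ℚ.+ v ℚ.* v          ≡⟨ lagrange a b c d ⟩
    normSq z ℚ.* normSq w        ≡⟨ normSq-* z w ⟨
    normSq (z * w)               ≤⟨ normSq≤ (≼-* {z} {w} (0≤r & h) (0≤s & k)) ⟩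
    (r ℚ.* s) ℚ.* (r ℚ.* s)      ∎
  t≤rs : t ℚ.≤ r ℚ.* s
  t≤rs with ℚP.<-cmp 0ℚ t
  ... | tri< 0<t _ _ = sq-cancel-≤ 0<t (*-nonNeg 0≤r 0≤s) t²≤
  ... | tri≈ _ 0≡t _ = subst (ℚ._≤ r ℚ.* s) 0≡t (*-nonNeg 0≤r 0≤s)
  ... | tri> _ _ t<0 = ℚP.≤-trans (ℚP.<⇒≤ t<0) (*-nonNeg 0≤r 0≤s)

-- Powers, and the dominance of one term over six

infixr 8 _^ℚ_

_^ℚ_ : ℚ → ℕ → ℚ
ρ ^ℚ zero  = 1ℚ
ρ ^ℚ suc k = ρ ℚ.* ρ ^ℚ k

1≼1 : 1# ≼ 1ℚ
1≼1 = ℚP.<⇒≤ 0<1 & ℚP.≤-refl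

-- Turns inequalities between exponents into size bounds: a lower bound `k` for the true exponent is
-- all that has to be known.
≼-^ : ∀ {z ρ k e} → ρ ℚ.≤ 1ℚ → z ≼ ρ → k ℕ.≤ e → z ^ e ≼ ρ ^ℚ k
≼-^ {e = zero}  ρ≤1 z≼ρ ℕ.z≤n       = 1≼1
≼-^ {e = suc e} ρ≤1 z≼ρ ℕ.z≤n       = ≼-* (≼-mono ρ≤1 z≼ρ) (≼-^ {e = e} ρ≤1 z≼ρ ℕ.z≤n)
≼-^ {e = suc e} ρ≤1 z≼ρ (ℕ.s≤s k≤e) = ≼-* z≼ρ (≼-^ {e = e} ρ≤1 z≼ρ k≤e)

-- `ρ` is slightly above 1/2, to leave a gap for locating a Cauchy sequence. At this `ρ` the sum `σ`
-- below is about 0.9788, and `η` fits into what is left up to 1.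
ρ η : ℚ
ρ = + 101 / 200
η = + 1 / 50

0<η : 0ℚ ℚ.< η
0<η = from-yes (0ℚ ℚP.<? η)

0≤ρ : 0ℚ ℚ.≤ ρ
0≤ρ = from-yes (0ℚ ℚP.≤? ρ)

ρ≤1 : ρ ℚ.≤ 1ℚ
ρ≤1 = from-yes (ρ ℚP.≤? 1ℚ)

-- Reverse triangle inequality by contradiction: if `h + u` were smaller than `η`, then
-- `h = (h + u) - u` would have modulus at most `η + σ`, which is below 1.
dominated : ∀ {h u σ} → 1ℚ ℚ.≤ normSq h → u ≼ σ → η ℚ.+ σ ℚ.< 1ℚ →
            η ℚ.* η ℚ.≤ normSq (h + u)
dominated {h} {u} {σ} 1≤h u≼σ η+σ<1 = ℚP.≮⇒≥ λ small →
  let h≼ = subst (_≼ η ℚ.+ σ) (eq h u)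
             (≼-+ {h + u} (ℚP.<⇒≤ 0<η & ℚP.<⇒≤ small) (≼-neg u≼σ))
      open ℚP.≤-Reasoning
      s = η ℚ.+ σ
  in ℚP.<-irrefl refl (begin-strict
    1ℚ            ≤⟨ 1≤h ⟩
    normSq h      ≤⟨ normSq≤ h≼ ⟩
    s ℚ.* s       ≤⟨ ℚP.*-monoˡ-≤-nonNeg s {{ℚ.nonNegative (0≤bound h≼)}} (ℚP.<⇒≤ η+σ<1) ⟩
    s ℚ.* 1ℚ      ≡⟨ ℚP.*-identityʳ s ⟩
    s             <⟨ η+σ<1 ⟩
    1ℚ            ∎)
  where
  opaque
    unfolding _+_ _*_ -_
    eq : ∀ h u → (h + u) + - u ≡ h
    eq = solve 2 (λ h u → (h :+ u) :+ :- u := h) refl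
      where open ℚ[i]-Solver

-- The exponents are lower bounds, common to both regions, for the distances of the six other
-- exponents from the dominating one. The jump from 4 to 6 matters: with 5 in place of 6 the sum
-- `η + σ` would exceed 1.
σ : ℚ
σ = ρ ^ℚ 1 ℚ.+ ρ ^ℚ 2 ℚ.+ ρ ^ℚ 3 ℚ.+ ρ ^ℚ 4 ℚ.+ ρ ^ℚ 6 ℚ.+ ρ ^ℚ 7

η+σ<1 : η ℚ.+ σ ℚ.< 1ℚ
η+σ<1 = from-yes (η ℚ.+ σ ℚP.<? 1ℚ)

sixTerms : ∀ {h u₁ u₂ u₃ u₄ u₅ u₆} → 1ℚ ℚ.≤ normSq h →
  u₁ ≼ ρ ^ℚ 1 → u₂ ≼ ρ ^ℚ 2 → u₃ ≼ ρ ^ℚ 3 →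
  u₄ ≼ ρ ^ℚ 4 → u₅ ≼ ρ ^ℚ 6 → u₆ ≼ ρ ^ℚ 7 →
  η ℚ.* η ℚ.≤ normSq (h + (u₁ + u₂ + u₃ + u₄ + u₅ + u₆))
sixTerms 1≤h ≼₁ ≼₂ ≼₃ ≼₄ ≼₅ ≼₆ =
  dominated 1≤h (≼-+ (≼-+ (≼-+ (≼-+ (≼-+ ≼₁ ≼₂) ≼₃) ≼₄) ≼₅) ≼₆) η+σ<1

opaque
  unfolding _+_ -_

  1≤normSq[-1] : 1ℚ ℚ.≤ normSq (- 1#)
  1≤normSq[-1] = ℚP.≤-refl

  1≤normSq[1+1] : 1ℚ ℚ.≤ normSq (1# + 1#)
  1≤normSq[1+1] = from-yes (1ℚ ℚP.≤? normSq (1# + 1#))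

-- The independence polynomial in `y = 1 + x`, and the disc around `y = 0`

e₀ : ℕ → ℕ → ℕ → ℕ
e₀ a b c = a ℕ.* (b ℕ.+ c) ℕ.+ b ℕ.* c

-- `e₀ a b c` will be the number of vertices divisible by exactly one of the primes; `e₁ a b c`
-- leaves out the `bc` among them that are multiples of `p`. Permuting the arguments of `e₁` singles
-- out another prime.
e₁ : ℕ → ℕ → ℕ → ℕ
e₁ a b c = a ℕ.* (b ℕ.+ c)

-- The value at y = 1 + x of I(Γ(ℤ_pqr), x), where (a, b, c) = (p-1, q-1, r-1).
shifted : ℕ → ℕ → ℕ → ℚ[i] → ℚ[i]
shifted a b c y = y ^ e₀ a b c
              + (y ^ (a ℕ.+ e₁ a b c) - y ^ e₁ a b c)
              + (y ^ (b ℕ.+ e₁ b a c) - y ^ e₁ b a c)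
              + (y ^ (c ℕ.+ e₁ c a b) - y ^ e₁ c a b)

-- Parametrising by the differences `s` and `t` removes subtraction, so the exponent identities fall
-- to the semiring solver. `g₂ = c(b - a)` and `g₃ = b(c - a)` are the gaps from the least exponent
-- `e₁ a b c` to `e₁ b a c` and `e₁ c a b`.
module Exponents {a s t : ℕ} (1≤a : 1 ℕ.≤ a) where
  b c g₂ g₃ : ℕ
  b  = suc a ℕ.+ s
  c  = suc b ℕ.+ t
  g₂ = c ℕ.* suc s
  g₃ = b ℕ.* (2 ℕ.+ s ℕ.+ t)

  cofactor : ℚ[i] → ℚ[i]
  cofactor y = - 1# + (y ^ a + - y ^ g₂ + - y ^ g₃ + y ^ (b ℕ.+ g₂)
                         + y ^ (b ℕ.* c) + y ^ (c ℕ.+ g₃))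

  a<b : suc a ℕ.≤ b
  a<b = ℕP.m≤m+n (suc a) s

  b<c : suc b ℕ.≤ c
  b<c = ℕP.m≤m+n (suc b) t

  2≤b : 2 ℕ.≤ b
  2≤b = ℕP.≤-trans (ℕ.s≤s 1≤a) a<b

  3≤c : 3 ℕ.≤ c
  3≤c = ℕP.≤-trans (ℕ.s≤s 2≤b) b<c

  3≤g₂ : 3 ℕ.≤ g₂
  3≤g₂ = ℕP.*-mono-≤ {3} {c} {1} {suc s} 3≤c (ℕ.s≤s ℕ.z≤n)

  4≤g₃ : 4 ℕ.≤ g₃
  4≤g₃ = ℕP.*-mono-≤ {2} {b} {2} 2≤b (ℕ.s≤s (ℕ.s≤s ℕ.z≤n))

  cofactor-large : ∀ {y} → y ≼ ρ → η ℚ.* η ℚ.≤ normSq (cofactor y)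
  -- The six exponents are at least 1, 3, 4, 5, 6 and 7. They are weakened to 1, 2, 3, 4, 6 and 7 so
  -- that one `σ` serves both regions.
  cofactor-large {y} y≼ρ = sixTerms 1≤normSq[-1]
    (pow a 1≤a)
    (≼-neg (pow g₂ (ℕP.≤-trans (ℕ.s≤s (ℕ.s≤s ℕ.z≤n)) 3≤g₂)))
    (≼-neg (pow g₃ (ℕP.≤-trans (ℕP.n≤1+n 3) 4≤g₃)))
    (pow (b ℕ.+ g₂) (ℕP.≤-trans (ℕP.n≤1+n 4) (ℕP.+-mono-≤ 2≤b 3≤g₂)))
    (pow (b ℕ.* c) (ℕP.*-mono-≤ 2≤b 3≤c))
    (pow (c ℕ.+ g₃) (ℕP.+-mono-≤ 3≤c 4≤g₃))
    where
    pow : ∀ {k} e → k ℕ.≤ e → y ^ e ≼ ρ ^ℚ k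
    pow e = ≼-^ {e = e} ρ≤1 y≼ρ

  e₁-b≡ : e₁ b a c ≡ e₁ a b c ℕ.+ g₂
  e₁-b≡ = solve 3 (λ a s t →
    let b = con 1 :+ a :+ s
        c = con 1 :+ b :+ t
    in b :* (a :+ c) := a :* (b :+ c) :+ c :* (con 1 :+ s)) refl a s t
    where open ℕ-Solver
  e₁-c≡ : e₁ c a b ≡ e₁ a b c ℕ.+ g₃
  e₁-c≡ = solve 3 (λ a s t →
    let b = con 1 :+ a :+ s
        c = con 1 :+ b :+ t
    in c :* (a :+ b) := a :* (b :+ c) :+ b :* (con 2 :+ s :+ t)) refl a s t
    where open ℕ-Solver

  shifted-factors : ∀ y → shifted a b c y ≡ y ^ e₁ a b c * cofactor y
  shifted-factors y
    rewrite e₁-b≡ | e₁-c≡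
          | ^-homo-* y (e₁ a b c) (b ℕ.* c)
          | ^-homo-* y a (e₁ a b c)
          | ^-homo-* y b (e₁ a b c ℕ.+ g₂)
          | ^-homo-* y c (e₁ a b c ℕ.+ g₃)
          | ^-homo-* y (e₁ a b c) g₂
          | ^-homo-* y (e₁ a b c) g₃
          | ^-homo-* y b g₂
          | ^-homo-* y c g₃
    = ring (y ^ e₁ a b c) (y ^ (b ℕ.* c)) (y ^ a) (y ^ b) (y ^ c) (y ^ g₂) (y ^ g₃)
    where
    opaque
      unfolding _+_ _*_ -_
      ring : ∀ m bc A B C G₂ G₃ →
        m * bc + (A * m - m) + (B * (m * G₂) - m * G₂) + (C * (m * G₃) - m * G₃) ≡
        m * (- 1# + (A + - G₂ + - G₃ + B * G₂ + bc + C * G₃))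
      ring = solve 7 (λ m bc A B C G₂ G₃ →
        m :* bc :+ (A :* m :- m) :+ (B :* (m :* G₂) :- m :* G₂) :+ (C :* (m :* G₃) :- m :* G₃) :=
        m :* (:- con 1# :+ (A :+ :- G₂ :+ :- G₃ :+ B :* G₂ :+ bc :+ C :* G₃))) refl
        where open ℚ[i]-Solver

-- The region of large `y`, through its inverse `z`

1^ : ∀ n → 1# ^ n ≡ 1#
1^ zero    = refl
1^ (suc n) = trans (*-identityˡ (1# ^ n)) (1^ n)

^-cancel : ∀ {z y} → z * y ≡ 1# → ∀ n → z ^ n * y ^ n ≡ 1#
^-cancel {z} {y} zy≡1 n = begin
  z ^ n * y ^ n  ≡⟨ ^-distrib-* z y n ⟨
  (z * y) ^ n    ≡⟨ cong (_^ n) zy≡1 ⟩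
  1# ^ n         ≡⟨ 1^ n ⟩
  1#             ∎
  where open ≡-Reasoning

-- The product is `z ^ (T ∸ e)`, so an exponent at distance `k` or more below the top exponent `T`
-- contributes at most `ρ ^ℚ k`.
^-quotient-≼ : ∀ {z y} → z * y ≡ 1# → z ≼ ρ → ∀ {k} e T → e ℕ.+ k ℕ.≤ T →
               z ^ T * y ^ e ≼ ρ ^ℚ k
^-quotient-≼ {z} {y} zy≡1 z≼ρ {k} e T e+k≤T = subst (_≼ ρ ^ℚ k) eq (≼-^ {e = d} ρ≤1 z≼ρ k≤d)
  where
  d = T ℕ.∸ e
  k≤d : k ℕ.≤ d
  k≤d = ℕP.m+n≤o⇒m≤o∸n k (subst (ℕ._≤ T) (ℕP.+-comm e k) e+k≤T)
  open ≡-Reasoning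
  eq : z ^ d ≡ z ^ T * y ^ e
  eq = sym (begin
    z ^ T * y ^ e            ≡⟨ cong (λ n → z ^ n * y ^ e)
                                  (ℕP.m∸n+n≡m (ℕP.≤-trans (ℕP.m≤m+n e k) e+k≤T)) ⟨
    z ^ (d ℕ.+ e) * y ^ e    ≡⟨ cong (_* y ^ e) (^-homo-* z d e) ⟩
    z ^ d * z ^ e * y ^ e    ≡⟨ *-assoc (z ^ d) (z ^ e) (y ^ e) ⟩
    z ^ d * (z ^ e * y ^ e)  ≡⟨ cong (z ^ d *_) (^-cancel zy≡1 e) ⟩
    z ^ d * 1#               ≡⟨ *-identityʳ (z ^ d) ⟩
    z ^ d                    ∎)

opaque
  unfolding _+_ _*_ -_

  -- The remainder is listed in the order in which `sixTerms` assigns the bounds, from exponent 1 to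
  -- exponent 7.
  regroup-oneTerm : ∀ Z A D₁ C₁ D₂ C₂ D₃ C₃ →
    Z * (A + (D₁ - C₁) + (D₂ - C₂) + (D₃ - C₃)) ≡
    Z * D₃ + (Z * A + Z * D₂ + - (Z * C₃) + - (Z * C₂) + Z * D₁ + - (Z * C₁))
  regroup-oneTerm = solve 8 (λ Z A D₁ C₁ D₂ C₂ D₃ C₃ →
    Z :* (A :+ (D₁ :- C₁) :+ (D₂ :- C₂) :+ (D₃ :- C₃)) :=
    Z :* D₃ :+ (Z :* A :+ Z :* D₂ :+ :- (Z :* C₃) :+ :- (Z :* C₂) :+ Z :* D₁ :+ :- (Z :* C₁))) refl
    where open ℚ[i]-Solver

  regroup-twoTerms : ∀ Z A D₁ C₁ D₂ C₂ D₃ C₃ →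
    Z * (A + (D₁ - C₁) + (D₂ - C₂) + (D₃ - C₃)) ≡
    (Z * A + Z * D₃) + (Z * D₂ + - (Z * C₃) + - (Z * C₂) + Z * D₁ + - (Z * C₁))
  regroup-twoTerms = solve 8 (λ Z A D₁ C₁ D₂ C₂ D₃ C₃ →
    Z :* (A :+ (D₁ :- C₁) :+ (D₂ :- C₂) :+ (D₃ :- C₃)) :=
    (Z :* A :+ Z :* D₃) :+ (Z :* D₂ :+ :- (Z :* C₃) :+ :- (Z :* C₂) :+ Z :* D₁ :+ :- (Z :* C₁))) refl
    where open ℚ[i]-Solver

  reassoc : ∀ h u v₁ v₂ v₃ v₄ v₅ →
    (h + u) + (v₁ + v₂ + v₃ + v₄ + v₅) ≡ h + (u + v₁ + v₂ + v₃ + v₄ + v₅)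
  reassoc = solve 7 (λ h u v₁ v₂ v₃ v₄ v₅ →
    (h :+ u) :+ (v₁ :+ v₂ :+ v₃ :+ v₄ :+ v₅) := h :+ (u :+ v₁ :+ v₂ :+ v₃ :+ v₄ :+ v₅)) refl
    where open ℚ[i]-Solver

module Reciprocal {a b c : ℕ} (1≤a : 1 ℕ.≤ a) (a<b : a ℕ.< b) (b<c : b ℕ.< c)
                  {y z : ℚ[i]} (zy≡1 : z * y ≡ 1#) (z≼ρ : z ≼ ρ) where
  private
    term : ∀ {k} e T → e ℕ.+ k ≤ T → z ^ T * y ^ e ≼ ρ ^ℚ k
    term = ^-quotient-≼ zy≡1 z≼ρ

    2≤b : 2 ≤ b
    2≤b = ℕP.≤-trans (ℕ.s≤s 1≤a) a<b

    3≤c : 3 ≤ c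
    3≤c = ℕP.≤-trans (ℕ.s≤s 2≤b) b<c

    a+2≤c : a ℕ.+ 2 ≤ c
    a+2≤c = subst (_≤ c) (ℕP.+-comm 2 a) (ℕP.≤-trans (ℕ.s≤s a<b) b<c)

    between : ∀ {k l m n} → k ≡ l → l ≤ m → m ≡ n → k ≤ n
    between refl l≤m refl = l≤m

  -- The top exponent is c + c(a+b) or ab + ac + bc, according as ab < c or c ≤ ab.
  shifted-large-< : a ℕ.* b < c → ∃ λ T → η ℚ.* η ℚ.≤ normSq (z ^ T * shifted a b c y)
  shifted-large-< ab<c = T , subst (λ w → η ℚ.* η ℚ.≤ normSq w) (sym (eq _ _ _ _ _ _ _ _ (^-cancel zy≡1 T)))
    (sixTerms {1#} ℚP.≤-refl
      -- The six exponents lie below `T` at distances `c - ab`, `c - ab + ca - b`, `c`,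
      -- `c - ab + ca`, `c - ab + cb - a` and `c - ab + cb`; the case hypothesis makes `c - ab` at
      -- least 1.
      (term (e₀ a b c) T
        (between (solve 3 (λ a b c → a :* (b :+ c) :+ b :* c :+ con 1 :=
                                     (con 1 :+ a :* b) :+ (c :* a :+ c :* b)) refl a b c)
          (ℕP.+-monoˡ-≤ (c ℕ.* a ℕ.+ c ℕ.* b) ab<c) (top a b c)))
      (term (b ℕ.+ e₁ b a c) T
        (between (solve 3 (λ a b c → b :+ b :* (a :+ c) :+ con 2 :=
                                     (con 1 :+ a :* b) :+ ((con 1 :+ b) :+ c :* b)) refl a b c)
          (ℕP.+-mono-≤ ab<c (ℕP.+-monoˡ-≤ (c ℕ.* b) (ℕP.≤-trans b<c c≤ca))) (top a b c)))
      (≼-neg (term (e₁ c a b) T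
        (between (ℕP.+-comm (e₁ c a b) 3) (ℕP.+-monoˡ-≤ (e₁ c a b) 3≤c) refl)))
      (≼-neg (term (e₁ b a c) T
        (between (solve 3 (λ a b c → b :* (a :+ c) :+ con 4 :=
                                     (con 1 :+ a :* b) :+ (con 3 :+ c :* b)) refl a b c)
          (ℕP.+-mono-≤ ab<c (ℕP.+-monoˡ-≤ (c ℕ.* b) (ℕP.≤-trans 3≤c c≤ca))) (top a b c))))
      (term (a ℕ.+ e₁ a b c) T
        (between (solve 3 (λ a b c → a :+ a :* (b :+ c) :+ con 6 :=
                                     (con 1 :+ a :* b) :+ (c :* a :+ (con 3 :+ (a :+ con 2)))) refl a b c)
          (ℕP.+-mono-≤ ab<c (ℕP.+-monoʳ-≤ (c ℕ.* a)
            (ℕP.≤-trans (ℕP.+-mono-≤ 3≤c a+2≤c) c+c≤cb))) (top a b c)))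
      (≼-neg (term (e₁ a b c) T
        (between (solve 3 (λ a b c → a :* (b :+ c) :+ con 7 :=
                                     (con 1 :+ a :* b) :+ (c :* a :+ con 6)) refl a b c)
          (ℕP.+-mono-≤ ab<c (ℕP.+-monoʳ-≤ (c ℕ.* a) (ℕP.*-mono-≤ 3≤c 2≤b))) (top a b c)))))
    where
    T = c ℕ.+ e₁ c a b
    open ℕ-Solver
    c≤ca : c ≤ c ℕ.* a
    c≤ca = ℕP.m≤m*n c a {{ℕ.>-nonZero 1≤a}}
    c+c≤cb : c ℕ.+ c ≤ c ℕ.* b
    c+c≤cb = between (solve 1 (λ c → c :+ c := c :* con 2) refl c) (ℕP.*-monoʳ-≤ c 2≤b) refl
    top : ∀ a b c → c ℕ.+ (c ℕ.* a ℕ.+ c ℕ.* b) ≡ c ℕ.+ c ℕ.* (a ℕ.+ b)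
    top a b c = cong (c ℕ.+_) (sym (ℕP.*-distribˡ-+ c a b))
    eq : ∀ Z A D₁ C₁ D₂ C₂ D₃ C₃ → Z * D₃ ≡ 1# →
         Z * (A + (D₁ - C₁) + (D₂ - C₂) + (D₃ - C₃)) ≡
         1# + (Z * A + Z * D₂ + - (Z * C₃) + - (Z * C₂) + Z * D₁ + - (Z * C₁))
    eq Z A D₁ C₁ D₂ C₂ D₃ C₃ h = trans (regroup-oneTerm Z A D₁ C₁ D₂ C₂ D₃ C₃) (cong (_+ _) h)

  -- In this case `a = 1` is impossible, as it would give `c ≤ b`. Hence `a ≥ 2`, `b ≥ 3` and
  -- `c ≥ 4`, from which the distances to the top exponent are bounded.
  shifted-large-≥ : c ≤ a ℕ.* b → ∃ λ T → η ℚ.* η ℚ.≤ normSq (z ^ T * shifted a b c y)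
  shifted-large-≥ c≤ab =
    T , subst (λ w → η ℚ.* η ℚ.≤ normSq w)
      (sym (eq (z ^ T) _ _ _ _ _ _ _ (^-cancel zy≡1 T) (proj₁ (proj₂ (proj₂ split)))))
      (sixTerms (proj₁ (proj₂ (proj₂ (proj₂ split)))) (proj₂ (proj₂ (proj₂ (proj₂ split))))
      -- These five exponents lie below `T` at distances `ac - b`, `ab`, `ac`, `bc - a` and `bc`.
      -- The remaining one, at distance `ab - c`, may coincide with `T` and is treated by `split`.
      (term (b ℕ.+ e₁ b a c) T
        (between (solve 3 (λ a b c → b :+ b :* (a :+ c) :+ con 2 :=
                                     (con 1 :+ (con 1 :+ b)) :+ (a :* b :+ b :* c)) refl a b c)
          (ℕP.+-monoˡ-≤ (a ℕ.* b ℕ.+ b ℕ.* c)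
            (ℕP.≤-trans (ℕP.+-mono-≤ 1≤c b<c) c+c≤ac)) (top a b c)))
      (≼-neg (term (e₁ c a b) T
        (between (solve 3 (λ a b c → c :* (a :+ b) :+ con 3 :=
                                     con 3 :+ (a :* c :+ b :* c)) refl a b c)
          (ℕP.+-monoˡ-≤ (a ℕ.* c ℕ.+ b ℕ.* c) (ℕP.≤-trans 3≤c c≤ab))
          (solve 3 (λ a b c → a :* b :+ (a :* c :+ b :* c) := a :* (b :+ c) :+ b :* c) refl a b c))))
      (≼-neg (term (e₁ b a c) T
        (between (solve 3 (λ a b c → b :* (a :+ c) :+ con 4 :=
                                     con 4 :+ (a :* b :+ b :* c)) refl a b c)
          (ℕP.+-monoˡ-≤ (a ℕ.* b ℕ.+ b ℕ.* c) (ℕP.*-mono-≤ 2≤a (ℕP.≤-trans 2≤b (ℕP.<⇒≤ b<c))))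
          (top a b c))))
      (term (a ℕ.+ e₁ a b c) T
        (between (solve 3 (λ a b c → a :+ a :* (b :+ c) :+ con 6 :=
                                     a :* (b :+ c) :+ ((con 4 :+ (a :+ con 2)))) refl a b c)
          (ℕP.+-monoʳ-≤ (e₁ a b c) (ℕP.≤-trans (ℕP.+-mono-≤ 4≤c a+2≤c) c+c≤bc)) refl))
      (≼-neg (term (e₁ a b c) T (ℕP.+-monoʳ-≤ (e₁ a b c)
        (ℕP.≤-trans (from-yes (7 ℕP.≤? 12)) (ℕP.*-mono-≤ 3≤b 4≤c))))))
    where
    T = e₀ a b c
    D₃ = c ℕ.+ e₁ c a b
    open ℕ-Solver
    2≤a : 2 ≤ a
    2≤a = ℕP.≤∧≢⇒< 1≤a λ { refl → ℕP.<⇒≱ b<c (subst (c ≤_) (ℕP.*-identityˡ b) c≤ab) }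
    3≤b : 3 ≤ b
    3≤b = ℕP.≤-trans (ℕ.s≤s 2≤a) a<b
    4≤c : 4 ≤ c
    4≤c = ℕP.≤-trans (ℕ.s≤s 3≤b) b<c
    1≤c : 1 ≤ c
    1≤c = ℕP.≤-trans (ℕ.s≤s ℕ.z≤n) 3≤c
    c+c≤ac : c ℕ.+ c ≤ a ℕ.* c
    c+c≤ac = between (solve 1 (λ c → c :+ c := con 2 :* c) refl c) (ℕP.*-monoˡ-≤ c 2≤a) refl
    c+c≤bc : c ℕ.+ c ≤ b ℕ.* c
    c+c≤bc = between (solve 1 (λ c → c :+ c := con 2 :* c) refl c) (ℕP.*-monoˡ-≤ c 2≤b) refl
    top : ∀ a b c → a ℕ.* c ℕ.+ (a ℕ.* b ℕ.+ b ℕ.* c) ≡ a ℕ.* (b ℕ.+ c) ℕ.+ b ℕ.* c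
    top = solve 3 (λ a b c → a :* c :+ (a :* b :+ b :* c) := a :* (b :+ c) :+ b :* c) refl
    top′ : ∀ a b c → a ℕ.* b ℕ.+ (a ℕ.* c ℕ.+ b ℕ.* c) ≡ a ℕ.* (b ℕ.+ c) ℕ.+ b ℕ.* c
    top′ = solve 3 (λ a b c → a :* b :+ (a :* c :+ b :* c) := a :* (b :+ c) :+ b :* c) refl
    -- For c = ab the two top terms coincide, and the leading coefficient is 2.
    Split : Set
    Split = ∃ λ h → ∃ λ u → 1# + z ^ T * y ^ D₃ ≡ h + u × 1ℚ ℚ.≤ normSq h × u ≼ ρ ^ℚ 1
    D₃≡T : c ≡ a ℕ.* b → D₃ ≡ T
    D₃≡T c≡ab = trans
      (cong₂ ℕ._+_ c≡ab (solve 3 (λ a b c → c :* (a :+ b) := a :* c :+ b :* c) refl a b c))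
      (top′ a b c)
    splitBy : c < a ℕ.* b ⊎ c ≡ a ℕ.* b → Split
    splitBy (inj₁ c<ab) = 1# , z ^ T * y ^ D₃ , refl , ℚP.≤-refl , term D₃ T
      (between (solve 3 (λ a b c → c :+ c :* (a :+ b) :+ con 1 :=
                                   (con 1 :+ c) :+ (a :* c :+ b :* c)) refl a b c)
        (ℕP.+-monoˡ-≤ (a ℕ.* c ℕ.+ b ℕ.* c) c<ab) (top′ a b c))
    splitBy (inj₂ c≡ab) = 1# + 1# , 0# ,
      trans (cong (λ e → 1# + z ^ T * y ^ e) (D₃≡T c≡ab))
        (trans (cong (λ w → 1# + w) (^-cancel zy≡1 T)) (sym (+-identityʳ (1# + 1#)))) ,
      1≤normSq[1+1] , 0≼ (from-yes (0ℚ ℚP.≤? ρ ^ℚ 1))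
    split : Split
    split = splitBy (ℕP.m≤n⇒m<n∨m≡n c≤ab)
    eq : ∀ Z A D₁ C₁ D₂ C₂ D₃ C₃ {h u} → Z * A ≡ 1# → 1# + Z * D₃ ≡ h + u →
         Z * (A + (D₁ - C₁) + (D₂ - C₂) + (D₃ - C₃)) ≡
         h + (u + Z * D₂ + - (Z * C₃) + - (Z * C₂) + Z * D₁ + - (Z * C₁))
    eq Z A D₁ C₁ D₂ C₂ D₃ C₃ {h} {u} ZA≡1 h+u = begin
      Z * (A + (D₁ - C₁) + (D₂ - C₂) + (D₃ - C₃))
        ≡⟨ regroup-twoTerms Z A D₁ C₁ D₂ C₂ D₃ C₃ ⟩
      (Z * A + Z * D₃) + v      ≡⟨ cong (_+ v) (trans (cong (_+ Z * D₃) ZA≡1) h+u) ⟩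
      (h + u) + v
        ≡⟨ reassoc h u (Z * D₂) (- (Z * C₃)) (- (Z * C₂)) (Z * D₁) (- (Z * C₁)) ⟩
      h + (u + Z * D₂ + - (Z * C₃) + - (Z * C₂) + Z * D₁ + - (Z * C₁)) ∎
      where
      open ≡-Reasoning
      v = Z * D₂ + - (Z * C₃) + - (Z * C₂) + Z * D₁ + - (Z * C₁)

  shifted-large : ∃ λ T → η ℚ.* η ℚ.≤ normSq (z ^ T * shifted a b c y)
  shifted-large = [ shifted-large-< , shifted-large-≥ ]′ (ℕP.<-≤-connex (a ℕ.* b) c)

module P = Polynomial rawRing

-- Polynomials over ℚ(i)

opaque
  unfolding _+_ _*_ -_

  eval-⊕ : ∀ f g x → P.eval (f P.⊕ g) x ≡ P.eval f x + P.eval g x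
  eval-⊕ []      g       x = sym (+-identityˡ (P.eval g x))
  eval-⊕ (a ∷ f) []      x = sym (+-identityʳ (P.eval (a ∷ f) x))
  eval-⊕ (a ∷ f) (b ∷ g) x = trans
    (cong (λ v → a + b + x * v) (eval-⊕ f g x))
    (solve 5 (λ a b x v w → a :+ b :+ x :* (v :+ w) := a :+ x :* v :+ (b :+ x :* w))
      refl a b x (P.eval f x) (P.eval g x))
    where open ℚ[i]-Solver

  eval-scale : ∀ a f x → P.eval (map (a *_) f) x ≡ a * P.eval f x
  eval-scale a []      x = sym (zeroʳ a)
  eval-scale a (b ∷ f) x = trans
    (cong (λ v → a * b + x * v) (eval-scale a f x))
    (solve 4 (λ a b x v → a :* b :+ x :* (a :* v) := a :* (b :+ x :* v))
      refl a b x (P.eval f x))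
    where open ℚ[i]-Solver

  eval-neg : ∀ f x → P.eval (map -_ f) x ≡ - P.eval f x
  eval-neg []      x = refl
  eval-neg (b ∷ f) x = trans
    (cong (λ v → - b + x * v) (eval-neg f x))
    (solve 3 (λ b x v → :- b :+ x :* (:- v) := :- (b :+ x :* v)) refl b x (P.eval f x))
    where open ℚ[i]-Solver

  eval-⊗ : ∀ f g x → P.eval (f P.⊗ g) x ≡ P.eval f x * P.eval g x
  eval-⊗ []      g x = sym (zeroˡ (P.eval g x))
  eval-⊗ (a ∷ f) g x = begin
    P.eval (map (a *_) g P.⊕ (0# ∷ (f P.⊗ g))) x
      ≡⟨ eval-⊕ (map (a *_) g) (0# ∷ (f P.⊗ g)) x ⟩
    P.eval (map (a *_) g) x + (0# + x * P.eval (f P.⊗ g) x)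
      ≡⟨ cong₂ (λ v w → v + (0# + x * w)) (eval-scale a g x) (eval-⊗ f g x) ⟩
    a * P.eval g x + (0# + x * (P.eval f x * P.eval g x))
      ≡⟨ solve 4 (λ a x v w → a :* w :+ (con 0# :+ x :* (v :* w)) := (a :+ x :* v) :* w)
           refl a x (P.eval f x) (P.eval g x) ⟩
    (a + x * P.eval f x) * P.eval g x ∎
    where
    open ≡-Reasoning
    open ℚ[i]-Solver using (solve; _:=_; _:+_; _:*_; con)

  eval-constant : ∀ a x → P.eval (a ∷ []) x ≡ a
  eval-constant = solve 2 (λ a x → a :+ x :* con 0# := a) refl
    where open ℚ[i]-Solver

  eval-X- : ∀ a x → P.eval (P.X- a) x ≡ - a + x
  eval-X- = solve 2 (λ a x → :- a :+ x :* (con 1# :+ x :* con 0#) := :- a :+ x) refl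
    where open ℚ[i]-Solver

  a-0≡a : ∀ a → a - 0# ≡ a
  a-0≡a = solve 1 (λ a → a :- con 0# := a) refl
    where open ℚ[i]-Solver

  a+x*0≡a : ∀ a x → a + x * 0# ≡ a
  a+x*0≡a = solve 2 (λ a x → a :+ x :* con 0# := a) refl
    where open ℚ[i]-Solver

  coeff-difference : ∀ f g k →
    P.coeff (f P.⊕ map -_ g) k ≡ P.coeff f k - P.coeff g k
  coeff-difference []      []      k       = refl
  coeff-difference []      (b ∷ g) zero    = sym (+-identityˡ (- b))
  coeff-difference []      (b ∷ g) (suc k) = coeff-difference [] g k
  coeff-difference (a ∷ f) []      zero    = sym (a-0≡a a)
  coeff-difference (a ∷ f) []      (suc k) = sym (a-0≡a (P.coeff f k))
  coeff-difference (a ∷ f) (b ∷ g) zero    = refl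
  coeff-difference (a ∷ f) (b ∷ g) (suc k) = coeff-difference f g k

  a-b≡0⇒a≡b : ∀ {a b} → a - b ≡ 0# → a ≡ b
  a-b≡0⇒a≡b {a} {b} e = trans
    (solve 2 (λ a b → a := (a :- b) :+ b) refl a b)
    (trans (cong (_+ b) e) (+-identityˡ b))
    where open ℚ[i]-Solver

  deflate-step : ∀ c x a v w → c + x * v - (c + a * w) ≡ (x - a) * w + x * (v - w)
  deflate-step = solve 5 (λ c x a v w →
    c :+ x :* v :- (c :+ a :* w) := (x :- a) :* w :+ x :* (v :- w)) refl
    where open ℚ[i]-Solver

  deflate-collect : ∀ x a w q → (x - a) * w + x * ((x - a) * q) ≡ (x - a) * (w + x * q)
  deflate-collect = solve 4 (λ x a w q →
    (x :- a) :* w :+ x :* ((x :- a) :* q) := (x :- a) :* (w :+ x :* q)) refl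
    where open ℚ[i]-Solver

eval-↑ : ∀ f m x → P.eval (f P.↑ m) x ≡ P.eval f x ^ m
eval-↑ f zero    x = eval-constant 1# x
eval-↑ f (suc m) x = trans (eval-⊗ f (f P.↑ m) x) (cong (P.eval f x *_) (eval-↑ f m x))

-- The quotient of f - f(a) by X - a.
deflate : ℚ[i] → P.Poly → P.Poly
deflate a []            = []
deflate a (c ∷ [])      = []
deflate a (c ∷ d ∷ f)   = P.eval (d ∷ f) a ∷ deflate a (d ∷ f)

eval-deflate : ∀ a f x → P.eval f x - P.eval f a ≡ (x - a) * P.eval (deflate a f) x
eval-deflate a []          x = trans (-‿inverseʳ 0#) (sym (zeroʳ (x - a)))
eval-deflate a (c ∷ [])    x = trans (cong₂ _-_ (a+x*0≡a c x) (a+x*0≡a c a))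
  (trans (-‿inverseʳ c) (sym (zeroʳ (x - a))))
eval-deflate a (c ∷ f@(_ ∷ _)) x = begin
  c + x * P.eval f x - (c + a * P.eval f a)
    ≡⟨ deflate-step c x a (P.eval f x) (P.eval f a) ⟩
  (x - a) * P.eval f a + x * (P.eval f x - P.eval f a)
    ≡⟨ cong (λ v → (x - a) * P.eval f a + x * v) (eval-deflate a f x) ⟩
  (x - a) * P.eval f a + x * ((x - a) * P.eval (deflate a f) x)
    ≡⟨ deflate-collect x a (P.eval f a) (P.eval (deflate a f) x) ⟩
  (x - a) * (P.eval f a + x * P.eval (deflate a f) x) ∎
  where open ≡-Reasoning

eval-zeros : ∀ f x → (∀ k → P.coeff f k ≡ 0#) → P.eval f x ≡ 0#
eval-zeros []      x h = refl
eval-zeros (c ∷ f) x h = trans (cong₂ (λ c v → c + x * v) (h 0) (eval-zeros f x (h ∘ suc)))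
  (a+x*0≡a 0# x)

-- Works from the leading coefficient down: once the later coefficients vanish, the value stored at
-- the head of the quotient is `d` itself.
deflate-zeros : ∀ a c f → (∀ k → P.coeff (deflate a (c ∷ f)) k ≡ 0#) → ∀ k → P.coeff f k ≡ 0#
deflate-zeros a c []      h k       = refl
deflate-zeros a c (d ∷ f) h zero    = begin
  d                    ≡⟨ a+x*0≡a d a ⟨
  d + a * 0#           ≡⟨ cong (λ v → d + a * v) (eval-zeros f a (deflate-zeros a d f (h ∘ suc))) ⟨
  d + a * P.eval f a   ≡⟨ h 0 ⟩
  0#                   ∎
  where open ≡-Reasoning
deflate-zeros a c (d ∷ f) h (suc k) = deflate-zeros a d f (h ∘ suc) k

deflate-length : ∀ a c f → length (deflate a (c ∷ f)) ≡ length f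
deflate-length a c []      = refl
deflate-length a c (d ∷ f) = cong suc (deflate-length a d f)

-- Splits off the root `point 0`; by injectivity and the absence of zero divisors the quotient
-- vanishes at the remaining points. The recursion runs on the length `l`, since the quotient is not
-- a subterm of `f`.
vanishing : ∀ l f → length f ≡ l → (point : ℕ → ℚ[i]) → Injective _≡_ _≡_ point →
            (∀ i → P.eval f (point i) ≡ 0#) → ∀ k → P.coeff f k ≡ 0#
vanishing l       []      e point inj h k = refl
vanishing (suc l) (c ∷ f) e point inj h k = coeffs k
  where
  a = point 0
  x≢a : ∀ i → point (suc i) - a ≢ 0#
  x≢a i x-a≡0 with () ← inj (a-b≡0⇒a≡b x-a≡0)
  deflated : ∀ i → P.eval (deflate a (c ∷ f)) (point (suc i)) ≡ 0#
  deflated i = *-cancel-≢0 (x≢a i) (trans (sym (eval-deflate a (c ∷ f) (point (suc i))))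
    (trans (cong₂ _-_ (h (suc i)) (h 0)) (-‿inverseʳ 0#)))
  tail : ∀ k → P.coeff f k ≡ 0#
  tail = deflate-zeros a c f (vanishing l (deflate a (c ∷ f))
    (trans (deflate-length a c f) (ℕP.suc-injective e)) (point ∘ suc)
    (λ eq → ℕP.suc-injective (inj eq)) deflated)
  coeffs : ∀ k → P.coeff (c ∷ f) k ≡ 0#
  coeffs zero    = trans (sym (a+x*0≡a c a))
    (trans (cong (λ v → c + a * v) (sym (eval-zeros f a tail))) (h 0))
  coeffs (suc k) = tail k

natural : ℕ → ℚ[i]
natural k = ⟨ fromℕ k , 0ℚ ⟩

-- Counting gives an identity of values, multiplicity is about coefficients; this is the bridge. The
-- naturals serve as infinitely many distinct points.
eval-injective : ∀ f g → (∀ x → P.eval f x ≡ P.eval g x) → f P.≋ g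
eval-injective f g h k = a-b≡0⇒a≡b (trans (sym (coeff-difference f g k))
  (vanishing _ (f P.⊕ map -_ g) refl natural (fromℕ-injective ∘ cong real)
    (λ i → trans (eval-⊕ f (map -_ g) (natural i))
      (trans (cong₂ _+_ (h (natural i)) (eval-neg g (natural i))) (-‿inverseʳ _))) k))

-- Complex numbers as sequences of Gaussian rationals

-- The ring operations of ℂ act termwise on the sequences, so each `at n` is a ring homomorphism up
-- to propositional equality, with no passage to the limit.
at : ℕ → ℂ → ℚ[i]
at n z = ⟨ seq (re z) n , seq (im z) n ⟩

opaque
  unfolding _+_ _*_ -_

  at-+ : ∀ n z w → at n (z +ᶜ w) ≡ at n z + at n w
  at-+ n z w = refl

  at-* : ∀ n z w → at n (z *ᶜ w) ≡ at n z * at n w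
  at-* n z w = refl

  at-neg : ∀ n z → at n (-ᶜ z) ≡ - at n z
  at-neg n z = refl

at-eval : ∀ n f x → at n (eval f x) ≡ P.eval (map (at n) f) (at n x)
at-eval n []      x = refl
at-eval n (a ∷ f) x = trans (at-+ n a (x *ᶜ eval f x))
  (cong (λ v → at n a + v) (trans (at-* n x (eval f x)) (cong (at n x *_) (at-eval n f x))))

at-coeff : ∀ n f k → at n (coeff f k) ≡ P.coeff (map (at n) f) k
at-coeff n []      k       = refl
at-coeff n (a ∷ f) zero    = refl
at-coeff n (a ∷ f) (suc k) = at-coeff n f k

map-at-⊕ : ∀ n f g → map (at n) (f ⊕ g) ≡ map (at n) f P.⊕ map (at n) g
map-at-⊕ n []      g       = refl
map-at-⊕ n (a ∷ f) []      = refl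
map-at-⊕ n (a ∷ f) (b ∷ g) = cong₂ _∷_ (at-+ n a b) (map-at-⊕ n f g)

map-at-scale : ∀ n a g → map (at n) (map (a *ᶜ_) g) ≡ map (at n a *_) (map (at n) g)
map-at-scale n a []      = refl
map-at-scale n a (b ∷ g) = cong₂ _∷_ (at-* n a b) (map-at-scale n a g)

map-at-⊗ : ∀ n f g → map (at n) (f ⊗ g) ≡ map (at n) f P.⊗ map (at n) g
map-at-⊗ n []      g = refl
map-at-⊗ n (a ∷ f) g = trans (map-at-⊕ n (map (a *ᶜ_) g) (0ᶜ ∷ (f ⊗ g)))
  (cong₂ P._⊕_ (map-at-scale n a g) (cong (0# ∷_) (map-at-⊗ n f g)))

map-at-↑ : ∀ n f m → map (at n) (f ↑ m) ≡ map (at n) f P.↑ m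
map-at-↑ n f zero    = refl
map-at-↑ n f (suc m) = trans (map-at-⊗ n f (f ↑ m)) (cong (map (at n) f P.⊗_) (map-at-↑ n f m))

map-at-X- : ∀ n z → map (at n) (X- z) ≡ P.X- (at n z)
map-at-X- n z = cong (_∷ 1# ∷ []) (at-neg n z)

≃ᴿ-pointwise : ∀ {u v} → (∀ n → seq u n ≡ seq v n) → u ≃ᴿ v
≃ᴿ-pointwise {u} {v} h ε 0<ε = 0 , λ n _ →
  subst (ℚ._< ε) (sym (trans (cong (λ q → ℚ.∣ q ℚ.- seq v n ∣) (h n))
    (cong ℚ.∣_∣ (ℚP.+-inverseʳ (seq v n))))) 0<ε

≃-pointwise : ∀ {z w} → (∀ n → at n z ≡ at n w) → z ≃ w
≃-pointwise {z} {w} h =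
  ≃ᴿ-pointwise {re z} {re w} (cong real ∘ h) , ≃ᴿ-pointwise {im z} {im w} (cong imag ∘ h)

constant : ℚ[i] → ℂ
constant z = fromℚ (real z) +i fromℚ (imag z)

map-at-constant : ∀ n (f : P.Poly) → map (at n) (map constant f) ≡ f
map-at-constant n []      = refl
map-at-constant n (a ∷ f) = cong (a ∷_) (map-at-constant n f)

-- Sums over the independent sets

sumOver : ∀ {a} {A : Set a} → (A → ℚ[i]) → List A → ℚ[i]
sumOver f = foldr (λ a s → f a + s) 0#

opaque
  unfolding _+_ _*_

  natural-suc : ∀ k → natural (suc k) ≡ 1# + natural k
  natural-suc k = cong₂ ⟨_,_⟩
    (trans (RootLemmas.fromℕ-suc k) (ℚP.+-comm (fromℕ k) 1ℚ)) refl

  split-eval : ∀ a b x v w → a + b + x * (v + w) ≡ a + x * v + (b + x * w)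
  split-eval = solve 5 (λ a b x v w → a :+ b :+ x :* (v :+ w) := a :+ x :* v :+ (b :+ x :* w)) refl
    where open ℚ[i]-Solver

eval-applyUpTo-zero : ∀ h N x → (∀ k → h k ≡ 0#) → P.eval (applyUpTo h N) x ≡ 0#
eval-applyUpTo-zero h zero    x h≡0 = refl
eval-applyUpTo-zero h (suc N) x h≡0 = trans
  (cong₂ (λ c v → c + x * v) (h≡0 0) (eval-applyUpTo-zero (h ∘ suc) N x (h≡0 ∘ suc))) (a+x*0≡a 0# x)

eval-applyUpTo-+ : ∀ f g h N x → (∀ k → h k ≡ f k + g k) →
  P.eval (applyUpTo h N) x ≡ P.eval (applyUpTo f N) x + P.eval (applyUpTo g N) x
eval-applyUpTo-+ f g h zero    x h≡ = sym (+-identityˡ 0#)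
eval-applyUpTo-+ f g h (suc N) x h≡ = trans
  (cong₂ (λ c v → c + x * v) (h≡ 0) (eval-applyUpTo-+ (f ∘ suc) (g ∘ suc) (h ∘ suc) N x (h≡ ∘ suc)))
  (split-eval (f 0) (g 0) x _ _)

eval-applyUpTo-δ : ∀ h s N x → s < N → h s ≡ 1# → (∀ k → s ≢ k → h k ≡ 0#) →
  P.eval (applyUpTo h N) x ≡ x ^ s
eval-applyUpTo-δ h zero (suc N) x _ h₁ h₀ = trans
  (cong₂ (λ c v → c + x * v) h₁ (eval-applyUpTo-zero (h ∘ suc) N x (λ k → h₀ (suc k) λ ())))
  (a+x*0≡a 1# x)
eval-applyUpTo-δ h (suc s) (suc N) x (ℕ.s≤s s<N) h₁ h₀ = trans
  (cong₂ (λ c v → c + x * v) (h₀ 0 λ ())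
    (eval-applyUpTo-δ (h ∘ suc) s N x s<N h₁ (λ k s≢k → h₀ (suc k) (s≢k ∘ ℕP.suc-injective))))
  (+-identityˡ _)

module _ {a} {A : Set a} (size : A → ℕ) where

  occurrences : List A → ℕ → ℕ
  occurrences L k = length (filter (λ S → size S ℕP.≟ k) L)

  δ-at : ℕ → ℕ → ℚ[i]
  δ-at s k with s ℕP.≟ k
  ... | yes _ = 1#
  ... | no  _ = 0#

  δ-at-≡ : ∀ s → δ-at s s ≡ 1#
  δ-at-≡ s with s ℕP.≟ s
  ... | yes _ = refl
  ... | no s≢s = contradiction refl s≢s

  δ-at-≢ : ∀ s k → s ≢ k → δ-at s k ≡ 0#
  δ-at-≢ s k s≢k with s ℕP.≟ k
  ... | yes s≡k = contradiction s≡k s≢k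
  ... | no _ = refl

  occurrences-∷ : ∀ S L k →
    natural (occurrences (S ∷ L) k) ≡ δ-at (size S) k + natural (occurrences L k)
  occurrences-∷ S L k = go (size S ℕP.≟ k)
    where
    size≡k? : (S : A) → Dec (size S ≡ k)
    size≡k? S = size S ℕP.≟ k
    go : Dec (size S ≡ k) → natural (occurrences (S ∷ L) k) ≡ δ-at (size S) k + natural (occurrences L k)
    go (yes e) = trans (cong (natural ∘ length) (filter-accept size≡k? e))
      (trans (natural-suc (occurrences L k))
        (cong (_+ natural (occurrences L k)) (sym (trans (cong (δ-at (size S)) (sym e)) (δ-at-≡ (size S))))))
    go (no ne) = trans (cong (natural ∘ length) (filter-reject size≡k? ne))
      (trans (sym (+-identityˡ _)) (cong (_+ natural (occurrences L k)) (sym (δ-at-≢ (size S) k ne))))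

  -- Each member of the list adds a Kronecker delta at its size to the coefficients, hence one power
  -- of `x`. The bound on `N` keeps that position inside the truncated coefficient list.
  eval-occurrences : ∀ L N x → foldr ℕ._⊔_ 0 (map size L) < N →
    P.eval (applyUpTo (natural ∘ occurrences L) N) x ≡ sumOver (λ S → x ^ size S) L
  eval-occurrences []      N x _     = eval-applyUpTo-zero (λ _ → 0#) N x (λ _ → refl)
  eval-occurrences (S ∷ L) N x max<N = trans
    (eval-applyUpTo-+ (δ-at (size S)) (natural ∘ occurrences L) _ N x (occurrences-∷ S L))
    (cong₂ _+_
      (eval-applyUpTo-δ (δ-at (size S)) (size S) N x
        (ℕP.m⊔n<o⇒m<o (size S) _ max<N) (δ-at-≡ (size S)) (δ-at-≢ (size S)))
      (eval-occurrences L N x (ℕP.m⊔n<o⇒n<o (size S) _ max<N)))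

map-at-independencePolynomial : ∀ {n} (G : SimpleGraph n) k →
  map (at k) (independencePolynomial G) ≡ map natural (independenceCoefficients G)
map-at-independencePolynomial G k = sym (map-∘ (independenceCoefficients G))

eval-independence : ∀ {n} (G : SimpleGraph n) x →
  P.eval (map natural (independenceCoefficients G)) x ≡ sumOver (λ S → x ^ ∣ S ∣) (independentSets G)
eval-independence G x = trans
  (cong (λ f → P.eval f x) (trans (sym (map-∘ (upTo N))) (map-applyUpTo id (natural ∘ countIndependent G) N)))
  (eval-occurrences ∣_∣ (independentSets G) N x ℕP.≤-refl)
  where N = suc (independenceNumber G)

indicator : Bool → ℕ
indicator b = if b then 1 else 0

restrict : Bool → ℚ[i] → ℚ[i]
restrict b w = if b then w else 0#

module _ {a} {A : Set a} where

  sumOver-cong : ∀ {f g : A → ℚ[i]} → (∀ S → f S ≡ g S) → ∀ L → sumOver f L ≡ sumOver g L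
  sumOver-cong f≡g []      = refl
  sumOver-cong f≡g (S ∷ L) = cong₂ _+_ (f≡g S) (sumOver-cong f≡g L)

  sumOver-++ : ∀ (f : A → ℚ[i]) K L → sumOver f (K ++ L) ≡ sumOver f K + sumOver f L
  sumOver-++ f []      L = sym (+-identityˡ (sumOver f L))
  sumOver-++ f (S ∷ K) L = trans (cong (λ v → f S + v) (sumOver-++ f K L)) (sym (+-assoc (f S) _ _))

  sumOver-map : ∀ {b} {B : Set b} (f : A → ℚ[i]) (g : B → A) L →
    sumOver f (map g L) ≡ sumOver (f ∘ g) L
  sumOver-map f g []      = refl
  sumOver-map f g (S ∷ L) = cong (λ v → f (g S) + v) (sumOver-map f g L)

  sumOver-zero : ∀ (L : List A) → sumOver (λ _ → 0#) L ≡ 0#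
  sumOver-zero []      = refl
  sumOver-zero (S ∷ L) = trans (+-identityˡ _) (sumOver-zero L)

  sumOver-scale : ∀ x (f : A → ℚ[i]) L → sumOver (λ S → x * f S) L ≡ x * sumOver f L
  sumOver-scale x f []      = sym (zeroʳ x)
  sumOver-scale x f (S ∷ L) = trans (cong (λ v → x * f S + v) (sumOver-scale x f L)) (sym (distribˡ x (f S) _))

  -- Moves the condition into the summand, so that sums over different families of subsets share one
  -- range and can be compared term by term.
  sumOver-filter : ∀ {ℓ} {P : Pred A ℓ} (P? : Decidable P) (f : A → ℚ[i]) L →
    sumOver f (filter P? L) ≡ sumOver (λ S → restrict (does (P? S)) (f S)) L
  sumOver-filter P? f []      = refl
  sumOver-filter P? f (S ∷ L) with does (P? S)
  ... | true  = cong (λ v → f S + v) (sumOver-filter P? f L)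
  ... | false = trans (sumOver-filter P? f L) (sym (+-identityˡ _))

  opaque
    unfolding _+_ -_

    sumOver-+ : ∀ (f g : A → ℚ[i]) L → sumOver (λ S → f S + g S) L ≡ sumOver f L + sumOver g L
    sumOver-+ f g []      = refl
    sumOver-+ f g (S ∷ L) = trans (cong (λ v → f S + g S + v) (sumOver-+ f g L))
      (solve 4 (λ a b c d → a :+ b :+ (c :+ d) := a :+ c :+ (b :+ d)) refl (f S) (g S) _ _)
      where open ℚ[i]-Solver

    sumOver-- : ∀ (f g : A → ℚ[i]) L → sumOver (λ S → f S - g S) L ≡ sumOver f L - sumOver g L
    sumOver-- f g []      = refl
    sumOver-- f g (S ∷ L) = trans (cong (λ v → f S - g S + v) (sumOver-- f g L))
      (solve 4 (λ a b c d → a :- b :+ (c :- d) := a :+ c :- (b :+ d)) refl (f S) (g S) _ _)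
      where open ℚ[i]-Solver

-- Inclusion of the subset in the set decided by `D`. It is computed along the vector so that it
-- splits in step with the recursion of `subsets`.
covers : ∀ {n} → (Fin n → Bool) → Subset n → Bool
covers D []            = true
covers D (outside ∷ S) = covers (D ∘ suc) S
covers D (inside ∷ S)  = D zero ∧ covers (D ∘ suc) S

∧-true : ∀ {x y} → x ∧ y ≡ true → x ≡ true × y ≡ true
∧-true {true} {true} _ = refl , refl

covers-sound : ∀ {n} {D : Fin n → Bool} {S} → covers D S ≡ true → ∀ a → a ∈ S → D a ≡ true
covers-sound {S = outside ∷ S} e (suc a) (there a∈S) = covers-sound e a a∈S
covers-sound {S = inside ∷ S}  e zero    here        = proj₁ (∧-true e)
covers-sound {D = D} {S = inside ∷ S} e (suc a) (there a∈S) =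
  covers-sound (proj₂ (∧-true {D zero} e)) a a∈S

covers-complete : ∀ {n} {D : Fin n → Bool} {S} → (∀ a → a ∈ S → D a ≡ true) → covers D S ≡ true
covers-complete {S = []}          h = refl
covers-complete {S = outside ∷ S} h = covers-complete λ a a∈S → h (suc a) (there a∈S)
covers-complete {S = inside ∷ S}  h =
  cong₂ _∧_ (h zero here) (covers-complete λ a a∈S → h (suc a) (there a∈S))

covers-counterexample : ∀ {n} {D : Fin n → Bool} {S} → covers D S ≡ false →
                        ∃ λ a → a ∈ S × D a ≡ false
covers-counterexample {S = outside ∷ S} e =
  let a , a∈S , Da = covers-counterexample e in suc a , there a∈S , Da
covers-counterexample {D = D} {S = inside ∷ S} e with D zero in D0
... | false = zero , here , D0
... | true  = let a , a∈S , Da = covers-counterexample e in suc a , there a∈S , Da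

covers-excludes : ∀ {n} {D : Fin n → Bool} {S a} → a ∈ S → D a ≡ false → covers D S ≡ false
covers-excludes {D = D} {S} {a} a∈S Da with covers D S in e
... | false = refl
... | true  with () ← trans (sym Da) (covers-sound e a a∈S)

covers-∧ : ∀ {n} (D E : Fin n → Bool) S → covers (λ a → D a ∧ E a) S ≡ covers D S ∧ covers E S
covers-∧ D E []            = refl
covers-∧ D E (outside ∷ S) = covers-∧ (D ∘ suc) (E ∘ suc) S
covers-∧ D E (inside ∷ S) with D zero | E zero
... | false | _     = refl
... | true  | true  = covers-∧ (D ∘ suc) (E ∘ suc) S
... | true  | false with covers (D ∘ suc) S
...   | true  = refl
...   | false = refl

sum-subsets : ∀ {n} (D : Fin n → Bool) x →
  sumOver (λ S → restrict (covers D S) (x ^ ∣ S ∣)) (subsets n) ≡ (1# + x) ^ sum (indicator ∘ D)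
sum-subsets {zero}  D x = +-identityʳ 1#
sum-subsets {suc n} D x = begin
  sumOver f (map (outside ∷_) (subsets n) ++ map (inside ∷_) (subsets n))
    ≡⟨ sumOver-++ f (map (outside ∷_) (subsets n)) (map (inside ∷_) (subsets n)) ⟩
  sumOver f (map (outside ∷_) (subsets n)) + sumOver f (map (inside ∷_) (subsets n))
    ≡⟨ cong₂ _+_ (sumOver-map f (outside ∷_) (subsets n)) (sumOver-map f (inside ∷_) (subsets n)) ⟩
  sumOver g (subsets n) + sumOver (λ S → restrict (D zero ∧ covers (D ∘ suc) S) (x * x ^ ∣ S ∣)) (subsets n)
    ≡⟨ case-D₀ (D zero) ⟩
  (1# + x) ^ (indicator (D zero) ℕ.+ k) ∎
  where
  open ≡-Reasoning
  f : Subset (suc n) → ℚ[i]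
  f S = restrict (covers D S) (x ^ ∣ S ∣)
  g : Subset n → ℚ[i]
  g S = restrict (covers (D ∘ suc) S) (x ^ ∣ S ∣)
  k = sum (indicator ∘ D ∘ suc)
  restrict-scale : ∀ b w → restrict b (x * w) ≡ x * restrict b w
  restrict-scale true  w = refl
  restrict-scale false w = sym (zeroʳ x)
  case-D₀ : ∀ d →
    sumOver g (subsets n) + sumOver (λ S → restrict (d ∧ covers (D ∘ suc) S) (x * x ^ ∣ S ∣)) (subsets n)
    ≡ (1# + x) ^ (indicator d ℕ.+ k)
  case-D₀ false = begin
    sumOver g (subsets n) + sumOver (λ _ → 0#) (subsets n)
      ≡⟨ cong (λ v → sumOver g (subsets n) + v) (sumOver-zero (subsets n)) ⟩
    sumOver g (subsets n) + 0#   ≡⟨ +-identityʳ _ ⟩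
    sumOver g (subsets n)        ≡⟨ sum-subsets (D ∘ suc) x ⟩
    (1# + x) ^ k                 ∎
  case-D₀ true = begin
    sumOver g (subsets n) + sumOver (λ S → restrict (covers (D ∘ suc) S) (x * x ^ ∣ S ∣)) (subsets n)
      ≡⟨ cong (λ v → sumOver g (subsets n) + v) (trans
           (sumOver-cong (λ S → restrict-scale (covers (D ∘ suc) S) (x ^ ∣ S ∣)) (subsets n))
           (sumOver-scale x g (subsets n))) ⟩
    sumOver g (subsets n) + x * sumOver g (subsets n)
      ≡⟨ cong (_+ x * sumOver g (subsets n)) (*-identityˡ _) ⟨
    1# * sumOver g (subsets n) + x * sumOver g (subsets n)
      ≡⟨ distribʳ (sumOver g (subsets n)) 1# x ⟨
    (1# + x) * sumOver g (subsets n)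
      ≡⟨ cong ((1# + x) *_) (sum-subsets (D ∘ suc) x) ⟩
    (1# + x) * (1# + x) ^ k ∎

-- Divisibility classes

-- Records which of the primes p, q, r divide a number.
Class : Set
Class = Bool × Bool × Bool

all any : Class → Bool
all (x , y , z) = x ∧ (y ∧ z)
any (x , y , z) = x ∨ (y ∨ z)

join : Class → Class → Class
join (x , y , z) (x′ , y′ , z′) = (x ∨ x′) , (y ∨ y′) , (z ∨ z′)

-- `proper` marks the classes of vertices. Every independent set lies within one of the other four
-- families: within `single` if no member is divisible by two primes, and otherwise within the
-- `avoid` family of the prime missing from such a member.
proper single avoid₁ avoid₂ avoid₃ : Class → Bool
proper c = any c ∧ not (all c)
single (true  , false , false) = true
single (false , true  , false) = true
single (false , false , true ) = true
single _                       = false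
avoid₁ (x , y , z) = not x ∧ (y ∨ z)
avoid₂ (x , y , z) = not y ∧ (x ∨ z)
avoid₃ (x , y , z) = not z ∧ (x ∨ y)

-- The two classes may coincide, since distinct vertices can share a class. Any set of numbers with
-- classes in a flat family is then independent.
Flat : (Class → Bool) → Set
Flat D = (∀ c → D c ≡ true → proper c ≡ true) ×
         (∀ c d → D c ≡ true → D d ≡ true → all (join c d) ≡ false)

single-flat : Flat single
single-flat = vertex , flat
  where
  vertex : ∀ c → single c ≡ true → proper c ≡ true
  vertex (true  , false , false) _ = refl
  vertex (false , true  , false) _ = refl
  vertex (false , false , true ) _ = refl
  flat : ∀ c d → single c ≡ true → single d ≡ true → all (join c d) ≡ false
  flat (true  , false , false) (true  , false , false) _ _ = refl
  flat (true  , false , false) (false , true  , false) _ _ = refl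
  flat (true  , false , false) (false , false , true ) _ _ = refl
  flat (false , true  , false) (true  , false , false) _ _ = refl
  flat (false , true  , false) (false , true  , false) _ _ = refl
  flat (false , true  , false) (false , false , true ) _ _ = refl
  flat (false , false , true ) (true  , false , false) _ _ = refl
  flat (false , false , true ) (false , true  , false) _ _ = refl
  flat (false , false , true ) (false , false , true ) _ _ = refl

avoid₁-flat : Flat avoid₁
avoid₁-flat = vertex , flat
  where
  vertex : ∀ c → avoid₁ c ≡ true → proper c ≡ true
  vertex (false , true  , _   ) _ = refl
  vertex (false , false , true) _ = refl
  flat : ∀ c d → avoid₁ c ≡ true → avoid₁ d ≡ true → all (join c d) ≡ false
  flat (false , _) (false , _) _ _ = refl

avoid₂-flat : Flat avoid₂
avoid₂-flat = vertex , flat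
  where
  vertex : ∀ c → avoid₂ c ≡ true → proper c ≡ true
  vertex (true  , false , _   ) _ = refl
  vertex (false , false , true) _ = refl
  flat : ∀ c d → avoid₂ c ≡ true → avoid₂ d ≡ true → all (join c d) ≡ false
  flat (true  , false , _) (_     , false , _) _ _ = refl
  flat (false , false , _) (true  , false , _) _ _ = refl
  flat (false , false , _) (false , false , _) _ _ = refl

avoid₃-flat : Flat avoid₃
avoid₃-flat = vertex , flat
  where
  vertex : ∀ c → avoid₃ c ≡ true → proper c ≡ true
  vertex (true  , true  , false) _ = refl
  vertex (true  , false , false) _ = refl
  vertex (false , true  , false) _ = refl
  ∧-false : ∀ x y → x ∧ (y ∧ false) ≡ false
  ∧-false true  true  = refl
  ∧-false true  false = refl
  ∧-false false _     = refl
  flat : ∀ c d → avoid₃ c ≡ true → avoid₃ d ≡ true → all (join c d) ≡ false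
  flat (x , y , false) (x′ , y′ , false) _ _ = ∧-false (x ∨ x′) (y ∨ y′)

double : ∀ c → proper c ≡ true → single c ≡ false →
  c ≡ (false , true , true) ⊎ c ≡ (true , false , true) ⊎ c ≡ (true , true , false)
double (true  , true  , false) _ _ = inj₂ (inj₂ refl)
double (true  , false , true ) _ _ = inj₂ (inj₁ refl)
double (false , true  , true ) _ _ = inj₁ refl
double (false , true  , false) _ ()
double (false , false , false) ()

-- A multiple of `qr` is annihilated by every multiple of `p`. One such member therefore confines a
-- whole independent set to the numbers prime to `p`.
avoid₁-double : ∀ d → proper d ≡ true → all (join (false , true , true) d) ≡ false → avoid₁ d ≡ true
avoid₁-double (false , true  , _   ) _ _ = refl
avoid₁-double (false , false , true) _ _ = refl

avoid₂-double : ∀ d → proper d ≡ true → all (join (true , false , true) d) ≡ false → avoid₂ d ≡ true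
avoid₂-double (true  , false , _   ) _ _ = refl
avoid₂-double (false , false , true) _ _ = refl

avoid₃-double : ∀ d → proper d ≡ true → all (join (true , true , false) d) ≡ false → avoid₃ d ≡ true
avoid₃-double (true  , _    , false) _ _ = refl
avoid₃-double (false , true , false) _ _ = refl

-- Reflects that `pqr` is squarefree: no vertex has square zero. It supplies the distinctness that
-- adjacency asks for.
join-irreflexive : ∀ c → proper c ≡ true → all (join c c) ≡ false
join-irreflexive (false , _     , _    ) _ = refl
join-irreflexive (true  , false , _    ) _ = refl
join-irreflexive (true  , true  , false) _ = refl

-- For one subset, `i` stands for independence, `d₀` for lying within `single` and the others for
-- lying within the `avoid` families. In `inner` the last three stay free, because each cancels
-- against its conjunction with `d₀`.
data Split (i d₀ d₁ d₂ d₃ : Bool) : Set where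
  inner  : i ≡ true → d₀ ≡ true → Split i d₀ d₁ d₂ d₃
  outer₁ : i ≡ true → d₀ ≡ false → d₁ ≡ true → d₂ ≡ false → d₃ ≡ false → Split i d₀ d₁ d₂ d₃
  outer₂ : i ≡ true → d₀ ≡ false → d₁ ≡ false → d₂ ≡ true → d₃ ≡ false → Split i d₀ d₁ d₂ d₃
  outer₃ : i ≡ true → d₀ ≡ false → d₁ ≡ false → d₂ ≡ false → d₃ ≡ true → Split i d₀ d₁ d₂ d₃
  none   : i ≡ false → d₀ ≡ false → d₁ ≡ false → d₂ ≡ false → d₃ ≡ false → Split i d₀ d₁ d₂ d₃

restrict-cancel : ∀ w d → restrict d w - restrict (d ∧ true) w ≡ 0#
restrict-cancel w true  = -‿inverseʳ w
restrict-cancel w false = -‿inverseʳ 0#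

opaque
  unfolding _+_ -_

  -- Inclusion-exclusion for one subset. Two `avoid` families meet only inside `single`, so
  -- correcting each by its intersection with `single` is already complete.
  split-restrict : ∀ {i d₀ d₁ d₂ d₃} w → Split i d₀ d₁ d₂ d₃ →
    restrict i w ≡ restrict d₀ w + (restrict d₁ w - restrict (d₁ ∧ d₀) w)
                                 + (restrict d₂ w - restrict (d₂ ∧ d₀) w)
                                 + (restrict d₃ w - restrict (d₃ ∧ d₀) w)
  split-restrict {d₁ = d₁} {d₂} {d₃} w (inner refl refl)
    = trans (solve 1 (λ w → w := w :+ con 0# :+ con 0# :+ con 0#) refl w)
        (sym (cong₂ _+_ (cong₂ _+_ (cong (λ v → w + v) (restrict-cancel w d₁)) (restrict-cancel w d₂))
          (restrict-cancel w d₃)))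
    where open ℚ[i]-Solver
  split-restrict w (outer₁ refl refl refl refl refl) =
    solve 1 (λ w → w := con 0# :+ (w :- con 0#) :+ (con 0# :- con 0#) :+ (con 0# :- con 0#)) refl w
    where open ℚ[i]-Solver
  split-restrict w (outer₂ refl refl refl refl refl) =
    solve 1 (λ w → w := con 0# :+ (con 0# :- con 0#) :+ (w :- con 0#) :+ (con 0# :- con 0#)) refl w
    where open ℚ[i]-Solver
  split-restrict w (outer₃ refl refl refl refl refl) =
    solve 1 (λ w → w := con 0# :+ (con 0# :- con 0#) :+ (con 0# :- con 0#) :+ (w :- con 0#)) refl w
    where open ℚ[i]-Solver
  split-restrict w (none refl refl refl refl refl) = refl

not-true : ∀ {b} → b ≢ true → b ≡ false
not-true {true}  h = contradiction refl h
not-true {false} h = refl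

-- Independent sets of a graph whose adjacency is read off from classes

module ClassifiedGraph {n} (G : SimpleGraph n) (class : Fin n → Class)
  (vertex⇒ : ∀ a → SimpleGraph.IsVertex G a → proper (class a) ≡ true)
  (vertex⇐ : ∀ a → proper (class a) ≡ true → SimpleGraph.IsVertex G a)
  (adj⇒ : ∀ a b → SimpleGraph.Adj G a b → all (join (class a) (class b)) ≡ true)
  (adj⇐ : ∀ a b → a ≢ b → all (join (class a) (class b)) ≡ true → SimpleGraph.Adj G a b)
  where

  in? : (Class → Bool) → Subset n → Bool
  in? D = covers (D ∘ class)

  flat⇒independent : ∀ {D S} → Flat D → in? D S ≡ true → IsIndependent G S
  flat⇒independent (vertex , flat) e =
    (λ a a∈S → vertex⇐ a (vertex (class a) (covers-sound e a a∈S))) ,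
    λ a b a∈S b∈S adj → case-false (trans (sym (adj⇒ a b adj))
      (flat (class a) (class b) (covers-sound e a a∈S) (covers-sound e b b∈S)))
    where
    case-false : ¬ (true ≡ false)
    case-false ()

  independent-join : ∀ {S a b} → IsIndependent G S → a ∈ S → b ∈ S →
                     all (join (class a) (class b)) ≡ false
  independent-join {S} {a} {b} (vertex , nonadj) a∈S b∈S =
    not-true λ e → nonadj a b a∈S b∈S (adj⇐ a b (a≢b e) e)
    where
    a≢b : all (join (class a) (class b)) ≡ true → a ≢ b
    a≢b e refl with () ← trans (sym e) (join-irreflexive (class a) (vertex⇒ a (vertex a a∈S)))

  split-inner : ∀ {S} → in? single S ≡ true → does (isIndependent? G S) ≡ true
  split-inner {S} e = dec-true (isIndependent? G S) (flat⇒independent single-flat e)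

  independent-within : ∀ {S s} {D : Class → Bool} c → class s ≡ c →
    (∀ d → proper d ≡ true → all (join c d) ≡ false → D d ≡ true) →
    IsIndependent G S → s ∈ S → in? D S ≡ true
  independent-within {D = D} c refl h ind s∈S = covers-complete {D = D ∘ class} λ a a∈S →
    h (class a) (vertex⇒ a (proj₁ ind a a∈S)) (independent-join ind s∈S a∈S)

  excludes : ∀ {S s} {D : Class → Bool} c → class s ≡ c → D c ≡ false → s ∈ S → in? D S ≡ false
  excludes {D = D} c refl Dc s∈S = covers-excludes {D = D ∘ class} s∈S Dc

  split-outer : ∀ {S s} → in? single S ≡ false → s ∈ S → single (class s) ≡ false → Dec (IsIndependent G S) →
    Split (does (isIndependent? G S)) (in? single S) (in? avoid₁ S) (in? avoid₂ S) (in? avoid₃ S)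
  split-outer {S} {s} e s∈S s-double (no ¬ind) = none (dec-false (isIndependent? G S) ¬ind) e
    (not-true (¬ind ∘ flat⇒independent avoid₁-flat))
    (not-true (¬ind ∘ flat⇒independent avoid₂-flat))
    (not-true (¬ind ∘ flat⇒independent avoid₃-flat))
  split-outer {S} {s} e s∈S s-double (yes ind)
    with double (class s) (vertex⇒ s (proj₁ ind s s∈S)) s-double
  ... | inj₁ c = outer₁ (dec-true (isIndependent? G S) ind) e
    (independent-within _ c avoid₁-double ind s∈S)
    (excludes {D = avoid₂} _ c refl s∈S) (excludes {D = avoid₃} _ c refl s∈S)
  ... | inj₂ (inj₁ c) = outer₂ (dec-true (isIndependent? G S) ind) e
    (excludes {D = avoid₁} _ c refl s∈S)
    (independent-within _ c avoid₂-double ind s∈S) (excludes {D = avoid₃} _ c refl s∈S)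
  ... | inj₂ (inj₂ c) = outer₃ (dec-true (isIndependent? G S) ind) e
    (excludes {D = avoid₁} _ c refl s∈S) (excludes {D = avoid₂} _ c refl s∈S)
    (independent-within _ c avoid₃-double ind s∈S)

  split : ∀ S →
    Split (does (isIndependent? G S)) (in? single S) (in? avoid₁ S) (in? avoid₂ S) (in? avoid₃ S)
  split S = go (in? single S) refl
    where
    go : ∀ b → in? single S ≡ b →
      Split (does (isIndependent? G S)) (in? single S) (in? avoid₁ S) (in? avoid₂ S) (in? avoid₃ S)
    go true  e = inner (split-inner e) e
    go false e = let s , s∈S , Ds = covers-counterexample {D = single ∘ class} e
                 in split-outer e s∈S Ds (isIndependent? G S)

  count : (Class → Bool) → ℕ
  count D = sum (indicator ∘ D ∘ class)

  sum-independent : ∀ x → sumOver (λ S → x ^ ∣ S ∣) (independentSets G) ≡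
    (1# + x) ^ count single
    + ((1# + x) ^ count avoid₁ - (1# + x) ^ count (λ c → avoid₁ c ∧ single c))
    + ((1# + x) ^ count avoid₂ - (1# + x) ^ count (λ c → avoid₂ c ∧ single c))
    + ((1# + x) ^ count avoid₃ - (1# + x) ^ count (λ c → avoid₃ c ∧ single c))
  sum-independent x = begin
    sumOver w (independentSets G)
      ≡⟨ sumOver-filter (isIndependent? G) w (subsets n) ⟩
    sumOver (λ S → restrict (does (isIndependent? G S)) (w S)) (subsets n)
      ≡⟨ sumOver-cong pointwise (subsets n) ⟩
    sumOver (λ S → f single S + diff avoid₁ S + diff avoid₂ S + diff avoid₃ S) (subsets n)
      ≡⟨ sumOver-+ _ (diff avoid₃) (subsets n) ⟩
    sumOver (λ S → f single S + diff avoid₁ S + diff avoid₂ S) (subsets n) + Σdiff avoid₃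
      ≡⟨ cong (_+ Σdiff avoid₃) (sumOver-+ _ (diff avoid₂) (subsets n)) ⟩
    sumOver (λ S → f single S + diff avoid₁ S) (subsets n) + Σdiff avoid₂ + Σdiff avoid₃
      ≡⟨ cong (λ v → v + Σdiff avoid₂ + Σdiff avoid₃) (sumOver-+ (f single) (diff avoid₁) (subsets n)) ⟩
    sumOver (f single) (subsets n) + Σdiff avoid₁ + Σdiff avoid₂ + Σdiff avoid₃
      ≡⟨ cong₂ _+_ (cong₂ _+_ (cong₂ _+_ (sum-subsets (single ∘ class) x) (Σdiff≡ avoid₁)) (Σdiff≡ avoid₂))
           (Σdiff≡ avoid₃) ⟩
    (1# + x) ^ count single
    + ((1# + x) ^ count avoid₁ - (1# + x) ^ count (λ c → avoid₁ c ∧ single c))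
    + ((1# + x) ^ count avoid₂ - (1# + x) ^ count (λ c → avoid₂ c ∧ single c))
    + ((1# + x) ^ count avoid₃ - (1# + x) ^ count (λ c → avoid₃ c ∧ single c)) ∎
    where
    open ≡-Reasoning
    w : Subset n → ℚ[i]
    w S = x ^ ∣ S ∣
    f : (Class → Bool) → Subset n → ℚ[i]
    f D S = restrict (in? D S) (w S)
    diff : (Class → Bool) → Subset n → ℚ[i]
    diff D S = f D S - f (λ c → D c ∧ single c) S
    Σdiff : (Class → Bool) → ℚ[i]
    Σdiff D = sumOver (diff D) (subsets n)
    Σdiff≡ : ∀ D → Σdiff D ≡ (1# + x) ^ count D - (1# + x) ^ count (λ c → D c ∧ single c)
    Σdiff≡ D = trans (sumOver-- (f D) (f (λ c → D c ∧ single c)) (subsets n))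
      (cong₂ _-_ (sum-subsets (D ∘ class) x) (sum-subsets (λ a → D (class a) ∧ single (class a)) x))
    pointwise : ∀ S → restrict (does (isIndependent? G S)) (w S) ≡
                      f single S + diff avoid₁ S + diff avoid₂ S + diff avoid₃ S
    pointwise S = trans (split-restrict (w S) (split S))
      (cong₂ _+_ (cong₂ _+_ (cong (λ v → f single S + v) (diff≡ avoid₁)) (diff≡ avoid₂)) (diff≡ avoid₃))
      where
      diff≡ : ∀ D → restrict (in? D S) (w S) - restrict (in? D S ∧ in? single S) (w S) ≡ diff D S
      diff≡ D = cong (λ b → f D S - restrict b (w S)) (sym (covers-∧ (D ∘ class) (single ∘ class) S))

-- Divisibility by products of primes, and counting multiples

does-true : ∀ {a} {A : Set a} (A? : Dec A) → does A? ≡ true → A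
does-true (yes a) _ = a

does-false : ∀ {a} {A : Set a} (A? : Dec A) → does A? ≡ false → ¬ A
does-false (no ¬a) _ = ¬a

div : ℕ → ℕ → Bool
div d k = does (d ∣? k)

-- Coprimality enters as the cancellation property that the proof applies: write `k = mj` and strip
-- `m` from the divisibility by `n`. Euclid's lemma provides it for primes.
div-coprime-* : ∀ m n → (∀ j → n ∣ m ℕ.* j → n ∣ j) → ∀ k → div (m ℕ.* n) k ≡ div m k ∧ div n k
div-coprime-* m n coprime k = does-⇔
  (mk⇔ (λ mn∣k → ∣-trans (m∣m*n n) mn∣k , ∣-trans (n∣m*n m) mn∣k) both)
  (m ℕ.* n ∣? k) (m ∣? k ×-dec n ∣? k)
  where
  both : (m ∣ k) × (n ∣ k) → m ℕ.* n ∣ k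
  both (divides j k≡jm , n∣k) = subst (m ℕ.* n ∣_) (sym k≡mj)
    (*-monoʳ-∣ m (coprime j (subst (n ∣_) k≡mj n∣k)))
    where
    k≡mj : k ≡ m ℕ.* j
    k≡mj = trans k≡jm (ℕP.*-comm j m)

div-prime-* : ∀ {p} → Prime p → ∀ j k → div p (j ℕ.* k) ≡ div p j ∨ div p k
div-prime-* {p} pp j k = does-⇔
  (mk⇔ (euclidsLemma j k pp) [ ∣m⇒∣m*n k , ∣n⇒∣m*n j ]′)
  (p ∣? j ℕ.* k) (p ∣? j ⊎-dec p ∣? k)

smaller-coprime : ∀ {p q} → Prime p → Prime q → p < q → ∀ j → q ∣ p ℕ.* j → q ∣ j
smaller-coprime {p} pp pq p<q j q∣pj with euclidsLemma p j pq q∣pj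
... | inj₂ q∣j = q∣j
... | inj₁ q∣p = contradiction (∣⇒≤ q∣p) (ℕP.<⇒≱ p<q)
  where instance _ = prime⇒nonZero pp

sumBelow : (ℕ → ℕ) → ℕ → ℕ
sumBelow f n = sum {n} (f ∘ toℕ)

sumBelow-+ : ∀ f m n → sumBelow f (m ℕ.+ n) ≡ sumBelow f m ℕ.+ sumBelow (f ∘ (m ℕ.+_)) n
sumBelow-+ f zero    n = refl
sumBelow-+ f (suc m) n =
  trans (cong (f 0 ℕ.+_) (sumBelow-+ (f ∘ suc) m n)) (sym (ℕP.+-assoc (f 0) _ _))

sumBelow-cong : ∀ {f g} → (∀ k → f k ≡ g k) → ∀ n → sumBelow f n ≡ sumBelow g n
sumBelow-cong f≡g n = sum-cong-≗ {n} (λ i → f≡g (toℕ i))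

sumBelow-zero : ∀ f n → (∀ k → k < n → f k ≡ 0) → sumBelow f n ≡ 0
sumBelow-zero f zero    h = refl
sumBelow-zero f (suc n) h = cong₂ ℕ._+_ (h 0 (ℕ.s≤s ℕ.z≤n))
  (sumBelow-zero (f ∘ suc) n λ k k<n → h (suc k) (ℕ.s≤s k<n))

multiples-first : ∀ d .{{_ : ℕ.NonZero d}} → sumBelow (indicator ∘ div d) d ≡ 1
multiples-first d@(suc d′) = cong₂ ℕ._+_
  (cong indicator (dec-true (d ∣? 0) (d ∣0)))
  (sumBelow-zero (indicator ∘ div d ∘ suc) d′ λ k k<d′ →
    cong indicator (dec-false (d ∣? suc k) λ d∣k → ℕP.<⇒≱ (ℕ.s≤s k<d′) (∣⇒≤ d∣k)))

-- The range is cut into `k` blocks of length `d`, each with exactly one multiple, at its start.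
multiples : ∀ d .{{_ : ℕ.NonZero d}} k → sumBelow (indicator ∘ div d) (k ℕ.* d) ≡ k
multiples d zero    = refl
multiples d (suc k) = begin
  sumBelow (indicator ∘ div d) (d ℕ.+ k ℕ.* d)
    ≡⟨ sumBelow-+ (indicator ∘ div d) d (k ℕ.* d) ⟩
  sumBelow (indicator ∘ div d) d ℕ.+ sumBelow (indicator ∘ div d ∘ (d ℕ.+_)) (k ℕ.* d)
    ≡⟨ cong₂ ℕ._+_ (multiples-first d) (trans (sumBelow-cong shift (k ℕ.* d)) (multiples d k)) ⟩
  suc k ∎
  where
  open ≡-Reasoning
  shift : ∀ j → indicator (div d (d ℕ.+ j)) ≡ indicator (div d j)
  shift j = cong indicator (does-⇔ (mk⇔ (λ h → ∣m+n∣m⇒∣n h ∣-refl) (∣m∣n⇒∣m+n ∣-refl))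
                              (d ∣? d ℕ.+ j) (d ∣? j))

exact : Class → Class → ℕ
exact (x , y , z) (x′ , y′ , z′) = indicator (same x x′ ∧ (same y y′ ∧ same z z′))
  where
  same : Bool → Bool → Bool
  same true  b = b
  same false b = not b

-- Linear relations between counts are checked on the eight classes separately, where both sides
-- evaluate to numerals.
byCases : ∀ {f g : Class → ℕ} →
  f (true  , true  , true ) ≡ g (true  , true  , true ) →
  f (true  , true  , false) ≡ g (true  , true  , false) →
  f (true  , false , true ) ≡ g (true  , false , true ) →
  f (true  , false , false) ≡ g (true  , false , false) →
  f (false , true  , true ) ≡ g (false , true  , true ) →
  f (false , true  , false) ≡ g (false , true  , false) →
  f (false , false , true ) ≡ g (false , false , true ) →
  f (false , false , false) ≡ g (false , false , false) →
  ∀ c → f c ≡ g c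
byCases e _ _ _ _ _ _ _ (true  , true  , true ) = e
byCases _ e _ _ _ _ _ _ (true  , true  , false) = e
byCases _ _ e _ _ _ _ _ (true  , false , true ) = e
byCases _ _ _ e _ _ _ _ (true  , false , false) = e
byCases _ _ _ _ e _ _ _ (false , true  , true ) = e
byCases _ _ _ _ _ e _ _ (false , true  , false) = e
byCases _ _ _ _ _ _ e _ (false , false , true ) = e
byCases _ _ _ _ _ _ _ e (false , false , false) = e

any-join : ∀ c d → all d ≡ false → all (join c d) ≡ true → any c ≡ true
any-join (true  , _     , _    ) d _ _ = refl
any-join (false , true  , _    ) d _ _ = refl
any-join (false , false , true ) d _ _ = refl
any-join (false , false , false) d e e′ with () ← trans (sym e) e′

proper-any : ∀ {c} → proper c ≡ true → any c ≡ true × all c ≡ false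
proper-any {c} e with any c | all c
... | true | false = refl , refl

-- The zero divisor graph of the integers modulo `pqr`

module ThreePrimes {a b c n : ℕ} (pp : Prime (suc a)) (pq : Prime (suc b)) (pr : Prime (suc c))
                   (p<q : suc a < suc b) (q<r : suc b < suc c)
                   (pqr≡n : suc a ℕ.* suc b ℕ.* suc c ≡ n) where

  p q r : ℕ
  p = suc a
  q = suc b
  r = suc c

  instance
    n≢0 : ℕ.NonZero n
    n≢0 = subst ℕ.NonZero pqr≡n _

  p*qr≡n : p ℕ.* (q ℕ.* r) ≡ n
  p*qr≡n = trans (sym (ℕP.*-assoc p q r)) pqr≡n

  q*pr≡n : q ℕ.* (p ℕ.* r) ≡ n
  q*pr≡n = trans (sym (ℕP.*-assoc q p r)) (trans (cong (ℕ._* r) (ℕP.*-comm q p)) pqr≡n)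

  r*pq≡n : r ℕ.* (p ℕ.* q) ≡ n
  r*pq≡n = trans (ℕP.*-comm r (p ℕ.* q)) pqr≡n

  class : ℕ → Class
  class k = div p k , div q k , div r k

  p<r : p < r
  p<r = ℕP.<-trans p<q q<r

  div-pq : ∀ k → div (p ℕ.* q) k ≡ div p k ∧ div q k
  div-pq = div-coprime-* p q (smaller-coprime pp pq p<q)

  div-pr : ∀ k → div (p ℕ.* r) k ≡ div p k ∧ div r k
  div-pr = div-coprime-* p r (smaller-coprime pp pr p<r)

  div-qr : ∀ k → div (q ℕ.* r) k ≡ div q k ∧ div r k
  div-qr = div-coprime-* q r (smaller-coprime pq pr q<r)

  div-n : ∀ k → div n k ≡ all (class k)
  div-n k = trans (cong (λ n → div n k) (sym pqr≡n)) (trans (div-coprime-* (p ℕ.* q) r coprime k)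
    (trans (cong (_∧ div r k) (div-pq k)) (∧-assoc (div p k) (div q k) (div r k))))
    where
    coprime : ∀ j → r ∣ p ℕ.* q ℕ.* j → r ∣ j
    coprime j h = smaller-coprime pq pr q<r j (smaller-coprime pp pr p<r (q ℕ.* j)
      (subst (r ∣_) (ℕP.*-assoc p q j) h))

  class-* : ∀ j k → class (j ℕ.* k) ≡ join (class j) (class k)
  class-* j k = cong₂ _,_ (div-prime-* pp j k) (cong₂ _,_ (div-prime-* pq j k) (div-prime-* pr j k))

  all-join : ∀ j k → div n (j ℕ.* k) ≡ all (join (class j) (class k))
  all-join j k = trans (div-n (j ℕ.* k)) (cong all (class-* j k))

  nonzero-all : ∀ {i : Fin n} → ¬ IsZero i → all (class (toℕ i)) ≡ false
  nonzero-all {i} i≢0 = trans (sym (div-n (toℕ i))) (dec-false (n ∣? toℕ i) λ n∣i →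
    ℕP.<⇒≱ (toℕ<n i) (∣⇒≤ {{ℕ.≢-nonZero i≢0}} n∣i))

  all-nonzero : ∀ {i : Fin n} → all (class (toℕ i)) ≡ false → ¬ IsZero i
  all-nonzero {i} e i≡0 = does-false (n ∣? toℕ i) (trans (div-n (toℕ i)) e)
    (subst (n ∣_) (sym i≡0) (n ∣0))

  product-zero⇒ : ∀ {i j : Fin n} → IsZero (i · j) → n ∣ toℕ i ℕ.* toℕ j
  product-zero⇒ {i} {j} e = m%n≡0⇒n∣m (toℕ i ℕ.* toℕ j) n {{nonZeroIndex i}} (trans (sym (toℕ-fromℕ< _)) e)

  product-zero⇐ : ∀ {i j : Fin n} → n ∣ toℕ i ℕ.* toℕ j → IsZero (i · j)
  product-zero⇐ {i} {j} h = trans (toℕ-fromℕ< _) (n∣m⇒m%n≡0 (toℕ i ℕ.* toℕ j) n {{nonZeroIndex i}} h)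

  product-zero-join : ∀ {i j : Fin n} → IsZero (i · j) → all (join (class (toℕ i)) (class (toℕ j))) ≡ true
  product-zero-join {i} {j} z = trans (sym (all-join (toℕ i) (toℕ j)))
    (dec-true (n ∣? toℕ i ℕ.* toℕ j) (product-zero⇒ {i} {j} z))

  open SimpleGraph (zeroDivisorGraph n)

  vertex⇒ : ∀ i → IsVertex i → proper (class (toℕ i)) ≡ true
  vertex⇒ i (i≢0 , j , j≢0 , z) = cong₂ (λ x y → x ∧ not y)
    (any-join (class (toℕ i)) (class (toℕ j)) (nonzero-all {j} j≢0) (product-zero-join {i} {j} z))
    (nonzero-all {i} i≢0)

  -- The annihilator of `i` is the cofactor `m`: it is a valid residue because `d > 1`, and nonzero
  -- because `n` is.
  divisor-vertex : ∀ {i : Fin n} d m → d ℕ.* m ≡ n → 1 < d → d ∣ toℕ i → ¬ IsZero i → IsVertex i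
  divisor-vertex d zero d0≡n 1<d d∣i i≢0 with () ← trans (sym (ℕP.*-zeroʳ d)) (trans d0≡n (sym pqr≡n))
  divisor-vertex {i} d m@(suc m′) dm≡n 1<d d∣i i≢0 = i≢0 , j , j≢0 , product-zero⇐ {i} {j}
    (subst₂ _∣_ dm≡n (cong (toℕ i ℕ.*_) (sym (toℕ-fromℕ< m<n))) (*-monoˡ-∣ m d∣i))
    where
    m<n : m < n
    m<n = subst (m <_) dm≡n (subst (m <_) (ℕP.*-comm m d) (ℕP.m<m*n m d 1<d))
    j : Fin n
    j = fromℕ< m<n
    j≢0 : ¬ IsZero j
    j≢0 e with () ← trans (sym (toℕ-fromℕ< m<n)) e

  prime>1 : ∀ {p} → Prime p → 1 < p
  prime>1 pp = ℕ.nonTrivial⇒n>1 _ {{prime⇒nonTrivial pp}}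

  any-divisor : ∀ {x y z} → any (x , y , z) ≡ true → x ≡ true ⊎ y ≡ true ⊎ z ≡ true
  any-divisor {true}                _ = inj₁ refl
  any-divisor {false} {true}        _ = inj₂ (inj₁ refl)
  any-divisor {false} {false} {true} _ = inj₂ (inj₂ refl)

  vertex⇐ : ∀ i → proper (class (toℕ i)) ≡ true → IsVertex i
  vertex⇐ i e with proper-any {class (toℕ i)} e
  ... | any-i , all-i with any-divisor any-i
  ...   | inj₁ p∣i = divisor-vertex {i} p (q ℕ.* r) p*qr≡n (prime>1 pp)
                       (does-true (p ∣? toℕ i) p∣i) (all-nonzero {i} all-i)
  ...   | inj₂ (inj₁ q∣i) = divisor-vertex {i} q (p ℕ.* r) q*pr≡n (prime>1 pq)
                       (does-true (q ∣? toℕ i) q∣i) (all-nonzero {i} all-i)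
  ...   | inj₂ (inj₂ r∣i) = divisor-vertex {i} r (p ℕ.* q) r*pq≡n (prime>1 pr)
                       (does-true (r ∣? toℕ i) r∣i) (all-nonzero {i} all-i)

  adj⇒ : ∀ i j → Adj i j → all (join (class (toℕ i)) (class (toℕ j))) ≡ true
  adj⇒ i j (_ , z) = product-zero-join {i} {j} z

  adj⇐ : ∀ i j → i ≢ j → all (join (class (toℕ i)) (class (toℕ j))) ≡ true → Adj i j
  adj⇐ i j i≢j e = i≢j , product-zero⇐ {i} {j}
    (does-true (n ∣? toℕ i ℕ.* toℕ j) (trans (all-join (toℕ i) (toℕ j)) e))

  open ClassifiedGraph (zeroDivisorGraph n) (class ∘ toℕ)
    vertex⇒ vertex⇐ adj⇒ adj⇐
    using (sum-independent; count)

  total : (Class → ℕ) → ℕ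
  total w = sumBelow (w ∘ class) n

  total-cong : ∀ {v w} → (∀ c → v c ≡ w c) → total v ≡ total w
  total-cong v≡w = sumBelow-cong (v≡w ∘ class) n

  total-+ : ∀ v w → total (λ c → v c ℕ.+ w c) ≡ total v ℕ.+ total w
  total-+ v w = ∑-distrib-+ {n} (v ∘ class ∘ toℕ) (w ∘ class ∘ toℕ)

  total-multiples : ∀ w d .{{_ : ℕ.NonZero d}} m → m ℕ.* d ≡ n →
    (∀ k → w (class k) ≡ indicator (div d k)) → total w ≡ m
  total-multiples w d m md≡n h = trans (sumBelow-cong h n)
    (trans (cong (sumBelow (indicator ∘ div d)) (sym md≡n)) (multiples d m))

  x₀₁₁ x₁₀₁ x₁₁₀ x₁₁₁ x₁₀₀ x₀₁₀ x₀₀₁ : Class → ℕ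
  x₁₁₁ = exact (true  , true  , true )
  x₀₁₁ = exact (false , true  , true )
  x₁₀₁ = exact (true  , false , true )
  x₁₁₀ = exact (true  , true  , false)
  x₁₀₀ = exact (true  , false , false)
  x₀₁₀ = exact (false , true  , false)
  x₀₀₁ = exact (false , false , true )

  -- Totals range over all residues, and 0 is the only one divisible by all three primes. The counts
  -- below subtract it.
  total₁₁₁ : total x₁₁₁ ≡ 1
  total₁₁₁ = total-multiples x₁₁₁ n 1 (ℕP.*-identityˡ n) (λ k → cong indicator (sym (div-n k)))

  total-sum₂ : ∀ w u v → (∀ c → w c ≡ u c ℕ.+ v c) → total w ≡ total u ℕ.+ total v
  total-sum₂ w u v h = trans (total-cong {w} {λ c → u c ℕ.+ v c} h) (total-+ u v)

  total-sum₃ : ∀ w s u v → (∀ c → w c ≡ s c ℕ.+ u c ℕ.+ v c) → total w ≡ total s ℕ.+ total u ℕ.+ total v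
  total-sum₃ w s u v h = trans (total-sum₂ w (λ c → s c ℕ.+ u c) v h) (cong (ℕ._+ total v) (total-+ s u))

  total-double : ∀ w u {k} → total w ≡ suc k → (∀ c → w c ≡ u c ℕ.+ x₁₁₁ c) → total u ≡ k
  total-double w u {k} e h = ℕP.+-cancelʳ-≡ 1 (total u) k (begin
    total u ℕ.+ 1              ≡⟨ cong (total u ℕ.+_) total₁₁₁ ⟨
    total u ℕ.+ total x₁₁₁     ≡⟨ total-sum₂ w u x₁₁₁ h ⟨
    total w                    ≡⟨ e ⟩
    suc k                      ≡⟨ ℕP.+-comm 1 k ⟩
    k ℕ.+ 1                    ∎)
    where open ≡-Reasoning

  total₀₁₁ : total x₀₁₁ ≡ a
  total₀₁₁ = total-double (λ (x , y , z) → indicator (y ∧ z)) x₀₁₁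
    (total-multiples (λ (x , y , z) → indicator (y ∧ z))
      (q ℕ.* r) p p*qr≡n (λ k → cong indicator (sym (div-qr k))))
    (byCases refl refl refl refl refl refl refl refl)

  total₁₀₁ : total x₁₀₁ ≡ b
  total₁₀₁ = total-double (λ (x , y , z) → indicator (x ∧ z)) x₁₀₁
    (total-multiples (λ (x , y , z) → indicator (x ∧ z))
      (p ℕ.* r) q q*pr≡n (λ k → cong indicator (sym (div-pr k))))
    (byCases refl refl refl refl refl refl refl refl)

  total₁₁₀ : total x₁₁₀ ≡ c
  total₁₁₀ = total-double (λ (x , y , z) → indicator (x ∧ y)) x₁₁₀
    (total-multiples (λ (x , y , z) → indicator (x ∧ y))
      (p ℕ.* q) r r*pq≡n (λ k → cong indicator (sym (div-pq k))))
    (byCases refl refl refl refl refl refl refl refl)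

  -- From the multiples of one prime, the two classes with a second prime and the residue 0 are
  -- removed: `(k + 1)(l + 1) - k - l - 1 = kl`.
  total-single : ∀ w u v v′ {k l} → total w ≡ suc k ℕ.* suc l → total v ≡ k → total v′ ≡ l →
    (∀ c → w c ≡ u c ℕ.+ (v c ℕ.+ v′ c ℕ.+ x₁₁₁ c)) → total u ≡ k ℕ.* l
  total-single w u v v′ {k} {l} e vk v′l h = ℕP.+-cancelʳ-≡ (k ℕ.+ l ℕ.+ 1) (total u) (k ℕ.* l) (begin
    total u ℕ.+ (k ℕ.+ l ℕ.+ 1)
      ≡⟨ cong (total u ℕ.+_) (cong₂ ℕ._+_ (cong₂ ℕ._+_ vk v′l) total₁₁₁) ⟨
    total u ℕ.+ (total v ℕ.+ total v′ ℕ.+ total x₁₁₁)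
      ≡⟨ cong (total u ℕ.+_) (total-sum₃ (λ c → v c ℕ.+ v′ c ℕ.+ x₁₁₁ c) v v′ x₁₁₁ (λ _ → refl)) ⟨
    total u ℕ.+ total (λ c → v c ℕ.+ v′ c ℕ.+ x₁₁₁ c)
      ≡⟨ total-sum₂ w u (λ c → v c ℕ.+ v′ c ℕ.+ x₁₁₁ c) h ⟨
    total w               ≡⟨ e ⟩
    suc k ℕ.* suc l
      ≡⟨ solve 2 (λ k l → (con 1 :+ k) :* (con 1 :+ l) := k :* l :+ (k :+ l :+ con 1)) refl k l ⟩
    k ℕ.* l ℕ.+ (k ℕ.+ l ℕ.+ 1) ∎)
    where
    open ≡-Reasoning
    open ℕ-Solver

  total₁₀₀ : total x₁₀₀ ≡ b ℕ.* c
  total₁₀₀ = total-single (λ (x , _) → indicator x) x₁₀₀ x₁₀₁ x₁₁₀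
    (total-multiples (λ (x , _) → indicator x)
      p (q ℕ.* r) (trans (ℕP.*-comm (q ℕ.* r) p) p*qr≡n) (λ _ → refl)) total₁₀₁ total₁₁₀
    (byCases refl refl refl refl refl refl refl refl)

  total₀₁₀ : total x₀₁₀ ≡ a ℕ.* c
  total₀₁₀ = total-single (λ (_ , y , _) → indicator y) x₀₁₀ x₀₁₁ x₁₁₀
    (total-multiples (λ (_ , y , _) → indicator y)
      q (p ℕ.* r) (trans (ℕP.*-comm (p ℕ.* r) q) q*pr≡n) (λ _ → refl)) total₀₁₁ total₁₁₀
    (byCases refl refl refl refl refl refl refl refl)

  total₀₀₁ : total x₀₀₁ ≡ a ℕ.* b
  total₀₀₁ = total-single (λ (_ , _ , z) → indicator z) x₀₀₁ x₀₁₁ x₁₀₁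
    (total-multiples (λ (_ , _ , z) → indicator z)
      r (p ℕ.* q) pqr≡n (λ _ → refl)) total₀₁₁ total₁₀₁
    (byCases refl refl refl refl refl refl refl refl)

  count-sum₂ : ∀ D u v {k l} → total u ≡ k → total v ≡ l →
    (∀ c → indicator (D c) ≡ u c ℕ.+ v c) → count D ≡ k ℕ.+ l
  count-sum₂ D u v ek el h = trans (total-sum₂ (indicator ∘ D) u v h) (cong₂ ℕ._+_ ek el)

  count-sum₃ : ∀ D s u v {k l m} → total s ≡ k → total u ≡ l → total v ≡ m →
    (∀ c → indicator (D c) ≡ s c ℕ.+ u c ℕ.+ v c) → count D ≡ k ℕ.+ l ℕ.+ m
  count-sum₃ D s u v ek el em h =
    trans (total-sum₃ (indicator ∘ D) s u v h) (cong₂ ℕ._+_ (cong₂ ℕ._+_ ek el) em)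

  private
    open ℕ-Solver

    count-single : count single ≡ e₀ a b c
    count-single = trans (count-sum₃ single x₁₀₀ x₀₁₀ x₀₀₁ total₁₀₀ total₀₁₀ total₀₀₁
      (byCases refl refl refl refl refl refl refl refl))
      (solve 3 (λ a b c → b :* c :+ a :* c :+ a :* b := a :* (b :+ c) :+ b :* c) refl a b c)

    count-avoid₁ : count avoid₁ ≡ a ℕ.+ e₁ a b c
    count-avoid₁ = trans (count-sum₃ avoid₁ x₀₁₁ x₀₁₀ x₀₀₁ total₀₁₁ total₀₁₀ total₀₀₁
      (byCases refl refl refl refl refl refl refl refl))
      (solve 3 (λ a b c → a :+ a :* c :+ a :* b := a :+ a :* (b :+ c)) refl a b c)

    count-avoid₂ : count avoid₂ ≡ b ℕ.+ e₁ b a c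
    count-avoid₂ = trans (count-sum₃ avoid₂ x₁₀₁ x₁₀₀ x₀₀₁ total₁₀₁ total₁₀₀ total₀₀₁
      (byCases refl refl refl refl refl refl refl refl))
      (solve 3 (λ a b c → b :+ b :* c :+ a :* b := b :+ b :* (a :+ c)) refl a b c)

    count-avoid₃ : count avoid₃ ≡ c ℕ.+ e₁ c a b
    count-avoid₃ = trans (count-sum₃ avoid₃ x₁₁₀ x₁₀₀ x₀₁₀ total₁₁₀ total₁₀₀ total₀₁₀
      (byCases refl refl refl refl refl refl refl refl))
      (solve 3 (λ a b c → c :+ b :* c :+ a :* c := c :+ c :* (a :+ b)) refl a b c)

    count-single₁ : count (λ d → avoid₁ d ∧ single d) ≡ e₁ a b c
    count-single₁ = trans (count-sum₂ (λ d → avoid₁ d ∧ single d) x₀₁₀ x₀₀₁ total₀₁₀ total₀₀₁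
      (byCases refl refl refl refl refl refl refl refl))
      (solve 3 (λ a b c → a :* c :+ a :* b := a :* (b :+ c)) refl a b c)

    count-single₂ : count (λ d → avoid₂ d ∧ single d) ≡ e₁ b a c
    count-single₂ = trans (count-sum₂ (λ d → avoid₂ d ∧ single d) x₁₀₀ x₀₀₁ total₁₀₀ total₀₀₁
      (byCases refl refl refl refl refl refl refl refl))
      (solve 3 (λ a b c → b :* c :+ a :* b := b :* (a :+ c)) refl a b c)

    count-single₃ : count (λ d → avoid₃ d ∧ single d) ≡ e₁ c a b
    count-single₃ = trans (count-sum₂ (λ d → avoid₃ d ∧ single d) x₁₀₀ x₀₁₀ total₁₀₀ total₀₁₀
      (byCases refl refl refl refl refl refl refl refl))
      (solve 3 (λ a b c → b :* c :+ a :* c := c :* (a :+ b)) refl a b c)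

  eval-zeroDivisorGraph : ∀ x →
    P.eval (map natural (independenceCoefficients (zeroDivisorGraph n))) x ≡ shifted a b c (1# + x)
  eval-zeroDivisorGraph x = trans (eval-independence (zeroDivisorGraph n) x)
    (trans (sum-independent x) (cong₂ _+_ (cong₂ _+_ (cong₂ _+_
      (cong (y ^_) count-single)
      (cong₂ (λ k l → y ^ k - y ^ l) count-avoid₁ count-single₁))
      (cong₂ (λ k l → y ^ k - y ^ l) count-avoid₂ count-single₂))
      (cong₂ (λ k l → y ^ k - y ^ l) count-avoid₃ count-single₃)))
    where y = 1# + x

-- Locating Cauchy sequences and moduli

Eventually : (ℕ → Set) → Set
Eventually Q = ∃ λ N → ∀ n → N ≤ n → Q n

eventually-× : ∀ {Q R : ℕ → Set} → Eventually Q → Eventually R → Eventually (λ n → Q n × R n)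
eventually-× (M , f) (N , g) = M ℕ.⊔ N , λ n le →
  f n (ℕP.m⊔n≤o⇒m≤o M N le) , g n (ℕP.m⊔n≤o⇒n≤o M N le)

eventually-map : ∀ {Q R : ℕ → Set} → (∀ n → Q n → R n) → Eventually Q → Eventually R
eventually-map f (N , g) = N , λ n le → f n (g n le)

eventually-inhabited : ∀ {Q : ℕ → Set} → Eventually Q → ∃ Q
eventually-inhabited (N , g) = N , g N ℕP.≤-refl

near : ∀ {a b ε} → ℚ.∣ a ℚ.- b ∣ ℚ.< ε → a ℚ.< b ℚ.+ ε
near {a} {b} h = ℚP.≤-<-trans (≤-+-∣-∣ a b) (ℚP.+-monoʳ-< b h)

-- The constructive substitute for deciding an order. Past `N` the sequence varies by less than half
-- the gap, so comparing the one rational `u N` with the midpoint settles the side.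
cotransitive : ∀ u → Cauchy u → ∀ {s t} → s ℚ.< t →
  Eventually (λ n → s ℚ.≤ u n) ⊎ Eventually (λ n → u n ℚ.≤ t)
cotransitive u cu {s} {t} s<t with cu ε 0<ε
  where
  ε = ½ ℚ.* (t ℚ.- s)
  0<ε : 0ℚ ℚ.< ε
  0<ε = *-pos 0<½ (subst (ℚ._< t ℚ.- s) (ℚP.+-inverseʳ s) (ℚP.+-monoˡ-< (ℚ.- s) s<t))
... | N , h with ℚP.≤-total (½ ℚ.* (s ℚ.+ t)) (u N)
...   | inj₁ m≤u = inj₁ (N , λ n le → ℚP.<⇒≤ (subst₂ ℚ._<_ (eq₁ s t) (eq₂ (u n) s t)
          (ℚP.+-monoˡ-< (ℚ.- (½ ℚ.* (t ℚ.- s)))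
            (ℚP.≤-<-trans m≤u (near {u N} {u n} (h N n ℕP.≤-refl le))))))
  where
  open +-*-Solver
  eq₁ : ∀ s t → ½ ℚ.* (s ℚ.+ t) ℚ.- ½ ℚ.* (t ℚ.- s) ≡ s
  eq₁ = solve 2 (λ s t → con ½ :* (s :+ t) :- con ½ :* (t :- s) := s) refl
  eq₂ : ∀ v s t → v ℚ.+ ½ ℚ.* (t ℚ.- s) ℚ.- ½ ℚ.* (t ℚ.- s) ≡ v
  eq₂ = solve 3 (λ v s t → v :+ con ½ :* (t :- s) :- con ½ :* (t :- s) := v) refl
...   | inj₂ u≤m = inj₂ (N , λ n le → ℚP.<⇒≤ (subst (u n ℚ.<_) (eq s t)
          (ℚP.<-≤-trans (near {u n} {u N} (h n N le ℕP.≤-refl))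
            (ℚP.+-monoˡ-≤ (½ ℚ.* (t ℚ.- s)) u≤m))))
  where
  open +-*-Solver
  eq : ∀ s t → ½ ℚ.* (s ℚ.+ t) ℚ.+ ½ ℚ.* (t ℚ.- s) ≡ t
  eq = solve 2 (λ s t → con ½ :* (s :+ t) :+ con ½ :* (t :- s) := t) refl

-- Thresholds with 1/2 < τ < ρ and ρ⁻¹ < θ < θ′ < 2.
τ θ θ′ ρ⁻¹ : ℚ
τ   = + 503 / 1000
θ   = + 199 / 100
θ′  = + 399 / 200
ρ⁻¹ = + 200 / 101

-- The root is rounded down by up to `δ n`. Of the two `ε` below `τ`, one pays for the rounding and
-- the other is the gap that strict inequality of reals requires.
root-lower : ∀ {ε u n s} → IsRootApprox u n s → τ ℚ.* τ ℚ.≤ u → ½ ℚ.+ ε ℚ.+ ε ℚ.≤ τ →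
             δ n ℚ.≤ ε → ½ ℚ.+ ε ℚ.< s
root-lower {ε} {u} {n} {s} (0≤s , _ , u<[s+δ]²) τ²≤u ½+2ε≤τ δ≤ε = ℚP.≰⇒> λ s≤½+ε →
  ≤⇒≯ (ℚP.≤-trans
         (sq-mono-≤ (+-nonNeg 0≤s (0≤δ n)) (ℚP.≤-trans (ℚP.+-mono-≤ s≤½+ε δ≤ε) ½+2ε≤τ))
         (ℚP.≤-trans τ²≤u (ℚP.p≤p⊔q u 0ℚ)))
      u<[s+δ]²

root-upper : ∀ {u n s} → IsRootApprox u n s → u ℚ.≤ θ ℚ.* θ → s ℚ.< θ′
root-upper (_ , s²≤u , _) u≤θ² = sq-cancel-< (from-yes (0ℚ ℚP.≤? θ′)) (ℚP.≤-<-trans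
  (ℚP.≤-trans s²≤u (ℚP.⊔-lub u≤θ² (from-yes (0ℚ ℚP.≤? θ ℚ.* θ))))
  (from-yes (θ ℚ.* θ ℚP.<? θ′ ℚ.* θ′)))

√-approx : ∀ w n → IsRootApprox (seq w n) n (seq (√ w) n)
√-approx w n = proj₂ (rootApprox (seq w n) n)

½<‖‖ : ∀ z → Eventually (λ n → τ ℚ.* τ ℚ.≤ normSq (at n z)) → fromℚ ½ <ᴿ ‖ z ‖
½<‖‖ z ev = ε , 0<ε , eventually-map
    (λ n (τ²≤u , δ≤ε) → root-lower {ε} {n = n} (√-approx ∣z∣² n) τ²≤u (from-yes (½ ℚ.+ ε ℚ.+ ε ℚP.≤? τ)) δ≤ε)
    (eventually-× ev (δ-small ε 0<ε))
  where
  ∣z∣² : ℝ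
  ∣z∣² = re z *ᴿ re z +ᴿ im z *ᴿ im z
  ε : ℚ
  -- `τ` exceeds 1/2 by 3/1000, which leaves room for twice this value.
  ε = + 1 / 1000
  0<ε : 0ℚ ℚ.< ε
  0<ε = from-yes (0ℚ ℚP.<? ε)

‖‖<2 : ∀ z → Eventually (λ n → normSq (at n z) ℚ.≤ θ ℚ.* θ) → ‖ z ‖ <ᴿ fromℚ (+ 2 / 1)
‖‖<2 z ev = ε , from-yes (0ℚ ℚP.<? ε) , eventually-map
    (λ n u≤θ² → ℚP.<-≤-trans (ℚP.+-monoˡ-< ε (root-upper {n = n} (√-approx ∣z∣² n) u≤θ²))
                  (from-yes (θ′ ℚ.+ ε ℚP.≤? + 2 / 1))) ev
  where
  ∣z∣² : ℝ
  ∣z∣² = re z *ᴿ re z +ᴿ im z *ᴿ im z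
  ε : ℚ
  ε = + 1 / 200

normSq-small : ∀ {w E} → 0ℚ ℚ.< E → ℚ.∣ real w ∣ ℚ.< ½ ℚ.* E → ℚ.∣ imag w ∣ ℚ.< ½ ℚ.* E →
               normSq w ℚ.< E ℚ.* E
normSq-small {w} {E} 0<E hr hi = begin-strict
  real w ℚ.* real w ℚ.+ imag w ℚ.* imag w
    ≤⟨ ℚP.+-mono-≤ (part (real w) hr) (part (imag w) hi) ⟩
  ½ ℚ.* E ℚ.* (½ ℚ.* E) ℚ.+ ½ ℚ.* E ℚ.* (½ ℚ.* E)
    ≡⟨ eq E ⟩
  ½ ℚ.* (E ℚ.* E)
    <⟨ ℚP.*-monoˡ-<-pos (E ℚ.* E) {{ℚ.positive (*-pos 0<E 0<E)}} (from-yes (½ ℚP.<? 1ℚ)) ⟩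
  1ℚ ℚ.* (E ℚ.* E)
    ≡⟨ ℚP.*-identityˡ (E ℚ.* E) ⟩
  E ℚ.* E ∎
  where
  open ℚP.≤-Reasoning
  part : ∀ a → ℚ.∣ a ∣ ℚ.< ½ ℚ.* E → a ℚ.* a ℚ.≤ ½ ℚ.* E ℚ.* (½ ℚ.* E)
  part a h = subst (ℚ._≤ ½ ℚ.* E ℚ.* (½ ℚ.* E)) (∣a∣² a) (sq-mono-≤ (ℚP.0≤∣p∣ a) (ℚP.<⇒≤ h))
  open +-*-Solver
  eq : ∀ E → ½ ℚ.* E ℚ.* (½ ℚ.* E) ℚ.+ ½ ℚ.* E ℚ.* (½ ℚ.* E) ≡ ½ ℚ.* (E ℚ.* E)
  eq = solve 1 (λ E → con ½ :* E :* (con ½ :* E) :+ con ½ :* E :* (con ½ :* E) := con ½ :* (E :* E)) refl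

≃0⇒small : ∀ {z} → z ≃ 0ᶜ → ∀ {E} → 0ℚ ℚ.< E → Eventually (λ n → normSq (at n z) ℚ.< E ℚ.* E)
≃0⇒small {z} (hr , hi) {E} 0<E = eventually-map
  (λ n (kr , ki) → normSq-small 0<E (drop-0 (seq (re z) n) kr) (drop-0 (seq (im z) n) ki))
  (eventually-× (hr _ (*-pos 0<½ 0<E)) (hi _ (*-pos 0<½ 0<E)))
  where
  drop-0 : ∀ a → ℚ.∣ a ℚ.- 0ℚ ∣ ℚ.< ½ ℚ.* E → ℚ.∣ a ∣ ℚ.< ½ ℚ.* E
  drop-0 a = subst (λ b → ℚ.∣ b ∣ ℚ.< ½ ℚ.* E) (ℚP.+-identityʳ a)

0<^ℚ : ∀ {ε} → 0ℚ ℚ.< ε → ∀ m → 0ℚ ℚ.< ε ^ℚ m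
0<^ℚ 0<ε zero    = 0<1
0<^ℚ 0<ε (suc m) = *-pos 0<ε (0<^ℚ 0<ε m)

normSq-^-≥ : ∀ {y ε} → ε ℚ.* ε ℚ.≤ normSq y → ∀ m → ε ^ℚ m ℚ.* ε ^ℚ m ℚ.≤ normSq (y ^ m)
normSq-^-≥ h zero = ℚP.≤-refl
normSq-^-≥ {y} {ε} h (suc m) = begin
  ε ℚ.* e ℚ.* (ε ℚ.* e)          ≡⟨ eq ε e ⟩
  ε ℚ.* ε ℚ.* (e ℚ.* e)          ≤⟨ *-mono-≤ (0≤normSq y) (0≤a² e) h (normSq-^-≥ h m) ⟩
  normSq y ℚ.* normSq (y ^ m)    ≡⟨ normSq-* y (y ^ m) ⟨
  normSq (y * y ^ m)             ∎
  where
  open ℚP.≤-Reasoning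
  e = ε ^ℚ m
  open +-*-Solver
  eq : ∀ ε e → ε ℚ.* e ℚ.* (ε ℚ.* e) ≡ ε ℚ.* ε ℚ.* (e ℚ.* e)
  eq = solve 2 (λ ε e → ε :* e :* (ε :* e) := ε :* ε :* (e :* e)) refl

-- By contraposition: |y| ≥ ε would force the product up to `ε ^ℚ m ℚ.* η`. This gets smallness of
-- `y` from that of `y ^ m * w` without taking roots.
normSq-factor : ∀ {y w} {ε} → 0ℚ ℚ.< ε → ∀ m → η ℚ.* η ℚ.≤ normSq w →
  normSq (y ^ m * w) ℚ.< (ε ^ℚ m ℚ.* η) ℚ.* (ε ^ℚ m ℚ.* η) → normSq y ℚ.< ε ℚ.* ε
normSq-factor {y} {w} {ε} 0<ε m η²≤ small = ℚP.≰⇒> λ ε²≤ → ≤⇒≯ (begin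
  (e ℚ.* η) ℚ.* (e ℚ.* η)        ≡⟨ eq e η ⟩
  e ℚ.* e ℚ.* (η ℚ.* η)          ≤⟨ *-mono-≤ (0≤normSq (y ^ m)) (0≤a² η) (normSq-^-≥ ε²≤ m) η²≤ ⟩
  normSq (y ^ m) ℚ.* normSq w    ≡⟨ normSq-* (y ^ m) w ⟨
  normSq (y ^ m * w)             ∎) small
  where
  open ℚP.≤-Reasoning
  e = ε ^ℚ m
  open +-*-Solver
  eq : ∀ e h → (e ℚ.* h) ℚ.* (e ℚ.* h) ≡ e ℚ.* e ℚ.* (h ℚ.* h)
  eq = solve 2 (λ e h → (e :* h) :* (e :* h) := e :* e :* (h :* h)) refl

∣∣<-of-sq : ∀ {a ε} → 0ℚ ℚ.< ε → a ℚ.* a ℚ.< ε ℚ.* ε → ℚ.∣ a ∣ ℚ.< ε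
∣∣<-of-sq {a} {ε} 0<ε h = sq-cancel-< (ℚP.<⇒≤ 0<ε) (subst (ℚ._< ε ℚ.* ε) (sym (∣a∣² a)) h)

-- Stated for the approximations, since equality in ℂ would compare Cauchy moduli.
record IsMinusOne (z : ℂ) : Set where
  field at-≡ : ∀ n → at n z ≡ - 1#

record IsSuccessor (x y : ℂ) : Set where
  field at-≡ : ∀ n → at n y ≡ 1# + at n x

-1-isMinusOne : IsMinusOne (-ᶜ 1ᶜ)
-1-isMinusOne = record { at-≡ = λ n → at-neg n 1ᶜ }

1+-isSuccessor : ∀ x → IsSuccessor x (1ᶜ +ᶜ x)
1+-isSuccessor x = record { at-≡ = λ n → at-+ n 1ᶜ x }

opaque
  unfolding _+_ -_

  shifted-difference : ∀ x → ⟨ real x ℚ.- real (- 1#) , imag x ℚ.- imag (- 1#) ⟩ ≡ 1# + x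
  shifted-difference x = cong₂ ⟨_,_⟩
    (solve 1 (λ a → a :- (:- con 1ℚ) := con 1ℚ :+ a) refl (real x))
    (solve 1 (λ a → a :- (:- con 0ℚ) := con 0ℚ :+ a) refl (imag x))
    where open +-*-Solver

module _ {x y z : ℂ} (x+1≡y : IsSuccessor x y) (z≡-1 : IsMinusOne z) where

  private
    difference : ∀ n → ⟨ real (at n x) ℚ.- real (at n z) , imag (at n x) ℚ.- imag (at n z) ⟩ ≡ at n y
    difference n = begin
      ⟨ real (at n x) ℚ.- real (at n z) , imag (at n x) ℚ.- imag (at n z) ⟩
        ≡⟨ cong (λ w → ⟨ real (at n x) ℚ.- real w , imag (at n x) ℚ.- imag w ⟩)
             (IsMinusOne.at-≡ z≡-1 n) ⟩
      ⟨ real (at n x) ℚ.- real (- 1#) , imag (at n x) ℚ.- imag (- 1#) ⟩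
        ≡⟨ shifted-difference (at n x) ⟩
      1# + at n x
        ≡⟨ IsSuccessor.at-≡ x+1≡y n ⟨
      at n y ∎
      where open ≡-Reasoning

  small⇒≃-1 : (∀ ε → 0ℚ ℚ.< ε → Eventually (λ n → normSq (at n y) ℚ.< ε ℚ.* ε)) → x ≃ z
  small⇒≃-1 h =
    (λ ε 0<ε → eventually-map (λ n k →
      subst (λ a → ℚ.∣ a ∣ ℚ.< ε) (cong real (sym (difference n)))
        (∣∣<-of-sq 0<ε (ℚP.≤-<-trans (real²≤normSq (at n y)) k))) (h ε 0<ε)) ,
    (λ ε 0<ε → eventually-map (λ n k →
      subst (λ a → ℚ.∣ a ∣ ℚ.< ε) (cong imag (sym (difference n)))
        (∣∣<-of-sq 0<ε (ℚP.≤-<-trans (imag²≤normSq (at n y)) k))) (h ε 0<ε))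

-- Factoring out the power of `1 + X`

map-at-factor : ∀ n z m f →
  map (at n) (((X- z) ↑ m) ⊗ f) ≡ ((P.X- at n z) P.↑ m) P.⊗ map (at n) f
map-at-factor n z m f = trans (map-at-⊗ n ((X- z) ↑ m) f) (cong (P._⊗ map (at n) f)
  (trans (map-at-↑ n (X- z) m) (cong (P._↑ m) (map-at-X- n z))))

opaque
  unfolding _+_ -_

  1-1≡0 : 1# + - 1# ≡ 0#
  1-1≡0 = refl

  -[-1] : - - 1# ≡ 1#
  -[-1] = refl

-- The cofactor is an expression in `y = 1 + x`, while multiplicity asks for a coefficient list in
-- `x`. The combinators below build that list along the expression, together with the proof about
-- its values.
record Polynomial-in-1+X (φ : ℚ[i] → ℚ[i]) : Set where
  constructor _evaluatesBy_
  field
    poly      : P.Poly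
    eval-poly : ∀ x → P.eval poly x ≡ φ (1# + x)

open Polynomial-in-1+X

power : ∀ e → Polynomial-in-1+X (_^ e)
power e = ((P.X- (- 1#)) P.↑ e) evaluatesBy λ x → trans (eval-↑ (P.X- (- 1#)) e x)
  (cong (_^ e) (trans (eval-X- (- 1#) x) (cong (_+ x) -[-1])))

negation : ∀ {φ} → Polynomial-in-1+X φ → Polynomial-in-1+X (λ y → - φ y)
negation (f evaluatesBy eval-f) = map -_ f evaluatesBy λ x → trans (eval-neg f x) (cong -_ (eval-f x))

infixl 6 _plus_

_plus_ : ∀ {φ ψ} → Polynomial-in-1+X φ → Polynomial-in-1+X ψ → Polynomial-in-1+X (λ y → φ y + ψ y)
(f evaluatesBy eval-f) plus (g evaluatesBy eval-g) = (f P.⊕ g) evaluatesBy λ x →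
  trans (eval-⊕ f g x) (cong₂ _+_ (eval-f x) (eval-g x))

Factorisation : ℕ → ℕ → ℕ → Set
Factorisation a b c = ∃ λ G →
    (∀ x → shifted a b c (1# + x) ≡ (1# + x) ^ e₁ a b c * P.eval G x) ×
    (∀ x → 1# + x ≼ ρ → η ℚ.* η ℚ.≤ normSq (P.eval G x))

factorisation : ∀ {a s t} → 1 ≤ a → Factorisation a (suc a ℕ.+ s) (suc (suc a ℕ.+ s) ℕ.+ t)
factorisation {a} {s} {t} 1≤a = poly G ,
    (λ x → trans (shifted-factors (1# + x)) (cong ((1# + x) ^ e₁ a b c *_) (sym (eval-poly G x)))) ,
    λ x h → subst (λ w → η ℚ.* η ℚ.≤ normSq w) (sym (eval-poly G x)) (cofactor-large h)
  where
  open Exponents {a} {s} {t} 1≤a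
  G : Polynomial-in-1+X cofactor
  G = ((- 1# ∷ []) evaluatesBy eval-constant (- 1#)) plus
      (power a plus negation (power g₂) plus negation (power g₃) plus power (b ℕ.+ g₂)
        plus power (b ℕ.* c) plus power (c ℕ.+ g₃))

-- Multiplicity at -1 and location of the other zeros

module Annulus {a b c : ℕ} (1≤a : 1 ≤ a) (a<b : a < b) (b<c : b < c) where

  factors : Factorisation a b c
  factors = go (ℕP.m≤n⇒∃[o]m+o≡n a<b) (ℕP.m≤n⇒∃[o]m+o≡n b<c)
    where
    -- Naming the differences lets `refl` replace `b` and `c` by the sums for which `factorisation`
    -- is stated.
    go : ∀ {b c} → ∃ (λ s → suc a ℕ.+ s ≡ b) → ∃ (λ t → suc b ℕ.+ t ≡ c) → Factorisation a b c
    go (s , refl) (t , refl) = factorisation 1≤a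

  -- The inverse `z` has modulus at most `ρ`, so `z ^ T` has modulus at most 1 and the lower bound
  -- survives its removal.
  shifted-large-outside : ∀ {y} → ρ⁻¹ ℚ.* ρ⁻¹ ℚ.≤ normSq y → η ℚ.* η ℚ.≤ normSq (shifted a b c y)
  shifted-large-outside {y} big = begin
      η ℚ.* η                                     ≤⟨ proj₂ large ⟩
      normSq (z ^ T * shifted a b c y)              ≡⟨ normSq-* (z ^ T) (shifted a b c y) ⟩
      normSq (z ^ T) ℚ.* normSq (shifted a b c y)
        ≤⟨ ℚP.*-monoʳ-≤-nonNeg (normSq (shifted a b c y))
             {{ℚ.nonNegative (0≤normSq (shifted a b c y))}} (normSq≤ zᵀ≼1) ⟩
      1ℚ ℚ.* normSq (shifted a b c y)               ≡⟨ ℚP.*-identityˡ _ ⟩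
      normSq (shifted a b c y)                      ∎
    where
    open ℚP.≤-Reasoning
    inv : ∃ λ z → z * y ≡ 1#
    inv = inverse {y} (ℚP.<-≤-trans (from-yes (0ℚ ℚP.<? ρ⁻¹ ℚ.* ρ⁻¹)) big)
    z : ℚ[i]
    z = proj₁ inv
    zy≡1 : z * y ≡ 1#
    zy≡1 = proj₂ inv
    z≼ρ : z ≼ ρ
    z≼ρ = 0≤ρ & ℚP.≮⇒≥ λ ρ²<z → ℚP.<-irrefl refl (begin-strict
      1ℚ                                    ≡⟨⟩
      ρ ℚ.* ρ ℚ.* (ρ⁻¹ ℚ.* ρ⁻¹)
        <⟨ ℚP.*-monoˡ-<-pos (ρ⁻¹ ℚ.* ρ⁻¹) ρ²<z ⟩
      normSq z ℚ.* (ρ⁻¹ ℚ.* ρ⁻¹)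
        ≤⟨ ℚP.*-monoˡ-≤-nonNeg (normSq z) {{ℚ.nonNegative (0≤normSq z)}} big ⟩
      normSq z ℚ.* normSq y                 ≡⟨ normSq-* z y ⟨
      normSq (z * y)                        ≡⟨ cong normSq zy≡1 ⟩
      1ℚ                                    ∎)
    large : ∃ λ T → η ℚ.* η ℚ.≤ normSq (z ^ T * shifted a b c y)
    large = Reciprocal.shifted-large 1≤a a<b b<c zy≡1 z≼ρ
    T : ℕ
    T = proj₁ large
    zᵀ≼1 : z ^ T ≼ 1ℚ
    zᵀ≼1 = ≼-^ {e = T} ρ≤1 z≼ρ ℕ.z≤n

  -- With `I` a variable, no step can unfold the enumeration of independent sets. What is used is
  -- that its coefficients are constant sequences: every index gives the same polynomial `f`.
  module Zeros (f : P.Poly) (I : Poly) (I≡f : ∀ n → map (at n) I ≡ f)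
           (eval-f : ∀ x → P.eval f x ≡ shifted a b c (1# + x))
           {z : ℂ} (z≡-1 : IsMinusOne z) where

    private
      G : P.Poly
      G = proj₁ factors

      shifted≡ : ∀ x → shifted a b c (1# + x) ≡ (1# + x) ^ e₁ a b c * P.eval G x
      shifted≡ = proj₁ (proj₂ factors)

      G-large : ∀ x → 1# + x ≼ ρ → η ℚ.* η ℚ.≤ normSq (P.eval G x)
      G-large = proj₂ (proj₂ factors)

      m : ℕ
      m = e₁ a b c

      X+1 : P.Poly
      X+1 = P.X- (- 1#)

      g : Poly
      g = map constant G

      f≋ : f P.≋ (X+1 P.↑ m) P.⊗ G
      f≋ = eval-injective f ((X+1 P.↑ m) P.⊗ G) λ x → trans (eval-f x) (trans (shifted≡ x)
        (sym (trans (eval-⊗ (X+1 P.↑ m) G x) (cong (_* P.eval G x)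
          (trans (eval-↑ X+1 m x) (cong (_^ m) (trans (eval-X- (- 1#) x) (cong (_+ x) -[-1]))))))))

      map-at-factors : ∀ n → map (at n) (((X- z) ↑ m) ⊗ g) ≡ (X+1 P.↑ m) P.⊗ G
      map-at-factors n = trans (map-at-factor n z m g)
        (cong₂ (λ v h → ((P.X- v) P.↑ m) P.⊗ h) (IsMinusOne.at-≡ z≡-1 n) (map-at-constant n G))

      at-eval-g : ∀ n → at n (eval g z) ≡ P.eval G (- 1#)
      at-eval-g n = trans (at-eval n g z) (cong₂ P.eval (map-at-constant n G) (IsMinusOne.at-≡ z≡-1 n))

      -- At `x = -1` the variable `1 + x` is 0, the centre of the disc on which the cofactor has
      -- modulus at least `η`. This makes the multiplicity exact.
      nonzero : ¬ IsZeroOf z g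
      nonzero z₀ =
        let n , small = eventually-inhabited (≃0⇒small {eval g z} z₀ 0<η)
        in ≤⇒≯ (G-large (- 1#) (subst (_≼ ρ) (sym 1-1≡0) (0≼ 0≤ρ)))
               (subst (λ w → normSq w ℚ.< η ℚ.* η) (at-eval-g n) small)

      coeffs : ∀ k n → at n (coeff I k) ≡ at n (coeff (((X- z) ↑ m) ⊗ g) k)
      coeffs k n = begin
        at n (coeff I k)                              ≡⟨ at-coeff n I k ⟩
        P.coeff (map (at n) I) k                      ≡⟨ cong (λ h → P.coeff h k) (I≡f n) ⟩
        P.coeff f k                                   ≡⟨ f≋ k ⟩
        P.coeff ((X+1 P.↑ m) P.⊗ G) k                 ≡⟨ cong (λ h → P.coeff h k) (map-at-factors n) ⟨
        P.coeff (map (at n) (((X- z) ↑ m) ⊗ g)) k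
          ≡⟨ at-coeff n (((X- z) ↑ m) ⊗ g) k ⟨
        at n (coeff (((X- z) ↑ m) ⊗ g) k)             ∎
        where open ≡-Reasoning

    multiplicity : ∀ {k} → m ≡ k → IsZeroOfMultiplicity z k I
    multiplicity refl = g ,
      (λ k → ≃-pointwise {coeff I k} {coeff (((X- z) ↑ m) ⊗ g) k} (coeffs k)) , nonzero

    module _ {x y : ℂ} (x+1≡y : IsSuccessor x y) (zero-x : IsZeroOf x I) where
      private
        at-y : ∀ n → at n y ≡ 1# + at n x
        at-y = IsSuccessor.at-≡ x+1≡y

        at-I : ∀ n → at n (eval I x) ≡ shifted a b c (at n y)
        at-I n = trans (at-eval n I x) (trans (cong (λ h → P.eval h (at n x)) (I≡f n))
          (trans (eval-f (at n x)) (cong (shifted a b c) (sym (at-y n)))))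

        shifted-small : ∀ {E} → 0ℚ ℚ.< E → Eventually (λ n → normSq (shifted a b c (at n y)) ℚ.< E ℚ.* E)
        shifted-small {E} 0<E = eventually-map (λ n → subst (λ w → normSq w ℚ.< E ℚ.* E) (at-I n))
          (≃0⇒small {eval I x} zero-x 0<E)

      inside⇒≃-1 : Eventually (λ n → normSq (at n y) ℚ.≤ ρ ℚ.* ρ) → x ≃ z
      inside⇒≃-1 ev = small⇒≃-1 x+1≡y z≡-1 λ ε 0<ε → eventually-map (step ε 0<ε)
        -- The tolerance `ε ^ℚ m ℚ.* η` matches the factorisation: `η` is absorbed by the cofactor,
        -- and the `m`-th power leaves |y| < ε.
        (eventually-× ev (shifted-small (*-pos (0<^ℚ 0<ε m) 0<η)))
        where
        step : ∀ ε → 0ℚ ℚ.< ε → ∀ n →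
          normSq (at n y) ℚ.≤ ρ ℚ.* ρ ×
          normSq (shifted a b c (at n y)) ℚ.< (ε ^ℚ m ℚ.* η) ℚ.* (ε ^ℚ m ℚ.* η) →
          normSq (at n y) ℚ.< ε ℚ.* ε
        step ε 0<ε n (y≤ρ , small) = subst (λ w → normSq w ℚ.< ε ℚ.* ε) (sym (at-y n))
          (normSq-factor 0<ε m
            (G-large (at n x) (0≤ρ & subst (λ w → normSq w ℚ.≤ ρ ℚ.* ρ) (at-y n) y≤ρ))
            (subst (λ w → normSq w ℚ.< (ε ^ℚ m ℚ.* η) ℚ.* (ε ^ℚ m ℚ.* η))
              (trans (cong (shifted a b c) (at-y n)) (shifted≡ (at n x))) small))

      -- One index suffices: far enough out the value is below `η`, against the uniform lower bound
      -- `η` in this region.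
      outside⇒⊥ : Eventually (λ n → ρ⁻¹ ℚ.* ρ⁻¹ ℚ.≤ normSq (at n y)) → ⊥
      outside⇒⊥ ev =
        let n , big , small = eventually-inhabited (eventually-× ev (shifted-small 0<η))
        in ≤⇒≯ (shifted-large-outside {at n y} big) small

      -- Each bound locates |y|² between two thresholds, `τ` and `ρ` below, `ρ⁻¹` and `θ` above (all
      -- squared). One side of each dichotomy is excluded, the other gives the bound with room for
      -- the rounded square root.
      annulus : ¬ (x ≃ z) → fromℚ ½ <ᴿ ‖ y ‖ × ‖ y ‖ <ᴿ fromℚ (+ 2 / 1)
      annulus x≄-1 = lower , upper
        where
        u-cauchy : Cauchy (λ n → normSq (at n y))
        u-cauchy = cauchy (re y *ᴿ re y +ᴿ im y *ᴿ im y)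
        lower : fromℚ ½ <ᴿ ‖ y ‖
        lower = [ ½<‖‖ y , (λ ev → contradiction (inside⇒≃-1 ev) x≄-1) ]′
          (cotransitive _ u-cauchy (from-yes (τ ℚ.* τ ℚP.<? ρ ℚ.* ρ)))
        upper : ‖ y ‖ <ᴿ fromℚ (+ 2 / 1)
        upper = [ (λ ev → ⊥-elim (outside⇒⊥ ev)) , ‖‖<2 y ]′
          (cotransitive _ u-cauchy (from-yes (ρ⁻¹ ℚ.* ρ⁻¹ ℚP.<? θ ℚ.* θ)))

theorem4p2 :
    (p q r : ℕ) → Prime p → Prime q → Prime r → p < q → q < r →
    let I = independencePolynomial (zeroDivisorGraph (p ℕ.* q ℕ.* r)) in
    IsZeroOfMultiplicity (-ᶜ 1ᶜ) ((p ∸ 1) ℕ.* (q ℕ.+ r ∸ 2)) I ×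
    ((x : ℂ) → IsZeroOf x I → ¬ (x ≃ -ᶜ 1ᶜ) →
      fromℚ ½ <ᴿ ‖ 1ᶜ +ᶜ x ‖ × ‖ 1ᶜ +ᶜ x ‖ <ᴿ fromℚ (+ 2 / 1))
theorem4p2 zero    q       r       pp _  _  _   _   = contradiction pp ¬prime[0]
theorem4p2 (suc a) (suc b) (suc c) pp pq pr p<q q<r =
  multiplicity′ -1-isMinusOne e₁≡ ,
  λ x x-zero x≄-1 → annulus′ -1-isMinusOne (1+-isSuccessor x) x-zero x≄-1
  where
  open ThreePrimes pp pq pr p<q q<r refl using (eval-zeroDivisorGraph; prime>1)
  1≤a : 1 ≤ a
  1≤a = ℕ.s≤s⁻¹ (prime>1 pp)
  a<b : a < b
  a<b = ℕ.s≤s⁻¹ p<q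
  b<c : b < c
  b<c = ℕ.s≤s⁻¹ q<r
  e₁≡ : e₁ a b c ≡ a ℕ.* (suc b ℕ.+ suc c ∸ 2)
  e₁≡ = cong (λ k → a ℕ.* (k ∸ 1)) (sym (ℕP.+-suc b c))
  open Annulus.Zeros 1≤a a<b b<c
    (map natural (independenceCoefficients (zeroDivisorGraph (suc a ℕ.* suc b ℕ.* suc c))))
    (independencePolynomial (zeroDivisorGraph (suc a ℕ.* suc b ℕ.* suc c)))
    (map-at-independencePolynomial (zeroDivisorGraph (suc a ℕ.* suc b ℕ.* suc c)))
    eval-zeroDivisorGraph
    renaming (multiplicity to multiplicity′; annulus to annulus′)
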